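{- There is a nondeterministic algorithm which, on input a directed graph $G=(V,E)$ on $n$ vertices together with two vertices $s,t$, has exactly one computation path that does not halt and reject; along that unique path it outputs an $O(\log^2 n)$-bit weight function $W : E \to \mathbb{N}_{>0}$ such that $G_W$ is min-unique, and it also outputs whether there is a directed path from $s$ to $t$ in $G$. The algorithm uses $O(\log^2 n)$ space and runs in time polynomial in $n$.
   Context: A weight function on a directed graph $G=(V,E)$ is a map $w:E\to\mathbb{N}_{>0}$; it is $b$-bit if every value is representable with $b$ bits. $G_w$ denotes $G$ weighted by $w$; the weight $w(P)$ of a path $P$ is the sum of the weights of its edges, and the length $\mathrm{len}(P)$ is its number of edges. For vertices $u,v$ and integer $i\ge 0$, let $\mathcal{P}^i_w(u,v)$ be the set of paths from $u$ to $v$ of length at most $i$ that have minimum weight among all paths from $u$ to $v$ of length at most $i$. $G_w$ is min-unique for paths of length at most $i$ if $|\mathcal{P}^i_w(u,v)|\le 1$ for every pair of vertices $u,v$; $G_w$ is min-unique if it is min-unique for paths of arbitrary length (equivalently, of length at most $n$), i.e. between every pair of vertices the minimum-weight path is unique. -}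

module Defs where

open import Data.Bool.Base using (Bool; T; if_then_else_)
open import Data.Bool.Properties using (T?)
open import Data.Digit using (Bit; 0b; 1b; fromDigits)
open import Data.Fin.Base using (Fin; toℕ)
open import Data.List.Base using (List; []; _∷_; [_]; _++_; length; map; concatMap; replicate; allFin; cartesianProduct; mapMaybe)
open import Data.List.Membership.Propositional using (_∈_)
open import Data.List.NonEmpty.Base using (List⁺; toList)
open import Data.Maybe.Base using (Maybe; fromMaybe)
import Data.Maybe.Base as Maybe
open import Data.Nat.Base using (ℕ; zero; suc; pred; _+_; _*_; _^_; _≤_; _<_; _⊓_)
open import Data.Nat.Logarithm using (⌈log₂_⌉)
open import Data.Product.Base using (_×_; _,_; ∃₂; ∃-syntax; Σ-syntax)
open import Data.Vec.Base using (Vec)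
import Data.Vec.Base as Vec
open import Function.Bundles using (_↔_)
open import Relation.Binary.Construct.Closure.ReflexiveTransitive using (Star; fold)
open import Relation.Binary.PropositionalEquality using (_≡_)
open import Relation.Nullary.Decidable.Core using (dec⇒maybe)

_∈O_ : (ℕ → ℕ) → (ℕ → ℕ) → Set
f ∈O g = ∃[ c ] ∃[ n₀ ] (∀ n → n₀ ≤ n → f n ≤ c * g n)

log² : ℕ → ℕ
log² n = ⌈log₂ n ⌉ ^ 2

PolynomiallyBounded : (ℕ → ℕ) → Set
PolynomiallyBounded f = ∃[ k ] f ∈O (_^ k)

Digraph : ℕ → Set
Digraph n = Fin n → Fin n → Bool

Edge : ∀ {n} → Digraph n → Fin n → Fin n → Set
Edge G u v = T (G u v)

-- Paths may repeat vertices.  As weights are positive, a minimum-weight path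
-- never does, so this choice does not affect min-uniqueness.
Path : ∀ {n} → Digraph n → Fin n → Fin n → Set
Path G = Star (Edge G)

record WeightFunction {n} (G : Digraph n) : Set where
  field
    weight   : ∀ {u v} → Edge G u v → ℕ
    positive : ∀ {u v} (e : Edge G u v) → 0 < weight e

open WeightFunction public

RepresentableWith : ℕ → ℕ → Set
RepresentableWith b x = ∃[ ds ] (length ds ≡ b × fromDigits {2} ds ≡ x)

_-bit_ : ∀ {n} {G : Digraph n} → ℕ → WeightFunction G → Set
_-bit_ {G = G} b w = ∀ {u v} (e : Edge G u v) → RepresentableWith b (weight w e)

pathWeight : ∀ {n} {G : Digraph n} → WeightFunction G → ∀ {u v} → Path G u v → ℕ
pathWeight w = fold (λ _ _ → ℕ) (λ e k → weight w e + k) 0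

IsMinimum : ∀ {n} {G : Digraph n} → WeightFunction G → ∀ {u v} → Path G u v → Set
IsMinimum {G = G} w {u} {v} p = (q : Path G u v) → pathWeight w p ≤ pathWeight w q

MinUnique : ∀ {n} (G : Digraph n) → WeightFunction G → Set
MinUnique G w = ∀ {u v} (p q : Path G u v) → IsMinimum w p → IsMinimum w q → p ≡ q

-- The model of computation is the nondeterministic Turing machine with a
-- two-way read-only input tape, several two-way infinite work tapes, and a
-- one-way write-only output tape; space counts visited work-tape cells only.

data Letter : Set where
  bit : Bit → Letter
  sep : Letter

data InputCell : Set where
  ⊢ ⊣    : InputCell
  letter : Letter → InputCell

data Direction : Set where
  left stay right : Direction

data Control (Q : Set) : Set where
  run    : Q → Control Q
  accept : Control Q
  reject : Control Q

record Move (Q Γ : Set) (k : ℕ) : Set where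
  field
    next      : Control Q
    inputMove : Direction
    workMoves : Vec (Γ × Direction) k
    emit      : Maybe Letter

record Machine : Set₁ where
  field
    State       : Set
    stateCount  : ℕ
    stateFinite : State ↔ Fin stateCount
    start       : State
    Symbol       : Set
    symbolCount  : ℕ
    symbolFinite : Symbol ↔ Fin symbolCount
    blank        : Symbol
    tapeCount : ℕ
    -- All possible moves.  The list is nonempty, so a computation path can
    -- only end in accept or reject.
    δ : State → InputCell → Vec Symbol tapeCount → List⁺ (Move State Symbol tapeCount)

-- The cells visited so far: those left of the head (nearest first), the
-- scanned one, and those right of the head (nearest first).
record Tape (Γ : Set) : Set where
  constructor tape
  field
    before  : List Γ
    scanned : Γ
    after   : List Γ

open Tape public

tapeSize : ∀ {Γ} → Tape Γ → ℕ
tapeSize t = length (before t) + suc (length (after t))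

inputCell : List Letter → ℕ → InputCell
inputCell x zero = ⊢
inputCell x (suc i) = go x i
  where
  go : List Letter → ℕ → InputCell
  go []       _       = ⊣
  go (l ∷ _)  zero    = letter l
  go (_ ∷ ls) (suc j) = go ls j

-- Position 0 holds ⊢ and position 1 + length x holds ⊣; the head stays between them.
moveInput : List Letter → Direction → ℕ → ℕ
moveInput x left  h = pred h
moveInput x stay  h = h
moveInput x right h = suc h ⊓ suc (length x)

module _ (M : Machine) where
  open Machine M

  shift : Direction → Tape Symbol → Tape Symbol
  shift stay  t                   = t
  shift left  (tape []       a r) = tape [] blank (a ∷ r)
  shift left  (tape (b ∷ l)  a r) = tape l b (a ∷ r)
  shift right (tape l a [])       = tape (a ∷ l) blank []
  shift right (tape l a (b ∷ r))  = tape (a ∷ l) b r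

  writeAndShift : Symbol × Direction → Tape Symbol → Tape Symbol
  writeAndShift (a , d) t = shift d (record t { scanned = a })

  record Configuration : Set where
    constructor configuration
    field
      control   : Control State
      inputHead : ℕ
      workTapes : Vec (Tape Symbol) tapeCount
      output    : List Letter

  open Configuration public

  initial : Configuration
  initial = configuration (run start) 0 (Vec.replicate tapeCount (tape [] blank [])) []

  space : Configuration → ℕ
  space c = Vec.sum (Vec.map tapeSize (workTapes c))

  module _ (x : List Letter) where

    perform : Configuration → Move State Symbol tapeCount → Configuration
    perform c m = configuration
      (Move.next m)
      (moveInput x (Move.inputMove m) (inputHead c))
      (Vec.zipWith writeAndShift (Move.workMoves m) (workTapes c))
      (output c ++ fromMaybe [] (Maybe.map [_] (Move.emit m)))

    successors : Configuration → List Configuration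
    successors c with control c
    ... | run q  = map (perform c) (toList (δ q (inputCell x (inputHead c)) (Vec.map scanned (workTapes c))))
    ... | accept = []
    ... | reject = []

    -- Membership proofs record which list entry is chosen, so different
    -- nondeterministic choices are different steps even if they lead to the
    -- same configuration.
    Step : Configuration → Configuration → Set
    Step c c′ = c′ ∈ successors c

    Run : Configuration → Set
    Run = Star Step initial

    steps : ∀ {c} → Run c → ℕ
    steps = fold (λ _ _ → ℕ) (λ _ k → suc k) 0

    -- The time and space bounds apply to every computation path, and the
    -- time bound also excludes infinite ones.
    RunsWithin : ℕ → ℕ → Set
    RunsWithin time memory = ∀ {c} (r : Run c) → steps r ≤ time × space c ≤ memory

    record AcceptingPath : Set where
      field
        final   : Configuration
        path    : Run final
        accepts : control final ≡ accept

    result : AcceptingPath → List Letter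
    result p = output (AcceptingPath.final p)

unary : ℕ → List Letter
unary k = replicate k (bit 1b) ++ [ sep ]

boolLetter : Bool → Letter
boolLetter b = bit (if b then 1b else 0b)

-- 1ⁿ # 1ˢ # 1ᵗ # followed by the rows of the adjacency matrix, each ending in #.
encodeInput : ∀ {n} → Digraph n → Fin n → Fin n → List Letter
encodeInput {n} G s t =
  unary n ++ unary (toℕ s) ++ unary (toℕ t)
  ++ concatMap (λ u → map (λ v → boolLetter (G u v)) (allFin n) ++ [ sep ]) (allFin n)

-- In lexicographic order.
edges : ∀ {n} (G : Digraph n) → List (∃₂ (Edge G))
edges {n} G = mapMaybe edgeAt (cartesianProduct (allFin n) (allFin n))
  where
  edgeAt : Fin n × Fin n → Maybe (∃₂ (Edge G))
  edgeAt (u , v) = Maybe.map (λ e → u , v , e) (dec⇒maybe (T? (G u v)))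

-- The output lists, for the edges in order, a binary numeral for the weight
-- (least significant bit first, zero padding allowed) ending in #, and then
-- one bit for the answer.
EncodesOutput : ∀ {n} {G : Digraph n} → List Letter → WeightFunction G → Bool → Set
EncodesOutput {G = G} y w answer =
  Σ[ numeral ∈ (∃₂ (Edge G) → List Bit) ]
    (∀ {u v} (e : Edge G u v) → fromDigits {2} (numeral (u , v , e)) ≡ weight w e)
    × y ≡ concatMap (λ e → map bit (numeral e) ++ [ sep ]) (edges G) ++ [ boolLetter answer ]

{-# OPTIONS --safe #-}
module Submission where

-- A weight function is built in about log n rounds, starting from the constant 1
-- and refining w to w(x) · B + (2ˣ mod m) for a well-chosen modulus m.  Minimum
-- weight walks stay shortest walks.  If w has unique minimum walks up to length R,
-- a minimum walk of length at most 2R is determined by its endpoints and its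
-- midpoint, so there are polynomially many candidates.  They have distinct values
-- of Σ 2ˣ, and an m not dividing the product of the differences separates them.
-- Since 1, …, 2k + 1 have no common multiple below 2ᵏ, a polynomially bounded m
-- exists.  The least m is found by testing uniqueness from every source by
-- double inductive counting (Reinhardt and Allender): the number of vertices at
-- distance at most d and the sum of their minimum weights are known, so guessing
-- those vertices together with walks to them survives the comparison in exactly
-- one way, and the minimum walks of length d + 1 and their ties are read off from
-- this enumeration by Bellman's recursion.
--
-- The procedure is a program for 45 registers, kept on one work tape whose i-th
-- cell holds the i-th bits of all registers, so that an instruction is one sweep.

open import Defs
open import Data.Bool.Base using (Bool; true; false; not; _∧_; _∨_; _xor_; if_then_else_; T)
import Data.Bool.Properties as Bool
open import Data.Bool.Properties using (T?; T-irrelevant)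
open import Data.Digit using (Bit; 0b; 1b; fromDigits)
open import Data.Empty using (⊥; ⊥-elim)
open import Data.Fin.Base using (Fin; zero; suc; toℕ; fromℕ<)
open import Data.Fin.Patterns
open import Data.Fin.Properties using (0↔⊥; 1↔⊤; 2↔Bool; +↔⊎; *↔×; toℕ<n; toℕ-fromℕ<; fromℕ<-toℕ; toℕ-injective)
import Data.Fin.Properties as Fin
open import Data.List.Base using (List; []; _∷_; [_]; _++_; length; map; _ʳ++_; concatMap; take; replicate; tabulate; allFin; cartesianProduct; mapMaybe)
import Data.List.Properties as List
open import Data.List.Membership.Propositional using (_∈_)
open import Data.List.NonEmpty.Base using (List⁺; toList) renaming (_∷_ to _∷⁺_)
open import Data.List.Relation.Unary.Any using (here; there)
open import Data.Maybe.Base using (Maybe; just; nothing; fromMaybe)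
import Data.Maybe.Base as Maybe
open import Data.Nat.Base using (ℕ; zero; suc; pred; _+_; _*_; _∸_; _^_; _≤_; _<_; _<ᵇ_; _≡ᵇ_; z≤n; s≤s; s≤s⁻¹; ∣_-_∣; NonZero; >-nonZero)
open import Data.Nat.Divisibility using (_∣_; divides; ∣⇒≤; ∣-trans; n∣m*n; ∣m⇒∣m*n; _∣?_)
open import Data.Nat.Logarithm using (⌈log₂_⌉; ⌈log₂⌉-mono-≤; ⌈log₂2*n⌉≡1+⌈log₂n⌉; ⌈log₂2^n⌉≡n)
open import Data.Nat.Properties
open import Data.Nat.Tactic.RingSolver using (solve-∀)
open import Data.Product.Base using (_×_; _,_; proj₁; proj₂; ∃₂; ∃-syntax; Σ-syntax)
open import Data.Product.Function.NonDependent.Propositional using (_×-↔_)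
open import Data.Sum.Base using (_⊎_; inj₁; inj₂)
open import Data.Sum.Function.Propositional using (_⊎-↔_)
open import Data.Unit.Base using (⊤; tt)
open import Data.Vec.Base using (Vec; []; _∷_)
import Data.Vec.Base as Vec
open import Function.Base using (_∘_; id)
open import Function.Bundles using (_↔_; _⇔_; mk⇔)
open import Function.Properties.Inverse using (↔-sym; ↔-trans)
open import Relation.Binary.Construct.Closure.ReflexiveTransitive using (Star; ε; _◅_; fold)
open import Relation.Binary.PropositionalEquality using (_≡_; _≢_; refl; sym; trans; cong; cong₂; subst; subst₂; module ≡-Reasoning)
open import Relation.Nullary using (¬_; Dec; yes; no; contradiction)
open import Relation.Nullary.Decidable.Core using (dec⇒maybe)

-- A number divisible by all of 1, …, 2k + 1 is at least 2ᵏ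

-- The obstacle is that guessing is unambiguous only for weights already known to be min-unique,
-- whereas many of the moduli tried are bad, and a bad modulus must not make the machine reject,
-- since then no path would accept. So uniqueness is tested one distance at a time: a ball is
-- enumerated only after uniqueness has been established within it, and failure then shows up as a
-- tie between two best predecessors, after which the rest of the test is passed through without
-- guessing. Weights are never tabulated. Each round contributes one modulus of O(log n) bits, the
-- list of moduli takes O(log² n) bits, and a weight is recomputed from it whenever it is needed. A
-- refinement puts the new value into a fresh low digit: the hashes along fewer than n edges sum to
-- less than the base, so a later round cannot undo an earlier decision. A weight depends only on
-- the vertex that an edge enters. A walk is therefore a list of vertices, and one kind of sum
-- serves for its weight, its length and its sum of powers of two.

binomial : ℕ → ℕ → ℕ
binomial n       zero    = 1
binomial zero    (suc k) = 0
binomial (suc n) (suc k) = binomial n k + binomial n (suc k)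

absorption : ∀ n k → suc k * binomial (suc n) (suc k) ≡ suc n * binomial n k
absorption zero    zero    = refl
absorption zero    (suc k) = *-zeroʳ k
absorption (suc n) zero    = begin
  1 * (1 + binomial (suc n) 1)      ≡⟨ l₁ (binomial (suc n) 1) ⟩
  1 + 1 * binomial (suc n) 1        ≡⟨ cong suc (absorption n 0) ⟩
  1 + suc n * 1                     ≡⟨ l₂ n ⟩
  suc (suc n) * 1                   ∎
  where
  open ≡-Reasoning
  l₁ : ∀ a → 1 * (1 + a) ≡ 1 + 1 * a
  l₁ = solve-∀
  l₂ : ∀ n → 1 + suc n * 1 ≡ suc (suc n) * 1
  l₂ = solve-∀
absorption (suc n) (suc k) = begin
  suc (suc k) * (b₁ + b₂)                ≡⟨ l₁ k b₁ b₂ ⟩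
  b₁ + (suc k * b₁ + suc (suc k) * b₂)   ≡⟨ cong (b₁ +_) (cong₂ _+_ (absorption n k) (absorption n (suc k))) ⟩
  b₁ + (suc n * binomial n k + suc n * binomial n (suc k)) ≡⟨ l₂ n (binomial n k) (binomial n (suc k)) ⟩
  suc (suc n) * (binomial n k + binomial n (suc k)) ∎
  where
  open ≡-Reasoning
  b₁ = binomial (suc n) (suc k)
  b₂ = binomial (suc n) (suc (suc k))
  l₁ : ∀ k a b → suc (suc k) * (a + b) ≡ a + (suc k * a + suc (suc k) * b)
  l₁ = solve-∀
  l₂ : ∀ n a b → a + b + (suc n * a + suc n * b) ≡ suc (suc n) * (a + b)
  l₂ = solve-∀

binomial-pos : ∀ {n k} → k ≤ n → 0 < binomial n k
binomial-pos {n}     {zero}  _       = s≤s z≤n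
binomial-pos {suc n} {suc k} k≤n = <-≤-trans (binomial-pos (s≤s⁻¹ k≤n)) (m≤m+n _ _)

-- The denominators of Leibniz' harmonic triangle.
leibniz : ℕ → ℕ → ℕ
leibniz n k = suc n * binomial n k

leibniz-pos : ∀ {n k} → k ≤ n → 0 < leibniz n k
leibniz-pos {n} {k} k≤n = <-≤-trans (binomial-pos k≤n) (m≤n*m (binomial n k) (suc n))

-- 1 / leibniz n k = 1 / leibniz (n + 1) k + 1 / leibniz (n + 1) (k + 1)
leibniz-sum : ∀ n k → leibniz n k * (leibniz (suc n) k + leibniz (suc n) (suc k)) ≡ leibniz (suc n) k * leibniz (suc n) (suc k)
leibniz-sum n k = begin
  suc n * c₀ * (suc (suc n) * c₁ + suc (suc n) * c₂) ≡⟨ cong (_* (suc (suc n) * c₁ + suc (suc n) * c₂)) (sym (absorption n k)) ⟩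
  suc k * c₂ * (suc (suc n) * c₁ + suc (suc n) * c₂) ≡⟨ l₁ n k c₁ c₂ ⟩
  suc (suc n) * c₂ * (suc k * (c₁ + c₂))             ≡⟨ cong (suc (suc n) * c₂ *_) (absorption (suc n) k) ⟩
  suc (suc n) * c₂ * (suc (suc n) * c₁)              ≡⟨ *-comm (suc (suc n) * c₂) _ ⟩
  suc (suc n) * c₁ * (suc (suc n) * c₂)              ∎
  where
  open ≡-Reasoning
  c₀ = binomial n k
  c₁ = binomial (suc n) k
  c₂ = binomial (suc n) (suc k)
  l₁ : ∀ n k c₁ c₂ → suc k * c₂ * (suc (suc n) * c₁ + suc (suc n) * c₂) ≡ suc (suc n) * c₂ * (suc k * (c₁ + c₂))
  l₁ = solve-∀

-- The equation says 1/a = 1/b + 1/c, so X/c = X/a - X/b is an integer. The witness `q ∸ r` is that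
-- difference, and `key` rules out truncation.
∣-from-reciprocals : ∀ {a b c X} → 0 < a → 0 < b → a * (b + c) ≡ b * c → a ∣ X → b ∣ X → c ∣ X
∣-from-reciprocals {a} {b} {c} {X} a>0 b>0 e (divides q X≡qa) (divides r X≡rb) = divides (q ∸ r) X≡
  where
  open ≡-Reasoning
  instance
    a≢0 : NonZero a
    a≢0 = >-nonZero a>0
    b≢0 : NonZero b
    b≢0 = >-nonZero b>0
  l₁ : ∀ q c a b → q * c * (a * b) ≡ q * a * (b * c)
  l₁ = solve-∀
  l₂ : ∀ X r a b c → X * (a * (b + c)) ≡ X * a * b + X * (a * c)
  l₂ = solve-∀
  l₃ : ∀ r a b c → r * b * (a * c) ≡ r * c * (a * b)
  l₃ = solve-∀
  l₄ : ∀ X a b → X * a * b ≡ X * (a * b)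
  l₄ = solve-∀
  -- (q - r) c = X, multiplied by a b
  key : q * c ≡ X + r * c
  key = *-cancelʳ-≡ (q * c) (X + r * c) (a * b) {{m*n≢0 a b}} (begin
    q * c * (a * b)                  ≡⟨ l₁ q c a b ⟩
    q * a * (b * c)                  ≡⟨ cong₂ _*_ (sym X≡qa) (sym e) ⟩
    X * (a * (b + c))                ≡⟨ l₂ X r a b c ⟩
    X * a * b + X * (a * c)          ≡⟨ cong₂ _+_ (l₄ X a b) (cong (_* (a * c)) X≡rb) ⟩
    X * (a * b) + r * b * (a * c)    ≡⟨ cong (X * (a * b) +_) (l₃ r a b c) ⟩
    X * (a * b) + r * c * (a * b)    ≡⟨ sym (*-distribʳ-+ (a * b) X (r * c)) ⟩
    (X + r * c) * (a * b)            ∎)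
  X≡ : X ≡ (q ∸ r) * c
  X≡ = sym (trans (*-distribʳ-∸ c q r) (trans (cong (_∸ r * c) key) (m+n∸n≡m X (r * c))))

-- Column 0 of the triangle consists of the numbers n + 1 themselves, and `leibniz-sum` obtains each
-- further entry from two entries of the column before it, in its own row and in the row above.
leibniz-∣ : ∀ {X N} → (∀ m → 0 < m → m ≤ N → m ∣ X) → ∀ k n → k ≤ n → n < N → leibniz n k ∣ X
leibniz-∣ {X} all zero    n k≤n n<N = subst (_∣ X) (sym (*-identityʳ (suc n))) (all (suc n) (s≤s z≤n) n<N)
leibniz-∣ all (suc k) (suc n) k<n n<N = ∣-from-reciprocals {leibniz n k} {leibniz (suc n) k}
  (leibniz-pos (s≤s⁻¹ k<n))
  (leibniz-pos (m≤n⇒m≤1+n (s≤s⁻¹ k<n)))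
  (leibniz-sum n k)
  (leibniz-∣ all k n (s≤s⁻¹ k<n) (<-trans (n<1+n n) n<N))
  (leibniz-∣ all k (suc n) (m≤n⇒m≤1+n (s≤s⁻¹ k<n)) n<N)

binomial-mono : ∀ n k → binomial n k ≤ binomial (suc n) k
binomial-mono n zero    = ≤-refl
binomial-mono n (suc k) = m≤n+m _ _

-- Both Pascal summands of C(2k + 2, k + 1) are at least C(2k, k), so each step doubles the bound.
central-binomial : ∀ k → 2 ^ k ≤ binomial (k + k) k
central-binomial zero    = ≤-refl
central-binomial (suc k) = subst (λ m → 2 ^ suc k ≤ binomial (suc m) (suc k)) (sym (+-suc k k))
  (+-mono-≤ (≤-trans ih (binomial-mono (k + k) k))
    (≤-trans (≤-reflexive (+-identityʳ _)) (≤-trans ih (m≤m+n _ _))))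
  where ih = central-binomial k

lcm-bound : ∀ k {X} → 0 < X → (∀ m → 0 < m → m ≤ suc (k + k) → m ∣ X) → 2 ^ k ≤ X
lcm-bound k {X} X>0 all = ≤-trans (central-binomial k) (≤-trans (m≤n*m (binomial (k + k) k) (suc (k + k)))
  (∣⇒≤ {{>-nonZero X>0}} (leibniz-∣ all k (k + k) (m≤m+n k k) ≤-refl)))

-- `lcm-bound` only refutes that all m divide X. As divisibility is decidable, a bounded search
-- turns the refutation into a witness.
nonDivisor : ∀ k {X} → 0 < X → X < 2 ^ k → ∃[ m ] (0 < m × m ≤ suc (k + k) × ¬ (m ∣ X))
nonDivisor k {X} X>0 X< = search (suc (k + k)) (λ all → <⇒≱ X< (lcm-bound k X>0 all))
  where
  search : ∀ N → ¬ (∀ m → 0 < m → m ≤ N → m ∣ X) → ∃[ m ] (0 < m × m ≤ N × ¬ (m ∣ X))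
  search zero    ¬all = contradiction (λ m m>0 m≤0 → contradiction (<-≤-trans m>0 m≤0) λ()) ¬all
  search (suc N) ¬all with suc N ∣? X
  ... | no ∤X  = suc N , s≤s z≤n , ≤-refl , ∤X
  ... | yes ∣X = let m , m>0 , m≤ , ∤X = search N (λ all → ¬all (extend all)) in m , m>0 , m≤n⇒m≤1+n m≤ , ∤X
    where
    extend : (∀ m → 0 < m → m ≤ N → m ∣ X) → ∀ m → 0 < m → m ≤ suc N → m ∣ X
    extend all m m>0 m≤ with m≤n⇒m<n∨m≡n m≤
    ... | inj₁ m<    = all m m>0 (s≤s⁻¹ m<)
    ... | inj₂ refl = ∣X

n<2^n : ∀ n → n < 2 ^ n
n<2^n zero    = s≤s z≤n
n<2^n (suc n) = ≤-trans (+-mono-≤ (m^n>0 2 n) (n<2^n n)) (+-monoʳ-≤ (2 ^ n) (m≤m+n _ 0))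

productTo : ℕ → (ℕ → ℕ) → ℕ
productTo zero    f = 1
productTo (suc n) f = productTo n f * f n

∣-productTo : ∀ {n i} f → i < n → f i ∣ productTo n f
∣-productTo {suc n} {i} f i<n with m≤n⇒m<n∨m≡n i<n
... | inj₁ i<    = ∣m⇒∣m*n (f n) (∣-productTo f (s≤s⁻¹ i<))
... | inj₂ refl = n∣m*n (productTo n f)

productTo-pos : ∀ n {f} → (∀ i → 0 < f i) → 0 < productTo n f
productTo-pos zero    f>0 = s≤s z≤n
productTo-pos (suc n) f>0 = *-mono-≤ (productTo-pos n f>0) (f>0 n)

productTo-≤ : ∀ n {f e} → (∀ i → i < n → f i ≤ 2 ^ e) → productTo n f ≤ 2 ^ (n * e)
productTo-≤ zero    f≤ = ≤-refl
productTo-≤ (suc n) {f} {e} f≤ = ≤-trans (*-mono-≤ (productTo-≤ n (λ i i<n → f≤ i (m≤n⇒m≤1+n i<n))) (f≤ n ≤-refl))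
  (≤-reflexive (trans (sym (^-distribˡ-+-* 2 (n * e) e)) (cong (2 ^_) (+-comm (n * e) e))))

-- Multisets of numbers as digit sequences

δᵢ : ℕ → ℕ → ℕ
δᵢ x i = if x ≡ᵇ i then 1 else 0

occurrences : List ℕ → ℕ → ℕ
occurrences []       i = 0
occurrences (x ∷ xs) i = δᵢ x i + occurrences xs i

-- Base 2 gives binary numerals, which determine their 0/1 digits. Base 1 merely adds the digits up,
-- so the same lemmas also yield the counting bound `Distinct-length`.
digits : ℕ → (ℕ → ℕ) → ℕ → ℕ
digits b a zero    = 0
digits b a (suc n) = a 0 + b * digits b (a ∘ suc) n

digits-zero : ∀ b n → digits b (λ _ → 0) n ≡ 0
digits-zero b zero    = refl
digits-zero b (suc n) = trans (cong (b *_) (digits-zero b n)) (*-zeroʳ b)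

digits-bump : ∀ b n x a → x < n → digits b (λ i → δᵢ x i + a i) n ≡ b ^ x + digits b a n
digits-bump b (suc n) zero    a x<n = refl
digits-bump b (suc n) (suc x) a x<n = trans (cong (λ d → a 0 + b * d) (digits-bump b n x (a ∘ suc) (s≤s⁻¹ x<n)))
  (l (a 0) b (b ^ x) (digits b (a ∘ suc) n))
  where
  l : ∀ a b p d → a + b * (p + d) ≡ b * p + (a + b * d)
  l = solve-∀

digits-≤ : ∀ n a → (∀ i → a i ≤ 1) → digits 1 a n ≤ n
digits-≤ zero    a a≤ = z≤n
digits-≤ (suc n) a a≤ = +-mono-≤ (a≤ 0) (≤-trans (≤-reflexive (+-identityʳ _)) (digits-≤ n (a ∘ suc) (a≤ ∘ suc)))

digits-injective : ∀ n a b → (∀ i → a i ≤ 1) → (∀ i → b i ≤ 1) → digits 2 a n ≡ digits 2 b n → ∀ i → i < n → a i ≡ b i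
digits-injective (suc n) a b a≤ b≤ e with a 0 in ea | b 0 in eb | a≤ 0 | b≤ 0
... | 0 | 0 | _ | _ = λ where
  zero    _   → trans ea (sym eb)
  (suc i) i<n → digits-injective n (a ∘ suc) (b ∘ suc) (a≤ ∘ suc) (b≤ ∘ suc) (*-cancelˡ-≡ _ _ 2 e) i (s≤s⁻¹ i<n)
... | 1 | 1 | _ | _ = λ where
  zero    _   → trans ea (sym eb)
  (suc i) i<n → digits-injective n (a ∘ suc) (b ∘ suc) (a≤ ∘ suc) (b≤ ∘ suc) (*-cancelˡ-≡ _ _ 2 (suc-injective e)) i (s≤s⁻¹ i<n)
... | 0 | 1 | _ | _ = contradiction e (even≢odd (digits 2 (a ∘ suc) n) (digits 2 (b ∘ suc) n))
... | 1 | 0 | _ | _ = contradiction (sym e) (even≢odd (digits 2 (b ∘ suc) n) (digits 2 (a ∘ suc) n))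
... | suc (suc _) | _ | s≤s () | _
... | 0 | suc (suc _) | _ | s≤s ()
... | 1 | suc (suc _) | _ | s≤s ()

wsum : (ℕ → ℕ) → List ℕ → ℕ
wsum w []       = 0
wsum w (x ∷ xs) = w x + wsum w xs

wsum-++ : ∀ w xs ys → wsum w (xs ++ ys) ≡ wsum w xs + wsum w ys
wsum-++ w []       ys = refl
wsum-++ w (x ∷ xs) ys = trans (cong (w x +_) (wsum-++ w xs ys)) (sym (+-assoc (w x) _ _))

wsum-≤ : ∀ w c xs → (∀ x → w x ≤ c) → wsum w xs ≤ length xs * c
wsum-≤ w c []       w≤ = z≤n
wsum-≤ w c (x ∷ xs) w≤ = +-mono-≤ (w≤ x) (wsum-≤ w c xs w≤)

wsum-one : ∀ xs → wsum (λ _ → 1) xs ≡ length xs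
wsum-one []       = refl
wsum-one (x ∷ xs) = cong suc (wsum-one xs)

data AllBelow (n : ℕ) : List ℕ → Set where
  []  : AllBelow n []
  _∷_ : ∀ {x xs} → x < n → AllBelow n xs → AllBelow n (x ∷ xs)

wsum-digits : ∀ b {n xs} → AllBelow n xs → wsum (b ^_) xs ≡ digits b (occurrences xs) n
wsum-digits b {n} []            = sym (digits-zero b n)
wsum-digits b {n} {x ∷ xs} (x< ∷ xs<) = trans (cong (b ^ x +_) (wsum-digits b xs<)) (sym (digits-bump b n x (occurrences xs) x<))

Distinct : List ℕ → Set
Distinct xs = ∀ i → occurrences xs i ≤ 1

δᵢ-self : ∀ x → δᵢ x x ≡ 1
δᵢ-self zero    = refl
δᵢ-self (suc x) = δᵢ-self x

δᵢ-other : ∀ {x y} → x ≢ y → δᵢ x y ≡ 0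
δᵢ-other {zero}  {zero}  x≢y = contradiction refl x≢y
δᵢ-other {zero}  {suc y} x≢y = refl
δᵢ-other {suc x} {zero}  x≢y = refl
δᵢ-other {suc x} {suc y} x≢y = δᵢ-other (x≢y ∘ cong suc)

Distinct-∷ : ∀ {x xs} → occurrences xs x ≡ 0 → Distinct xs → Distinct (x ∷ xs)
Distinct-∷ {x} {xs} ∉ d i with x ≟ i
... | yes refl = ≤-reflexive (trans (cong₂ _+_ (δᵢ-self x) ∉) refl)
... | no x≢i   = ≤-trans (≤-reflexive (cong (_+ occurrences xs i) (δᵢ-other x≢i))) (d i)

Distinct-length : ∀ {n xs} → AllBelow n xs → Distinct xs → length xs ≤ n
Distinct-length {n} {xs} xs< d = ≤-trans (≤-reflexive (trans (sym (ones xs)) (wsum-digits 1 xs<))) (digits-≤ n _ d)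
  where
  ones : ∀ xs → wsum (1 ^_) xs ≡ length xs
  ones []       = refl
  ones (x ∷ xs) = cong₂ _+_ (^-zeroˡ x) (ones xs)

occurrence : ∀ xs i → occurrences xs i ≢ 0 → ∃[ ys ] ∃[ zs ] (xs ≡ ys ++ i ∷ zs)
occurrence []       i ≢0 = contradiction refl ≢0
occurrence (x ∷ xs) i ≢0 with x ≟ i
... | yes refl = [] , xs , refl
... | no x≢i   = let ys , zs , e = occurrence xs i (λ e → ≢0 (trans (cong (_+ occurrences xs i) (δᵢ-other x≢i)) e))
                 in x ∷ ys , zs , cong (x ∷_) e

Distinct-suffix : ∀ ys {zs} → Distinct (ys ++ zs) → Distinct zs
Distinct-suffix []       d = d
Distinct-suffix (y ∷ ys) d = Distinct-suffix ys (λ i → ≤-trans (m≤n+m _ (δᵢ y i)) (d i))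

below-suc : ∀ {k} {Q : ℕ → Set} → (∀ y → y < k → Q y) → Q k → ∀ y → y < suc k → Q y
below-suc {k} q qk y y<k with m≤n⇒m<n∨m≡n y<k
... | inj₁ y<   = q y (s≤s⁻¹ y<)
... | inj₂ refl = qk

-- `P x a` reads: the value a is attained at x. Only the least value at each x has to be known.
argmin : ∀ k (P : ℕ → ℕ → Set) →
         (∀ x → (∃[ a ] (P x a × (∀ b → P x b → a ≤ b))) ⊎ (∀ b → ¬ P x b)) →
         (∃[ x ] ∃[ a ] (x < k × P x a × (∀ y → y < k → ∀ b → P y b → a ≤ b)))
         ⊎ (∀ y → y < k → ∀ b → ¬ P y b)
argmin zero    P dec = inj₂ (λ y ())
argmin (suc k) P dec with dec k | argmin k P dec
... | inj₂ ∄            | inj₁ (x , a , x<k , px , min) =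
  inj₁ (x , a , m≤n⇒m≤1+n x<k , px , below-suc min (λ b pb → contradiction pb (∄ b)))
... | inj₂ ∄            | inj₂ none = inj₂ (below-suc none ∄)
... | inj₁ (c , pc , m) | inj₂ none = inj₁ (k , c , ≤-refl , pc , below-suc (λ y y<k b pb → contradiction pb (none y y<k b)) m)
... | inj₁ (c , pc , m) | inj₁ (x , a , x<k , px , min) with ≤-total a c
...   | inj₁ a≤c = inj₁ (x , a , m≤n⇒m≤1+n x<k , px , below-suc min (λ b pb → ≤-trans a≤c (m b pb)))
...   | inj₂ c≤a = inj₁ (k , c , ≤-refl , pc , below-suc (λ y y<k b pb → ≤-trans c≤a (min y y<k b pb)) m)

-- The hash function x ↦ 2ˣ mod m, computed by repeated doubling.  For m = 1
-- the value is 1 instead of 0.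
hash : ℕ → ℕ → ℕ
reduce : ℕ → ℕ → ℕ
reduce m y = if m <ᵇ suc y then y ∸ m else y

hash m zero    = 1
hash m (suc x) = reduce m (hash m x + hash m x)

reduce-cases : ∀ m y → (m ≤ y × reduce m y ≡ y ∸ m) ⊎ (y < m × reduce m y ≡ y)
reduce-cases m y with m <ᵇ suc y in e
... | true  = inj₁ (s≤s⁻¹ (<ᵇ⇒< m (suc y) (subst Data.Bool.Base.T (sym e) _)) , refl)
... | false = inj₂ (≰⇒> (λ m≤y → subst Data.Bool.Base.T e (<⇒<ᵇ (s≤s m≤y))) , refl)

-- Both summands are at most m, so a single conditional subtraction brings the double back to at
-- most m. The bound cannot be strict because of m = 1.
hash-≤ : ∀ {m} → 0 < m → ∀ x → hash m x ≤ m
hash-≤ m>0 zero = m>0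
hash-≤ {m} m>0 (suc x) with reduce-cases m (hash m x + hash m x)
... | inj₁ (_ , e) = ≤-trans (≤-reflexive e) (≤-trans (∸-monoˡ-≤ m (+-mono-≤ (hash-≤ m>0 x) (hash-≤ m>0 x))) (≤-reflexive (m+n∸n≡m m m)))
... | inj₂ (y< , e) = ≤-trans (≤-reflexive e) (<⇒≤ y<)

-- Collisions are judged by this congruence alone, so it does no harm that the value for m = 1 is
-- not the least residue.
hash-congruent : ∀ m x → ∃[ q ] (hash m x + q * m ≡ 2 ^ x)
hash-congruent m zero = 0 , refl
hash-congruent m (suc x) with hash-congruent m x | reduce-cases m (hash m x + hash m x)
... | q , e | inj₁ (m≤y , r) = suc (q + q) , (begin
  reduce m (h + h) + suc (q + q) * m   ≡⟨ cong (_+ suc (q + q) * m) r ⟩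
  (h + h ∸ m) + suc (q + q) * m        ≡⟨ l₁ (h + h ∸ m) m q ⟩
  (h + h ∸ m + m) + (q + q) * m        ≡⟨ cong (_+ (q + q) * m) (m∸n+n≡m m≤y) ⟩
  h + h + (q + q) * m                  ≡⟨ l₂ h q m ⟩
  2 * (h + q * m)                      ≡⟨ cong (2 *_) e ⟩
  2 ^ suc x                            ∎)
  where
  open ≡-Reasoning
  h = hash m x
  l₁ : ∀ a m q → a + suc (q + q) * m ≡ a + m + (q + q) * m
  l₁ = solve-∀
  l₂ : ∀ h q m → h + h + (q + q) * m ≡ 2 * (h + q * m)
  l₂ = solve-∀
... | q , e | inj₂ (_ , r) = q + q , (begin
  reduce m (h + h) + (q + q) * m  ≡⟨ cong (_+ (q + q) * m) r ⟩
  h + h + (q + q) * m             ≡⟨ l₂ h q m ⟩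
  2 * (h + q * m)                 ≡⟨ cong (2 *_) e ⟩
  2 ^ suc x                       ∎)
  where
  open ≡-Reasoning
  h = hash m x
  l₂ : ∀ h q m → h + h + (q + q) * m ≡ 2 * (h + q * m)
  l₂ = solve-∀

wsum-hash : ∀ m xs → ∃[ q ] (wsum (hash m) xs + q * m ≡ wsum (2 ^_) xs)
wsum-hash m []       = 0 , refl
wsum-hash m (x ∷ xs) = let q , e = hash-congruent m x ; q′ , e′ = wsum-hash m xs in
  q + q′ , trans (l (hash m x) (wsum (hash m) xs) q q′ m) (cong₂ _+_ e e′)
  where
  l : ∀ a b q q′ m → a + b + (q + q′) * m ≡ (a + q * m) + (b + q′ * m)
  l = solve-∀

hash-collision : ∀ m xs ys → wsum (hash m) xs ≡ wsum (hash m) ys → m ∣ ∣ wsum (2 ^_) xs - wsum (2 ^_) ys ∣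
hash-collision m xs ys e = let q , e₁ = wsum-hash m xs ; q′ , e₂ = wsum-hash m ys in
  subst (m ∣_) (cong₂ ∣_-_∣ e₁ (trans (cong (_+ q′ * m) e) e₂))
    (divides ∣ q - q′ ∣ (trans (∣m+n-m+o∣≡∣n-o∣ (wsum (hash m) xs) (q * m) (q′ * m)) (sym (*-distribʳ-∣-∣ m q q′))))

refine : (base : ℕ) → (ℕ → ℕ) → ℕ → ℕ → ℕ
refine base w m x = w x * base + hash m x

wsum-refine : ∀ base w m xs → wsum (refine base w m) xs ≡ wsum w xs * base + wsum (hash m) xs
wsum-refine base w m []       = refl
wsum-refine base w m (x ∷ xs) = trans (cong (w x * base + hash m x +_) (wsum-refine base w m xs))
  (l (w x) base (hash m x) (wsum w xs) (wsum (hash m) xs))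
  where
  l : ∀ a b h c k → a * b + h + (c * b + k) ≡ (a + c) * b + (h + k)
  l = solve-∀

-- Walks, minimum walks, and isolation of minimum walks by hashing

module Walks (n : ℕ) (adj : ℕ → ℕ → Bool) (adj-< : ∀ {u v} → adj u v ≡ true → v < n) where

  -- The list holds the vertices entered, without the start: its length is the number of edges,
  -- `wsum w` charges every edge by its target, and concatenation of walks is concatenation of
  -- lists.
  data Walk : ℕ → List ℕ → ℕ → Set where
    []  : ∀ {u} → Walk u [] u
    _∷_ : ∀ {u x xs v} → adj u x ≡ true → Walk x xs v → Walk u (x ∷ xs) v

  walk-++ : ∀ {u xs a ys v} → Walk u xs a → Walk a ys v → Walk u (xs ++ ys) v
  walk-++ []      q = q
  walk-++ (e ∷ p) q = e ∷ walk-++ p q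

  walk-split : ∀ xs {u ys v} → Walk u (xs ++ ys) v → ∃[ a ] (Walk u xs a × Walk a ys v)
  walk-split []       p       = _ , [] , p
  walk-split (x ∷ xs) (e ∷ p) = let a , q , r = walk-split xs p in a , e ∷ q , r

  walk-suffix : ∀ xs {u a ys v} → Walk u (xs ++ a ∷ ys) v → Walk a ys v
  walk-suffix []       (_ ∷ p) = p
  walk-suffix (x ∷ xs) (_ ∷ p) = walk-suffix xs p

  walk-below : ∀ {u xs v} → Walk u xs v → AllBelow n xs
  walk-below []      = []
  walk-below (e ∷ p) = adj-< e ∷ walk-below p

  walk-end : ∀ {u xs v} → u < n → Walk u xs v → v < n
  walk-end u< []      = u<
  walk-end u< (e ∷ p) = walk-end (adj-< e) p

  walk-end-unique : ∀ {u xs v v′} → Walk u xs v → Walk u xs v′ → v ≡ v′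
  walk-end-unique []      []      = refl
  walk-end-unique (_ ∷ p) (_ ∷ q) = walk-end-unique p q

  -- If u occurs again, the cycle through u is cut off. The one resulting walk is no heavier for any
  -- weight function, so `refine-min` can use its weight and its length together.
  simplify : ∀ {u xs v} → Walk u xs v → ∃[ ys ] (Walk u ys v × Distinct (u ∷ ys) × (∀ w → wsum w ys ≤ wsum w xs))
  simplify {u} [] = [] , [] , Distinct-∷ {u} {[]} refl (λ _ → z≤n) , (λ w → z≤n)
  simplify {u} {x ∷ xs} (e ∷ p) with simplify p
  ... | ys , q , d , ws with occurrences (x ∷ ys) u ≟ 0
  ...   | yes ∉ = x ∷ ys , e ∷ q , Distinct-∷ {u} {x ∷ ys} ∉ d , λ w → +-monoʳ-≤ (w x) (ws w)
  ...   | no ∈  = let as , bs , eq = occurrence (x ∷ ys) u ∈ in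
    bs , walk-suffix as (subst (λ l → Walk u l _) eq (e ∷ q)) , Distinct-suffix as (subst Distinct eq d) ,
    λ w → ≤-trans (≤-trans (m≤n+m _ (w u)) (≤-trans (m≤n+m _ (wsum w as))
            (≤-reflexive (trans (sym (wsum-++ w as (u ∷ bs))) (cong (wsum w) (sym eq))))))
          (+-monoʳ-≤ (w x) (ws w))

  shorten : ∀ {u xs v} → u < n → Walk u xs v → ∃[ ys ] (Walk u ys v × length ys < n × (∀ w → wsum w ys ≤ wsum w xs))
  shorten u< p = let ys , q , d , ws = simplify p in ys , q , Distinct-length (u< ∷ walk-below q) d , ws

  Min : (ℕ → ℕ) → ℕ → List ℕ → ℕ → Set
  Min w u xs v = Walk u xs v × (∀ ys → Walk u ys v → wsum w xs ≤ wsum w ys)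

  Shortest : ℕ → List ℕ → ℕ → Set
  Shortest = Min (λ _ → 1)

  shortest-≤ : ∀ {u xs v} → Shortest u xs v → ∀ {ys} → Walk u ys v → length xs ≤ length ys
  shortest-≤ {xs = xs} (_ , min) {ys} q = subst₂ _≤_ (wsum-one xs) (wsum-one ys) (min ys q)

  min-prefix : ∀ {w u} xs {ys v a} → Min w u (xs ++ ys) v → Walk u xs a → Walk a ys v → Min w u xs a
  min-prefix {w} xs {ys} (_ , min) p q = p , λ zs r →
    +-cancelʳ-≤ (wsum w ys) _ _ (subst₂ _≤_ (wsum-++ w xs ys) (wsum-++ w zs ys) (min (zs ++ ys) (walk-++ r q)))

  min-suffix : ∀ {w u} xs {ys v a} → Min w u (xs ++ ys) v → Walk u xs a → Walk a ys v → Min w a ys v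
  min-suffix {w} xs {ys} (_ , min) p q = q , λ zs r →
    +-cancelˡ-≤ (wsum w xs) _ _ (subst₂ _≤_ (wsum-++ w xs ys) (wsum-++ w xs zs) (min (xs ++ zs) (walk-++ p r)))

  -- There may be infinitely many walks, so the minimum is found by recursion on a length bound,
  -- over the first vertex entered. `minimum` then removes the bound, since `shorten` brings every
  -- walk below n edges without raising its weight.
  bestWithin : ∀ w d u v →
    (∃[ xs ] (Walk u xs v × length xs ≤ d × (∀ ys → Walk u ys v → length ys ≤ d → wsum w xs ≤ wsum w ys)))
    ⊎ (∀ ys → Walk u ys v → length ys ≤ d → ⊥)
  bestWithin w d u v with u ≟ v
  ... | yes refl = inj₁ ([] , [] , z≤n , λ ys _ _ → z≤n)
  bestWithin w zero    u v | no u≢v = inj₂ λ where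
    [] [] _ → u≢v refl
  bestWithin w (suc d) u v | no u≢v = conclude (argmin n Via viaBest)
    where
    Via : ℕ → ℕ → Set
    Via x a = adj u x ≡ true × (∃[ xs ] (Walk x xs v × length xs ≤ d × a ≡ w x + wsum w xs))
    viaBest : ∀ x → (∃[ a ] (Via x a × (∀ b → Via x b → a ≤ b))) ⊎ (∀ b → ¬ Via x b)
    viaBest x with adj u x Bool.≟ true | bestWithin w d x v
    ... | no ¬e | _ = inj₂ λ b (e , _) → ¬e e
    ... | yes e | inj₂ ∄ = inj₂ λ { b (_ , xs , p , l , _) → ∄ xs p l }
    ... | yes e | inj₁ (xs , p , l , min) = inj₁ (_ , (e , xs , p , l , refl) , λ where
      b (_ , ys , q , l′ , refl) → +-monoʳ-≤ (w x) (min ys q l′))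
    conclude : (∃[ x ] ∃[ a ] (x < n × Via x a × (∀ y → y < n → ∀ b → Via y b → a ≤ b))) ⊎ (∀ y → y < n → ∀ b → ¬ Via y b) →
      (∃[ xs ] (Walk u xs v × length xs ≤ suc d × (∀ ys → Walk u ys v → length ys ≤ suc d → wsum w xs ≤ wsum w ys)))
      ⊎ (∀ ys → Walk u ys v → length ys ≤ suc d → ⊥)
    conclude (inj₁ (x , a , x<n , (e , xs , p , l , refl) , min)) = inj₁ (x ∷ xs , e ∷ p , s≤s l , λ where
      []       []      _  → contradiction refl u≢v
      (y ∷ ys) (e′ ∷ q) l′ → min y (adj-< e′) _ (e′ , ys , q , s≤s⁻¹ l′ , refl))
    conclude (inj₂ ∄) = inj₂ λ where
      []       []      _  → u≢v refl
      (y ∷ ys) (e′ ∷ q) l′ → ∄ y (adj-< e′) _ (e′ , ys , q , s≤s⁻¹ l′ , refl)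

  minimum : ∀ w {u} v → u < n → (∃[ xs ] (Min w u xs v × length xs < n)) ⊎ (∀ ys → ¬ Walk u ys v)
  minimum w {u} v u<n with bestWithin w (pred n) u v
  ... | inj₁ (xs , p , l , min) = inj₁ (xs , (p , λ ys q → let zs , r , l′ , ws = shorten u<n q in
                                     ≤-trans (min zs r (<⇒≤pred l′)) (ws w)) , ≤-<-trans l (pred< u<n))
    where
    pred< : ∀ {u n} → u < n → pred n < n
    pred< (s≤s _) = ≤-refl
  ... | inj₂ ∄ = inj₂ λ ys q → let zs , r , l′ , ws = shorten u<n q in ∄ zs r (<⇒≤pred l′)

  UniqueUpTo : (ℕ → ℕ) → ℕ → Set
  UniqueUpTo w R = ∀ u v xs ys → u < n → Min w u xs v → Min w u ys v → length xs ≤ R → xs ≡ ys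

  -- Minimum walks thereby follow the breadth-first layers, which allows a test distance by distance
  -- and makes `powers-injective`, a fact about shortest walks, applicable to them.
  LengthFirst : (ℕ → ℕ) → Set
  LengthFirst w = ∀ {u v xs} → u < n → Min w u xs v → Shortest u xs v

  -- If some walk were lighter for w, its simple version would have fewer than n edges. Its hashes
  -- would then sum to less than n * m, which is at most `base`, and could not outweigh a difference
  -- of at least one in the high digit.
  refine-min : ∀ {base w m u v xs} → 0 < m → n * m ≤ base → u < n → Min (refine base w m) u xs v → Min w u xs v
  refine-min {base} {w} {m} {u} {v} {xs} m>0 nm≤ u<n (p , min) = p , λ ys q → ≮⇒≥ (λ ys< → ⊥-elim (absurd ys q ys<))
    where
    absurd : ∀ ys → Walk u ys v → wsum w ys < wsum w xs → ⊥
    absurd ys q ys< = let zs , r , l , ws = shorten u<n q in <-irrefl refl (begin-strict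
      wsum (refine base w m) zs                    ≡⟨ wsum-refine base w m zs ⟩
      wsum w zs * base + wsum (hash m) zs          ≤⟨ +-monoʳ-≤ _ (wsum-≤ (hash m) m zs (hash-≤ m>0)) ⟩
      wsum w zs * base + length zs * m             <⟨ +-monoʳ-< (wsum w zs * base) (<-≤-trans (*-monoˡ-< m {{>-nonZero m>0}} l) nm≤) ⟩
      wsum w zs * base + base                      ≡⟨ +-comm _ base ⟩
      suc (wsum w zs) * base                       ≤⟨ *-monoˡ-≤ base (≤-<-trans (ws w) ys<) ⟩
      wsum w xs * base                             ≤⟨ m≤m+n _ _ ⟩
      wsum w xs * base + wsum (hash m) xs          ≡⟨ sym (wsum-refine base w m xs) ⟩
      wsum (refine base w m) xs                    ≤⟨ min zs r ⟩
      wsum (refine base w m) zs                    ∎)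
      where open ≤-Reasoning

  -- Stepping to x at once and continuing from its occurrence would save an edge. With x = y this
  -- excludes repetitions; with x ≠ y it tells apart two shortest walks that differ in their first
  -- vertex.
  no-shortcut : ∀ {u x y zs v} → adj u x ≡ true → Shortest u (y ∷ zs) v → occurrences zs x ≢ 0 → ⊥
  no-shortcut {u} {x} {y} {zs} e s@(p , _) ∈ =
    let as , bs , eq = occurrence zs x ∈
        q = walk-suffix (y ∷ as) (subst (λ l → Walk u (y ∷ l) _) eq p)
    in <⇒≱ (s≤s (≤-trans (s≤s (m≤n+m (length bs) (length as))) (≤-reflexive (trans (sym (+-suc (length as) (length bs))) (trans (sym (List.length-++ as)) (cong length (sym eq)))))))
         (shortest-≤ s (e ∷ q))

  shortest-tail : ∀ {u x xs v} → Shortest u (x ∷ xs) v → Shortest x xs v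
  shortest-tail {x = x} s@(e ∷ p , _) = min-suffix (x ∷ []) s (e ∷ []) p

  shortest-distinct : ∀ {u xs v} → Shortest u xs v → Distinct xs
  shortest-distinct {xs = []} s i = z≤n
  shortest-distinct {xs = x ∷ xs} s@(e ∷ p , _) with occurrences xs x ≟ 0
  ... | yes ∉ = Distinct-∷ {x} {xs} ∉ (shortest-distinct (shortest-tail s))
  ... | no ∈  = ⊥-elim (no-shortcut e s ∈)

  -- Binary digits recover the vertex set, and a vertex occurs at the same
  -- distance from u on all shortest walks, so the set recovers the order.
  powers-injective : ∀ {u xs ys v} → Shortest u xs v → Shortest u ys v → wsum (2 ^_) xs ≡ wsum (2 ^_) ys → xs ≡ ys
  powers-injective {xs = []}     {[]}     s t e = refl
  powers-injective {xs = []}     {y ∷ ys} s@(p , _) t e = contradiction (shortest-≤ t p) λ()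
  powers-injective {xs = x ∷ xs} {[]}     s t@(q , _) e = contradiction (shortest-≤ s q) λ()
  powers-injective {xs = x ∷ xs} {y ∷ ys} s@(ex ∷ p , _) t@(ey ∷ q , _) e with x ≟ y
  ... | yes refl = cong (x ∷_) (powers-injective (shortest-tail s) (shortest-tail t) (+-cancelˡ-≡ (2 ^ x) _ _ e))
  ... | no x≢y with occurrences ys x ≟ 0
  ...   | no ∈  = ⊥-elim (no-shortcut ex t ∈)
  ...   | yes ∉ = contradiction
    (trans (sym (cong (_+ occurrences xs x) (δᵢ-self x)))
      (trans (digits-injective n (occurrences (x ∷ xs)) (occurrences (y ∷ ys)) (shortest-distinct s) (shortest-distinct t)
               (trans (sym (wsum-digits 2 (adj-< ex ∷ walk-below p))) (trans e (wsum-digits 2 (adj-< ey ∷ walk-below q)))) x (adj-< ex))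
        (cong₂ _+_ (δᵢ-other (x≢y ∘ sym)) ∉)))
    λ()

  -- The product `X` below has n⁴ factors, each at most 2^(2n + 1).
  exponent : ℕ
  exponent = n * (n * (n * (n * (n + n + 1))))

  -- The range that `nonDivisor` searches for k = `suc exponent`; the successor makes the required
  -- bound X < 2ᵏ strict.
  hashBound : ℕ
  hashBound = suc (suc exponent + suc exponent)

  module Isolation (w : ℕ → ℕ) (base R : ℕ) (lengthFirst : LengthFirst w) (uniq : UniqueUpTo w R) where

    -- The empty list is a default for pairs without a walk; these only contribute further positive
    -- factors to `X`.
    minWalk : ℕ → ℕ → List ℕ
    minWalk u v with u <? n
    ... | no _ = []
    ... | yes u<n with minimum w v u<n
    ...   | inj₁ (xs , _) = xs
    ...   | inj₂ _        = []

    minWalk-≡ : ∀ {u v xs} → u < n → Min w u xs v → length xs ≤ R → xs ≡ minWalk u v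
    minWalk-≡ {u} {v} u<n mn l with u <? n
    ... | no ¬u< = contradiction u<n ¬u<
    ... | yes u< with minimum w v u<
    ...   | inj₁ (ys , mn′ , _) = uniq _ _ _ _ u<n mn mn′ l
    ...   | inj₂ ∄ = contradiction (proj₁ mn) (∄ _)

    powers-≤ : ∀ {m xs} → AllBelow n xs → length xs ≤ m → wsum (2 ^_) xs ≤ m * 2 ^ n
    powers-≤ [] l = z≤n
    powers-≤ (x< ∷ xs<) (s≤s l) = +-mono-≤ (^-monoʳ-≤ 2 (<⇒≤ x<)) (powers-≤ xs< l)

    minWalk-≤ : ∀ u v → wsum (2 ^_) (minWalk u v) ≤ n * 2 ^ n
    minWalk-≤ u v with u <? n
    ... | no _ = z≤n
    ... | yes u<n with minimum w v u<n
    ...   | inj₁ (xs , mn , l) = powers-≤ (walk-below (proj₁ mn)) (<⇒≤ l)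
    ...   | inj₂ _        = z≤n

    through : ℕ → ℕ → ℕ → List ℕ
    through u v a = minWalk u a ++ minWalk a v

    candidate : ∀ {u v xs} → u < n → Min w u xs v → length xs ≤ R + R → ∃[ a ] (a < n × xs ≡ through u v a)
    candidate {u} {v} {xs} u<n mn l =
      -- The cut comes after R vertices rather than in the middle: both parts have at most R edges,
      -- and a walk of at most R edges gets an empty second part and `a = v`.
      let e = List.take++drop≡id R xs
          mn′ = subst (λ l → Min w u l v) (sym e) mn
          a , p , q = walk-split (take R xs) (proj₁ mn′)
          a<n = walk-end u<n p
      in a , a<n , trans (sym e) (cong₂ _++_
           (minWalk-≡ u<n (min-prefix (take R xs) mn′ p q) (≤-trans (≤-reflexive (List.length-take R xs)) (m⊓n≤m R _)))
           (minWalk-≡ a<n (min-suffix (take R xs) mn′ p q) (≤-trans (≤-reflexive (List.length-drop R xs))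
             (≤-trans (∸-monoˡ-≤ R l) (≤-reflexive (m+n∸n≡m R R))))))

    -- Different midpoints may give the same walk. Its difference 0 is replaced by 1 to keep the
    -- product `X` positive.
    nonzero : ℕ → ℕ
    nonzero zero    = 1
    nonzero (suc k) = suc k

    difference : ℕ → ℕ → ℕ → ℕ → ℕ
    difference u v a a′ = nonzero ∣ wsum (2 ^_) (through u v a) - wsum (2 ^_) (through u v a′) ∣

    X : ℕ
    X = productTo n λ u → productTo n λ v → productTo n λ a → productTo n (difference u v a)

    nonzero-pos : ∀ k → 0 < nonzero k
    nonzero-pos zero    = s≤s z≤n
    nonzero-pos (suc k) = s≤s z≤n

    nonzero-≤ : ∀ {k c} → 0 < c → k ≤ c → nonzero k ≤ c
    nonzero-≤ {zero}  c>0 k≤ = c>0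
    nonzero-≤ {suc k} c>0 k≤ = k≤

    through-≤ : ∀ u v a → wsum (2 ^_) (through u v a) ≤ 2 ^ (n + n + 1)
    through-≤ u v a = begin
      wsum (2 ^_) (through u v a)              ≡⟨ wsum-++ (2 ^_) (minWalk u a) (minWalk a v) ⟩
      wsum (2 ^_) (minWalk u a) + wsum (2 ^_) (minWalk a v) ≤⟨ +-mono-≤ (minWalk-≤ u a) (minWalk-≤ a v) ⟩
      n * 2 ^ n + n * 2 ^ n                    ≤⟨ +-mono-≤ bound bound ⟩
      2 ^ n * 2 ^ n + 2 ^ n * 2 ^ n            ≡⟨ l (2 ^ n) ⟩
      2 ^ n * 2 ^ n * 2                        ≡⟨ cong (_* 2) (sym (^-distribˡ-+-* 2 n n)) ⟩
      2 ^ (n + n) * 2 ^ 1                      ≡⟨ sym (^-distribˡ-+-* 2 (n + n) 1) ⟩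
      2 ^ (n + n + 1)                          ∎
      where
      open ≤-Reasoning
      bound = *-monoˡ-≤ (2 ^ n) (<⇒≤ (n<2^n n))
      l : ∀ a → a * a + a * a ≡ a * a * 2
      l = solve-∀

    X-pos : 0 < X
    X-pos = productTo-pos n λ u → productTo-pos n λ v → productTo-pos n λ a → productTo-pos n λ a′ → nonzero-pos _

    X-≤ : X ≤ 2 ^ exponent
    X-≤ = productTo-≤ n λ u _ → productTo-≤ n λ v _ → productTo-≤ n λ a _ → productTo-≤ n λ a′ _ →
      nonzero-≤ (m^n>0 2 (n + n + 1)) (≤-trans (∣m-n∣≤m⊔n (wsum (2 ^_) (through u v a)) _) (⊔-lub (through-≤ u v a) (through-≤ u v a′)))

    difference-∣X : ∀ {u v a a′} → u < n → v < n → a < n → a′ < n → difference u v a a′ ∣ X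
    difference-∣X {u} {v} {a} {a′} u< v< a< a′< =
      ∣-trans (∣-productTo (difference u v a) a′<) (∣-trans (∣-productTo _ a<) (∣-trans (∣-productTo _ v<) (∣-productTo _ u<)))

    isolating : ∃[ m ] (0 < m × m ≤ hashBound × ¬ (m ∣ X))
    isolating = nonDivisor (suc exponent) X-pos (≤-<-trans X-≤ (^-monoʳ-< 2 (s≤s (s≤s z≤n)) (n<1+n exponent)))

    -- Two minimum walks agree in w and in the refined weight, hence in the sum of hashes, so m
    -- divides the difference of their sums of powers. Unless it is 0, that difference is a factor
    -- of `X`.
    isolated : ∀ m → 0 < m → ¬ (m ∣ X) → n * m ≤ base → UniqueUpTo (refine base w m) (R + R)
    isolated m m>0 m∤X nm≤ u v xs ys u<n mx my l = powers-injective sx sy F≡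
      where
      wx = refine-min {base} {w} {m} m>0 nm≤ u<n mx
      wy = refine-min {base} {w} {m} m>0 nm≤ u<n my
      sx = lengthFirst u<n wx
      sy = lengthFirst u<n wy
      cx = candidate u<n wx l
      -- Only `xs` is assumed to be short, but `ys` is shortest too and so not longer.
      cy = candidate u<n wy (≤-trans (shortest-≤ sy (proj₁ mx)) l)
      w≡ : wsum w xs ≡ wsum w ys
      w≡ = ≤-antisym (proj₂ wx ys (proj₁ my)) (proj₂ wy xs (proj₁ mx))
      h≡ : wsum (hash m) xs ≡ wsum (hash m) ys
      h≡ = +-cancelˡ-≡ (wsum w xs * base) _ _ (begin
        wsum w xs * base + wsum (hash m) xs ≡⟨ sym (wsum-refine base w m xs) ⟩
        wsum (refine base w m) xs           ≡⟨ ≤-antisym (proj₂ mx ys (proj₁ my)) (proj₂ my xs (proj₁ mx)) ⟩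
        wsum (refine base w m) ys           ≡⟨ wsum-refine base w m ys ⟩
        wsum w ys * base + wsum (hash m) ys ≡⟨ cong (λ a → a * base + wsum (hash m) ys) (sym w≡) ⟩
        wsum w xs * base + wsum (hash m) ys ∎)
        where open ≡-Reasoning
      F≡ : wsum (2 ^_) xs ≡ wsum (2 ^_) ys
      F≡ = decide ∣ wsum (2 ^_) xs - wsum (2 ^_) ys ∣ refl
        where
        d≡ : ∀ {k} → ∣ wsum (2 ^_) xs - wsum (2 ^_) ys ∣ ≡ suc k → suc k ≡ difference u v (proj₁ cx) (proj₁ cy)
        d≡ eq = sym (cong nonzero (trans (sym (cong₂ (λ a b → ∣ wsum (2 ^_) a - wsum (2 ^_) b ∣)
               (proj₂ (proj₂ cx)) (proj₂ (proj₂ cy)))) eq))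
        decide : ∀ k → ∣ wsum (2 ^_) xs - wsum (2 ^_) ys ∣ ≡ k → wsum (2 ^_) xs ≡ wsum (2 ^_) ys
        decide zero    eq = ∣m-n∣≡0⇒m≡n eq
        decide (suc k) eq = contradiction (∣-trans (subst (m ∣_) (trans eq (d≡ eq)) (hash-collision m xs ys h≡))
                      (difference-∣X u<n (walk-end u<n (proj₁ mx)) (proj₁ (proj₂ cx)) (proj₁ (proj₂ cy)))) m∤X

-- Finite types

Finite : Set → Set
Finite A = ∃[ n ] (A ↔ Fin n)

⊥-finite : Finite ⊥
⊥-finite = 0 , ↔-sym 0↔⊥

⊤-finite : Finite ⊤
⊤-finite = 1 , ↔-sym 1↔⊤

Bool-finite : Finite Bool
Bool-finite = 2 , ↔-sym 2↔Bool

⊎-finite : ∀ {A B} → Finite A → Finite B → Finite (A ⊎ B)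
⊎-finite (m , f) (n , g) = m + n , ↔-trans (f ⊎-↔ g) (↔-sym +↔⊎)

×-finite : ∀ {A B} → Finite A → Finite B → Finite (A × B)
×-finite (m , f) (n , g) = m * n , ↔-trans (f ×-↔ g) (↔-sym *↔×)

-- Tuples, by recursion on the length so that they enjoy η

Tup : Set → ℕ → Set
Tup A zero    = ⊤
Tup A (suc k) = A × Tup A k

Tup-finite : ∀ {A} → Finite A → ∀ k → Finite (Tup A k)
Tup-finite f zero    = ⊤-finite
Tup-finite f (suc k) = ×-finite f (Tup-finite f k)

get : ∀ {A k} → Fin k → Tup A k → A
get zero    t = proj₁ t
get (suc i) t = get i (proj₂ t)

set : ∀ {A k} → Fin k → A → Tup A k → Tup A k
set zero    a t = a , proj₂ t
set (suc i) a t = proj₁ t , set i a (proj₂ t)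

constant : ∀ {A} k → A → Tup A k
constant zero    a = tt
constant (suc k) a = a , constant k a

get-set : ∀ {A k} (i : Fin k) (a : A) t → get i (set i a t) ≡ a
get-set zero    a t = refl
get-set (suc i) a t = get-set i a (proj₂ t)

get-set-≢ : ∀ {A k} {i j : Fin k} (a : A) t → j ≢ i → get j (set i a t) ≡ get j t
get-set-≢ {i = zero}  {zero}  a t j≢i = contradiction refl j≢i
get-set-≢ {i = zero}  {suc j} a t j≢i = refl
get-set-≢ {i = suc i} {zero}  a t j≢i = refl
get-set-≢ {i = suc i} {suc j} a t j≢i = get-set-≢ a (proj₂ t) (j≢i ∘ cong suc)

get-constant : ∀ {A k} (i : Fin k) (a : A) → get i (constant k a) ≡ a
get-constant zero    a = refl
get-constant (suc i) a = get-constant i a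

-- Serial binary arithmetic, least significant bit first

⌊_⌋ : Bool → ℕ
⌊ false ⌋ = 0
⌊ true  ⌋ = 1

val : List Bool → ℕ
val []       = 0
val (b ∷ bs) = ⌊ b ⌋ + 2 * val bs

toBits : ℕ → ℕ → List Bool
oddᵇ : ℕ → Bool
half : ℕ → ℕ

oddᵇ zero          = false
oddᵇ (suc zero)    = true
oddᵇ (suc (suc n)) = oddᵇ n

half zero          = 0
half (suc zero)    = 0
half (suc (suc n)) = suc (half n)

toBits zero    v = []
toBits (suc k) v = oddᵇ v ∷ toBits k (half v)

oddᵇ-bit : ∀ b n → oddᵇ (⌊ b ⌋ + 2 * n) ≡ b
oddᵇ-bit false zero    = refl
oddᵇ-bit true  zero    = refl
oddᵇ-bit false (suc n) rewrite +-suc n (n + 0) = oddᵇ-bit false n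
oddᵇ-bit true  (suc n) rewrite +-suc n (n + 0) = oddᵇ-bit true n

half-bit : ∀ b n → half (⌊ b ⌋ + 2 * n) ≡ n
half-bit false zero    = refl
half-bit true  zero    = refl
half-bit false (suc n) rewrite +-suc n (n + 0) = cong suc (half-bit false n)
half-bit true  (suc n) rewrite +-suc n (n + 0) = cong suc (half-bit true n)

toBits-val : ∀ bs → toBits (length bs) (val bs) ≡ bs
toBits-val []       = refl
toBits-val (b ∷ bs) = cong₂ _∷_ (oddᵇ-bit b (val bs))
  (trans (cong (toBits (length bs)) (half-bit b (val bs))) (toBits-val bs))

odd-half : ∀ n → ⌊ oddᵇ n ⌋ + 2 * half n ≡ n
odd-half zero          = refl
odd-half (suc zero)    = refl
odd-half (suc (suc n)) = begin
  ⌊ oddᵇ n ⌋ + 2 * suc (half n)   ≡⟨ lem ⌊ oddᵇ n ⌋ (half n) ⟩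
  2 + (⌊ oddᵇ n ⌋ + 2 * half n)   ≡⟨ cong (2 +_) (odd-half n) ⟩
  2 + n                           ∎
  where
  open ≡-Reasoning
  lem : ∀ a b → a + 2 * suc b ≡ 2 + (a + 2 * b)
  lem = solve-∀

val-toBits : ∀ k v → v < 2 ^ k → val (toBits k v) ≡ v
val-toBits zero    v v<  = sym (n<1⇒n≡0 v<)
val-toBits (suc k) v v<  = trans (cong (λ h → ⌊ oddᵇ v ⌋ + 2 * h) (val-toBits k (half v) h<)) (odd-half v)
  where
  h< : half v < 2 ^ k
  h< = *-cancelˡ-< 2 _ _ (≤-<-trans (≤-trans (m≤n+m _ ⌊ oddᵇ v ⌋) (≤-reflexive (odd-half v))) v<)

length-toBits : ∀ k v → length (toBits k v) ≡ k
length-toBits zero    v = refl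
length-toBits (suc k) v = cong suc (length-toBits k (half v))

-- The arguments are the state of the sweep, the bit of the destination register and the bit of the
-- argument register.
BitOp : Set
BitOp = Bool → Bool → Bool → Bool

finalState : BitOp → Bool → List (Bool × Bool) → Bool
finalState nxt c []             = c
finalState nxt c ((a , b) ∷ ps) = finalState nxt (nxt c a b) ps

results : BitOp → BitOp → Bool → List (Bool × Bool) → List Bool
results nxt res c []             = []
results nxt res c ((a , b) ∷ ps) = res c a b ∷ results nxt res (nxt c a b) ps

val₁ val₂ : List (Bool × Bool) → ℕ
val₁ ps = val (map proj₁ ps)
val₂ ps = val (map proj₂ ps)

sumBit carry borrow carry₁ sumBit₁ smaller same : BitOp
sumBit  c a b = (a xor b) xor c
carry   c a b = (a ∧ b) ∨ (c ∧ (a xor b))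
borrow  c a b = (not a ∧ b) ∨ (c ∧ not (a xor b))
carry₁  c a b = c ∧ a
sumBit₁ c a b = a xor c
smaller c a b = if a xor b then b else c
same    c a b = c ∧ not (a xor b)

private
  -- One position of schoolbook arithmetic. The first equation is that of the lowest bits, with
  -- outgoing carry c'; the second is the induction hypothesis for the higher bits, with f the
  -- overflow at weight p. The intermediate carry cancels.
  mix : ∀ r c' a b c x z p y f → r + 2 * c' ≡ a + b + c → x + f * p ≡ y + z + c' →
        r + 2 * x + f * (2 * p) ≡ a + 2 * y + (b + 2 * z) + c
  mix r c' a b c x z p y f e₁ e₂ = +-cancelˡ-≡ (2 * c') _ _ (begin
    2 * c' + (r + 2 * x + f * (2 * p))     ≡⟨ l₁ r c' x p f ⟩
    (r + 2 * c') + 2 * (x + f * p)         ≡⟨ cong₂ (λ m n → m + 2 * n) e₁ e₂ ⟩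
    a + b + c + 2 * (y + z + c')           ≡⟨ l₂ a b c y z c' ⟩
    2 * c' + (a + 2 * y + (b + 2 * z) + c) ∎)
    where
    open ≡-Reasoning
    l₁ : ∀ r c' x p f → 2 * c' + (r + 2 * x + f * (2 * p)) ≡ (r + 2 * c') + 2 * (x + f * p)
    l₁ = solve-∀
    l₂ : ∀ a b c y z c' → a + b + c + 2 * (y + z + c') ≡ 2 * c' + (a + 2 * y + (b + 2 * z) + c)
    l₂ = solve-∀

add-correct : ∀ c ps → val (results carry sumBit c ps) + ⌊ finalState carry c ps ⌋ * 2 ^ length ps
                       ≡ val₁ ps + val₂ ps + ⌊ c ⌋
add-correct c [] = *-identityʳ ⌊ c ⌋
add-correct c ((a , b) ∷ ps) =
  mix ⌊ sumBit c a b ⌋ ⌊ carry c a b ⌋ ⌊ a ⌋ ⌊ b ⌋ ⌊ c ⌋ (val (results carry sumBit (carry c a b) ps)) (val₂ ps)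
      (2 ^ length ps) (val₁ ps) ⌊ finalState carry (carry c a b) ps ⌋ (table c a b) (add-correct (carry c a b) ps)
  where
  table : ∀ c a b → ⌊ sumBit c a b ⌋ + 2 * ⌊ carry c a b ⌋ ≡ ⌊ a ⌋ + ⌊ b ⌋ + ⌊ c ⌋
  table false false false = refl
  table false false true  = refl
  table false true  false = refl
  table false true  true  = refl
  table true  false false = refl
  table true  false true  = refl
  table true  true  false = refl
  table true  true  true  = refl

inc-correct : ∀ c ps → val (results carry₁ sumBit₁ c ps) + ⌊ finalState carry₁ c ps ⌋ * 2 ^ length ps
                       ≡ val₁ ps + ⌊ c ⌋
inc-correct c [] = *-identityʳ ⌊ c ⌋
inc-correct c ((a , b) ∷ ps) = trans
  (mix ⌊ sumBit₁ c a b ⌋ ⌊ carry₁ c a b ⌋ ⌊ a ⌋ 0 ⌊ c ⌋ (val (results carry₁ sumBit₁ (carry₁ c a b) ps)) 0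
      (2 ^ length ps) (val₁ ps) ⌊ finalState carry₁ (carry₁ c a b) ps ⌋ (table c a)
      (trans (inc-correct (carry₁ c a b) ps) (cong (_+ ⌊ carry₁ c a b ⌋) (sym (+-identityʳ (val₁ ps))))))
  (cong (_+ ⌊ c ⌋) (+-identityʳ (⌊ a ⌋ + 2 * val₁ ps)))
  where
  table : ∀ c a → ⌊ a xor c ⌋ + 2 * ⌊ c ∧ a ⌋ ≡ ⌊ a ⌋ + 0 + ⌊ c ⌋
  table false false = refl
  table false true  = refl
  table true  false = refl
  table true  true  = refl

-- Subtraction is addition read backwards: the minuend is the sum of difference, subtrahend and
-- borrow, so `mix` applies with minuend and result exchanged.
sub-correct : ∀ c ps → val₁ ps + ⌊ finalState borrow c ps ⌋ * 2 ^ length ps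
                       ≡ val (results borrow sumBit c ps) + val₂ ps + ⌊ c ⌋
sub-correct c [] = *-identityʳ ⌊ c ⌋
sub-correct c ((a , b) ∷ ps) =
  mix ⌊ a ⌋ ⌊ borrow c a b ⌋ ⌊ sumBit c a b ⌋ ⌊ b ⌋ ⌊ c ⌋ (val₁ ps) (val₂ ps)
      (2 ^ length ps) (val (results borrow sumBit (borrow c a b) ps)) ⌊ finalState borrow (borrow c a b) ps ⌋
      (table c a b) (sub-correct (borrow c a b) ps)
  where
  table : ∀ c a b → ⌊ a ⌋ + 2 * ⌊ borrow c a b ⌋ ≡ ⌊ sumBit c a b ⌋ + ⌊ b ⌋ + ⌊ c ⌋
  table false false false = refl
  table false false true  = refl
  table false true  false = refl
  table false true  true  = refl
  table true  false false = refl
  table true  false true  = refl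
  table true  true  false = refl
  table true  true  true  = refl

<ᵇ-true : ∀ {m n} → m < n → (m <ᵇ n) ≡ true
<ᵇ-true {zero}  {suc n} _ = refl
<ᵇ-true {suc m} {suc n} m<n = <ᵇ-true {m} {n} (s≤s⁻¹ m<n)

<ᵇ-false : ∀ {m n} → n ≤ m → (m <ᵇ n) ≡ false
<ᵇ-false {m}     {zero}  _ = refl
<ᵇ-false {suc m} {suc n} n≤m = <ᵇ-false {m} {n} (s≤s⁻¹ n≤m)

≡ᵇ-refl : ∀ n → (n ≡ᵇ n) ≡ true
≡ᵇ-refl zero    = refl
≡ᵇ-refl (suc n) = ≡ᵇ-refl n

≡ᵇ-false : ∀ {m n} → m ≢ n → (m ≡ᵇ n) ≡ false
≡ᵇ-false {zero}  {zero}  m≢n = contradiction refl m≢n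
≡ᵇ-false {zero}  {suc n} m≢n = refl
≡ᵇ-false {suc m} {zero}  m≢n = refl
≡ᵇ-false {suc m} {suc n} m≢n = ≡ᵇ-false (m≢n ∘ cong suc)

<ᵇ-double : ∀ c a b x y → (⌊ a ⌋ + 2 * x <ᵇ ⌊ c ⌋ + (⌊ b ⌋ + 2 * y)) ≡ (x <ᵇ ⌊ smaller c a b ⌋ + y)
<ᵇ-double c a b x y with x <? ⌊ smaller c a b ⌋ + y
... | yes p = trans (<ᵇ-true (up c a b p)) (sym (<ᵇ-true p))
  where
  up : ∀ c a b → x < ⌊ smaller c a b ⌋ + y → ⌊ a ⌋ + 2 * x < ⌊ c ⌋ + (⌊ b ⌋ + 2 * y)
  up false false false p = *-monoʳ-< 2 p
  up false false true  p = s≤s (*-monoʳ-≤ 2 (s≤s⁻¹ p))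
  up false true  false p = ≤-trans (≤-reflexive (cong suc (sym (+-suc x (x + 0))))) (*-monoʳ-≤ 2 p)
  up false true  true  p = s≤s (*-monoʳ-< 2 p)
  up true  false false p = s≤s (*-monoʳ-≤ 2 (s≤s⁻¹ p))
  up true  false true  p = m≤n⇒m≤1+n (s≤s (*-monoʳ-≤ 2 (s≤s⁻¹ p)))
  up true  true  false p = m≤n⇒m≤1+n (≤-trans (≤-reflexive (cong suc (sym (+-suc x (x + 0))))) (*-monoʳ-≤ 2 p))
  up true  true  true  p = s≤s (s≤s (*-monoʳ-≤ 2 (s≤s⁻¹ p)))
... | no ¬p = trans (<ᵇ-false (up c a b (≮⇒≥ ¬p))) (sym (<ᵇ-false (≮⇒≥ ¬p)))
  where
  up : ∀ c a b → ⌊ smaller c a b ⌋ + y ≤ x → ⌊ c ⌋ + (⌊ b ⌋ + 2 * y) ≤ ⌊ a ⌋ + 2 * x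
  up false false false p = *-monoʳ-≤ 2 p
  up false false true  p = ≤-trans (n≤1+n _) (≤-trans (≤-reflexive (cong suc (sym (+-suc y (y + 0))))) (*-monoʳ-≤ 2 p))
  up false true  false p = m≤n⇒m≤1+n (*-monoʳ-≤ 2 p)
  up false true  true  p = s≤s (*-monoʳ-≤ 2 p)
  up true  false false p = *-monoʳ-< 2 p
  up true  false true  p = ≤-trans (≤-reflexive (cong suc (sym (+-suc y (y + 0))))) (*-monoʳ-≤ 2 p)
  up true  true  false p = s≤s (*-monoʳ-≤ 2 p)
  up true  true  true  p = s≤s (*-monoʳ-< 2 p)

-- Bits arrive least significant first, so the last position that differs decides and overwrites the
-- state. The initial state is the verdict on equal numbers: `false` tests for <, `true` for ≤.
smaller-correct : ∀ c ps → finalState smaller c ps ≡ (val₁ ps <ᵇ ⌊ c ⌋ + val₂ ps)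
smaller-correct false [] = refl
smaller-correct true  [] = refl
smaller-correct c ((a , b) ∷ ps) =
  trans (smaller-correct (smaller c a b) ps) (sym (<ᵇ-double c a b (val₁ ps) (val₂ ps)))

≡ᵇ-double : ∀ a b x y → (⌊ a ⌋ + 2 * x ≡ᵇ ⌊ b ⌋ + 2 * y) ≡ (not (a xor b) ∧ (x ≡ᵇ y))
≡ᵇ-double a b x y with x ≟ y
≡ᵇ-double false false x y | yes refl = trans (≡ᵇ-refl (2 * x)) (sym (≡ᵇ-refl x))
≡ᵇ-double true  true  x y | yes refl = trans (≡ᵇ-refl (2 * x)) (sym (≡ᵇ-refl x))
≡ᵇ-double false false x y | no x≢y = trans (≡ᵇ-false (x≢y ∘ *-cancelˡ-≡ x y 2)) (sym (≡ᵇ-false x≢y))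
≡ᵇ-double true  true  x y | no x≢y = trans (≡ᵇ-false (x≢y ∘ *-cancelˡ-≡ x y 2)) (sym (≡ᵇ-false x≢y))
≡ᵇ-double false true  x y | _ = ≡ᵇ-false (λ e → even≢odd x y e)
≡ᵇ-double true  false x y | _ = ≡ᵇ-false (λ e → even≢odd y x (sym e))

same-false : ∀ ps → finalState same false ps ≡ false
same-false []       = refl
same-false (p ∷ ps) = same-false ps

same-correct : ∀ ps → finalState same true ps ≡ (val₁ ps ≡ᵇ val₂ ps)
same-correct [] = refl
same-correct ((a , b) ∷ ps) with a xor b | ≡ᵇ-double a b (val₁ ps) (val₂ ps)
... | false | e = trans (same-correct ps) (sym e)
... | true  | e = trans (same-false ps) (sym e)

keep₀ : BitOp
keep₀ c a b = c
keep₁ : BitOp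
keep₁ c a b = a
erase : BitOp
erase c a b = false

results-keep : ∀ nxt c ps → results nxt keep₁ c ps ≡ map proj₁ ps
results-keep nxt c []             = refl
results-keep nxt c ((a , b) ∷ ps) = cong (a ∷_) (results-keep nxt (nxt c a b) ps)

results-erase : ∀ nxt c ps → val (results nxt erase c ps) ≡ 0
results-erase nxt c []             = refl
results-erase nxt c ((a , b) ∷ ps) = cong (2 *_) (results-erase nxt (nxt c a b) ps)

val< : ∀ bs → val bs < 2 ^ length bs
val< [] = s≤s z≤n
val< (b ∷ bs) = <-≤-trans (+-monoˡ-< (2 * val bs) (bit<2 b))
  (≤-trans (≤-reflexive (sym (*-suc 2 (val bs)))) (*-monoʳ-≤ 2 (val< bs)))
  where
  bit<2 : ∀ b → ⌊ b ⌋ < 2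
  bit<2 false = s≤s z≤n
  bit<2 true  = s≤s (s≤s z≤n)

-- A register language

registerCount : ℕ
registerCount = 45

Reg : Set
Reg = Fin registerCount

data Instr : Set where
  clr inc putReg  : Reg → Instr
  add sub lt le eq : Reg → Reg → Instr
  grow isOne      : Instr
  move            : Direction → Instr
  put             : Letter → Instr

infixr 4 _⨾_

-- Every instruction doubles as a test: `branch` and `while` execute it and then inspect the final
-- state of its sweep. An instruction wanted for its effect alone is a `branch` between two `skip`s.
data Prog : Set where
  skip fail : Prog
  _⨾_       : Prog → Prog → Prog
  branch    : Instr → Prog → Prog → Prog
  while     : Instr → Prog → Prog
  choose    : Prog → Prog → Prog

-- A register file is stored as a list of columns, the i-th column consisting
-- of the i-th bits of all registers.  Every instruction is one sweep over the
-- columns with a one-bit state.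

Col : Set
Col = Tup Bool registerCount

-- `init` may depend on the scanned input cell, which is how `isOne` reads the input. `extends`
-- turns the blank after the last column into a new top column. `moves` and `puts` take effect once
-- the head is back at the left end.
record Sweep : Set where
  field
    init    : InputCell → Bool
    nxt res : BitOp
    dst arg : Reg
    emits   : Bool
    extends : Bool
    moves   : Direction
    puts    : Maybe Letter

open Sweep

isOneᵇ : InputCell → Bool
isOneᵇ (letter (bit (suc zero))) = true
isOneᵇ _                         = false

idle : Sweep
idle = record { init = λ _ → false ; nxt = keep₀ ; res = keep₁ ; dst = zero ; arg = zero
              ; emits = false ; extends = false ; moves = stay ; puts = nothing }

sweep : Instr → Sweep
sweep (clr r)    = record idle { res = erase ; dst = r }
sweep (inc r)    = record idle { init = λ _ → true ; nxt = carry₁ ; res = sumBit₁ ; dst = r }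
sweep (putReg r) = record idle { dst = r ; emits = true }
sweep (add r q)  = record idle { nxt = carry ; res = sumBit ; dst = r ; arg = q }
sweep (sub r q)  = record idle { nxt = borrow ; res = sumBit ; dst = r ; arg = q }
sweep (lt r q)   = record idle { nxt = smaller ; dst = r ; arg = q }
sweep (le r q)   = record idle { init = λ _ → true ; nxt = smaller ; dst = r ; arg = q }
sweep (eq r q)   = record idle { init = λ _ → true ; nxt = same ; dst = r ; arg = q }
sweep grow       = record idle { extends = true }
sweep isOne      = record idle { init = isOneᵇ }
sweep (move d)   = record idle { moves = d }
sweep (put l)    = record idle { puts = just l }

stepState : Sweep → Bool → Col → Bool
stepState S c col = nxt S c (get (dst S) col) (get (arg S) col)

stepCol : Sweep → Bool → Col → Col
stepCol S c col = set (dst S) (res S c (get (dst S) col) (get (arg S) col)) col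

sweepState : Sweep → Bool → List Col → Bool
sweepState S c []           = c
sweepState S c (col ∷ cols) = sweepState S (stepState S c col) cols

sweepCols : Sweep → Bool → List Col → List Col
sweepCols S c []           = []
sweepCols S c (col ∷ cols) = stepCol S c col ∷ sweepCols S (stepState S c col) cols

emission : Sweep → Col → Maybe Letter
emission S col = if emits S then just (boolLetter (get (dst S) col)) else nothing

append : List Letter → Maybe Letter → List Letter
append o m = o ++ fromMaybe [] (Maybe.map [_] m)

sweepOutput : Sweep → List Letter → List Col → List Letter
sweepOutput S o []           = o
sweepOutput S o (col ∷ cols) = sweepOutput S (append o (emission S col)) cols

extension : Sweep → List Col
extension S = if extends S then [ constant registerCount false ] else []

-- Memory states and the effect of an instruction

record Mem : Set where
  constructor mem
  field
    regs  : Tup ℕ registerCount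
    hd    : ℕ
    out   : List Letter
    width : ℕ

open Mem public

val-at : Reg → Mem → ℕ
val-at r σ = get r (regs σ)

assign : Reg → ℕ → Mem → Mem
assign r v σ = record σ { regs = set r v (regs σ) }

module _ (x : List Letter) (maxWidth : ℕ) where

  test : Instr → Mem → Bool
  test (lt r q) σ = val-at r σ <ᵇ val-at q σ
  test (le r q) σ = val-at r σ <ᵇ suc (val-at q σ)
  test (eq r q) σ = val-at r σ ≡ᵇ val-at q σ
  test isOne    σ = isOneᵇ (inputCell x (hd σ))
  test _        σ = false

  post : Instr → Mem → Mem
  post (clr r)    σ = assign r 0 σ
  post (inc r)    σ = assign r (suc (val-at r σ)) σ
  post (add r q)  σ = assign r (val-at r σ + val-at q σ) σ
  post (sub r q)  σ = assign r (val-at r σ ∸ val-at q σ) σ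
  post grow       σ = record σ { width = suc (width σ) }
  post (move d)   σ = record σ { hd = moveInput x d (hd σ) }
  post (put l)    σ = record σ { out = out σ ++ [ l ] }
  post (putReg r) σ = record σ { out = out σ ++ map boolLetter (toBits (width σ) (val-at r σ)) }
  post _          σ = σ

  -- Under these conditions no carry or borrow leaves the top column, so registers hold exact
  -- natural numbers and the arithmetic instructions end in state `false`, as `test` claims.
  Fits : Instr → Mem → Set
  Fits (inc r)   σ = suc (val-at r σ) < 2 ^ width σ
  Fits (add r q) σ = val-at r σ + val-at q σ < 2 ^ width σ
  Fits (sub r q) σ = val-at q σ ≤ val-at r σ
  Fits grow      σ = suc (width σ) ≤ maxWidth
  Fits _         σ = ⊤

track : Reg → List Col → List Bool
track r = map (get r)

record Stores (cols : List Col) (σ : Mem) : Set where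
  field
    length-cols : length cols ≡ width σ
    stored      : ∀ r → val (track r cols) ≡ val-at r σ

open Stores public

pairs : Sweep → List Col → List (Bool × Bool)
pairs S = map (λ col → get (dst S) col , get (arg S) col)

sweepState-pairs : ∀ S c cols → sweepState S c cols ≡ finalState (nxt S) c (pairs S cols)
sweepState-pairs S c []           = refl
sweepState-pairs S c (col ∷ cols) = sweepState-pairs S (stepState S c col) cols

track-dst : ∀ S c cols → track (dst S) (sweepCols S c cols) ≡ results (nxt S) (res S) c (pairs S cols)
track-dst S c []           = refl
track-dst S c (col ∷ cols) = cong₂ _∷_ (get-set (dst S) _ col) (track-dst S (stepState S c col) cols)

track-other : ∀ S c cols {r} → r ≢ dst S → track r (sweepCols S c cols) ≡ track r cols
track-other S c []           r≢ = refl
track-other S c (col ∷ cols) r≢ = cong₂ _∷_ (get-set-≢ _ col r≢) (track-other S (stepState S c col) cols r≢)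

length-sweepCols : ∀ S c cols → length (sweepCols S c cols) ≡ length cols
length-sweepCols S c []           = refl
length-sweepCols S c (col ∷ cols) = cong suc (length-sweepCols S (stepState S c col) cols)

val₁-pairs : ∀ S cols → val₁ (pairs S cols) ≡ val (track (dst S) cols)
val₁-pairs S cols = cong val (sym (List.map-∘ cols))

val₂-pairs : ∀ S cols → val₂ (pairs S cols) ≡ val (track (arg S) cols)
val₂-pairs S cols = cong val (sym (List.map-∘ cols))

length-pairs : ∀ S cols → length (pairs S cols) ≡ length cols
length-pairs S = List.length-map _

store-assign : ∀ S c {cols σ v} → Stores cols σ → val (results (nxt S) (res S) c (pairs S cols)) ≡ v →
               Stores (sweepCols S c cols) (assign (dst S) v σ)
store-assign S c {cols} {σ} {v} st e .length-cols = trans (length-sweepCols S c cols) (length-cols st)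
store-assign S c {cols} {σ} {v} st e .stored r with r Fin.≟ dst S
... | yes refl = trans (cong val (track-dst S c cols)) (trans e (sym (get-set (dst S) v (regs σ))))
... | no r≢    = trans (cong val (track-other S c cols r≢)) (trans (stored st r) (sym (get-set-≢ v (regs σ) r≢)))

store-keep : ∀ S c {cols σ} → res S ≡ keep₁ → Stores cols σ → Stores (sweepCols S c cols) σ
store-keep S c {cols} {σ} refl st .length-cols = trans (length-sweepCols S c cols) (length-cols st)
store-keep S c {cols} {σ} refl st .stored r with r Fin.≟ dst S
... | yes refl = trans (cong val (trans (track-dst S c cols) (results-keep (nxt S) c (pairs S cols))))
                       (trans (val₁-pairs S cols) (stored st r))
... | no r≢    = trans (cong val (track-other S c cols r≢)) (stored st r)

no-carry : ∀ {v w p} b → v + ⌊ b ⌋ * p ≡ w → w < p → b ≡ false × v ≡ w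
no-carry {v} false e w<p = refl , trans (sym (+-identityʳ v)) e
no-carry {v} {w} {p} true e w<p = contradiction w<p (≤⇒≯ (≤-trans (≤-reflexive (sym (+-identityʳ p))) (≤-trans (m≤n+m _ v) (≤-reflexive e))))

val-++-zero : ∀ bs → val (bs ++ [ false ]) ≡ val bs
val-++-zero []       = refl
val-++-zero (b ∷ bs) = cong (λ v → ⌊ b ⌋ + 2 * v) (val-++-zero bs)

store-extend : ∀ {cols σ} → Stores cols σ →
               Stores (cols ++ [ constant registerCount false ]) (record σ { width = suc (width σ) })
store-extend {cols} st .length-cols = trans (List.length-++ cols) (trans (+-comm (length cols) 1) (cong suc (length-cols st)))
store-extend {cols} st .stored r = trans (cong val (trans (List.map-++ (get r) cols _) (cong (λ b → track r cols ++ [ b ]) (get-constant r false))))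
                                         (trans (val-++-zero (track r cols)) (stored st r))

sweepOutput-silent : ∀ S o cols → emits S ≡ false → sweepOutput S o cols ≡ o
sweepOutput-silent S o []           e = refl
sweepOutput-silent S o (col ∷ cols) e rewrite e | List.++-identityʳ o = sweepOutput-silent S o cols e

sweepOutput-emits : ∀ S o cols → emits S ≡ true → sweepOutput S o cols ≡ o ++ map boolLetter (track (dst S) cols)
sweepOutput-emits S o []           e = sym (List.++-identityʳ o)
sweepOutput-emits S o (col ∷ cols) e rewrite e =
  trans (sweepOutput-emits S _ cols e) (List.++-assoc o [ boolLetter (get (dst S) col) ] _)

record Effect (x : List Letter) (maxWidth : ℕ) (i : Instr) (cols : List Col) (σ : Mem) : Set where
  private
    S = sweep i
    c = init S (inputCell x (hd σ))
  field
    state≡  : sweepState S c cols ≡ test x maxWidth i σ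
    stores′ : Stores (sweepCols S c cols ++ extension S) (post x maxWidth i σ)
    output≡ : append (sweepOutput S (out σ) cols) (puts S) ≡ out (post x maxWidth i σ)
    head≡   : moveInput x (moves S) (hd σ) ≡ hd (post x maxWidth i σ)
    width≤  : width σ ≤ maxWidth → width (post x maxWidth i σ) ≤ maxWidth

open Effect public

++[] : ∀ {cols σ} → Stores cols σ → Stores (cols ++ []) σ
++[] {cols} {σ} = subst (λ l → Stores l σ) (sym (List.++-identityʳ cols))

silent : ∀ S o cols → emits S ≡ false → append (sweepOutput S o cols) nothing ≡ o
silent S o cols e = trans (List.++-identityʳ _) (sweepOutput-silent S o cols e)

sweepState-keep : ∀ S c cols → nxt S ≡ keep₀ → sweepState S c cols ≡ c
sweepState-keep S c []           refl = refl
sweepState-keep S c (col ∷ cols) refl = sweepState-keep S c cols refl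

effect : ∀ x mw i {cols σ} → Fits x mw i σ → Stores cols σ → Effect x mw i cols σ
effect x mw (clr r) {cols} {σ} fits st = record
  { state≡  = sweepState-keep S _ cols refl
  ; stores′ = ++[] (store-assign _ _ st (results-erase keep₀ _ (pairs S cols)))
  ; output≡ = silent _ _ cols refl ; head≡ = refl ; width≤ = id }
  where S = sweep (clr r)
effect x mw (inc r) {cols} {σ} fits st = record
  { state≡  = trans (sweepState-pairs S true cols) (proj₁ nc)
  ; stores′ = ++[] (store-assign S true st (proj₂ nc))
  ; output≡ = silent _ _ cols refl ; head≡ = refl ; width≤ = id }
  where
  S = sweep (inc r)
  p≡ : 2 ^ length (pairs S cols) ≡ 2 ^ width σ
  p≡ = cong (2 ^_) (trans (length-pairs S cols) (length-cols st))
  nc = no-carry (finalState carry₁ true (pairs S cols))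
         (trans (inc-correct true (pairs S cols))
           (trans (+-comm _ 1) (cong suc (trans (val₁-pairs S cols) (stored st r)))))
         (≤-trans fits (≤-reflexive (sym p≡)))
effect x mw (putReg r) {cols} {σ} fits st = record
  { state≡  = sweepState-keep S _ cols refl
  ; stores′ = ++[] (record { length-cols = length-cols st′ ; stored = stored st′ })
  ; output≡ = trans (List.++-identityʳ _) (trans (sweepOutput-emits S (out σ) cols refl)
      (cong (λ bs → out σ ++ map boolLetter bs) bits≡))
  ; head≡ = refl ; width≤ = id }
  where
  S = sweep (putReg r)
  st′ = store-keep S false refl st
  bits≡ : track r cols ≡ toBits (width σ) (val-at r σ)
  bits≡ = trans (sym (toBits-val (track r cols)))
    (cong₂ toBits (trans (List.length-map _ cols) (length-cols st)) (stored st r))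
effect x mw (add r q) {cols} {σ} fits st = record
  { state≡  = trans (sweepState-pairs S false cols) (proj₁ nc)
  ; stores′ = ++[] (store-assign S false st (proj₂ nc))
  ; output≡ = silent _ _ cols refl ; head≡ = refl ; width≤ = id }
  where
  S = sweep (add r q)
  p≡ : 2 ^ length (pairs S cols) ≡ 2 ^ width σ
  p≡ = cong (2 ^_) (trans (length-pairs S cols) (length-cols st))
  nc = no-carry (finalState carry false (pairs S cols))
         (trans (add-correct false (pairs S cols))
           (trans (+-identityʳ _) (cong₂ _+_ (trans (val₁-pairs S cols) (stored st r)) (trans (val₂-pairs S cols) (stored st q)))))
         (≤-trans fits (≤-reflexive (sym p≡)))
effect x mw (sub r q) {cols} {σ} fits st = record
  { state≡  = trans (sweepState-pairs S false cols) (proj₁ nc)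
  ; stores′ = ++[] (store-assign S false st (proj₂ nc))
  ; output≡ = silent _ _ cols refl ; head≡ = refl ; width≤ = id }
  where
  S = sweep (sub r q)
  ps = pairs S cols
  p≡ : length ps ≡ length (results borrow sumBit false ps)
  p≡ = go false ps
    where
    go : ∀ c qs → length qs ≡ length (results borrow sumBit c qs)
    go c []             = refl
    go c ((a , b) ∷ qs) = cong suc (go (borrow c a b) qs)
  eqn : val-at r σ + ⌊ finalState borrow false ps ⌋ * 2 ^ length ps ≡ val (results borrow sumBit false ps) + val-at q σ
  eqn = subst₂ (λ a b → a + ⌊ finalState borrow false ps ⌋ * 2 ^ length ps ≡ val (results borrow sumBit false ps) + b)
          (trans (val₁-pairs S cols) (stored st r)) (trans (val₂-pairs S cols) (stored st q))
          (trans (sub-correct false ps) (+-identityʳ _))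
  go : ∀ b → val-at r σ + ⌊ b ⌋ * 2 ^ length ps ≡ val (results borrow sumBit false ps) + val-at q σ →
       b ≡ false × val (results borrow sumBit false ps) ≡ val-at r σ ∸ val-at q σ
  go false e = refl , trans (sym (m+n∸n≡m _ (val-at q σ))) (cong (_∸ val-at q σ) (trans (sym e) (+-identityʳ _)))
  -- A final borrow would make the minuend plus 2^width equal to result plus subtrahend, but the
  -- result is below 2^width and the subtrahend is at most the minuend.
  go true  e = contradiction
    (+-mono-<-≤ (subst (λ k → val (results borrow sumBit false ps) < 2 ^ k) (sym p≡) (val< (results borrow sumBit false ps))) fits)
    (≤⇒≯ (≤-trans (≤-reflexive (trans (+-comm _ (val-at r σ)) (cong (val-at r σ +_) (sym (+-identityʳ _))))) (≤-reflexive e)))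
  nc = go (finalState borrow false ps) eqn
effect x mw (lt r q) {cols} {σ} fits st = record
  { state≡  = trans (sweepState-pairs S false cols) (trans (smaller-correct false (pairs S cols))
      (cong₂ _<ᵇ_ (trans (val₁-pairs S cols) (stored st r)) (trans (val₂-pairs S cols) (stored st q))))
  ; stores′ = ++[] (store-keep S false refl st)
  ; output≡ = silent _ _ cols refl ; head≡ = refl ; width≤ = id }
  where S = sweep (lt r q)
effect x mw (le r q) {cols} {σ} fits st = record
  { state≡  = trans (sweepState-pairs S true cols) (trans (smaller-correct true (pairs S cols))
      (cong₂ (λ a b → a <ᵇ suc b) (trans (val₁-pairs S cols) (stored st r)) (trans (val₂-pairs S cols) (stored st q))))
  ; stores′ = ++[] (store-keep S true refl st)
  ; output≡ = silent _ _ cols refl ; head≡ = refl ; width≤ = id }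
  where S = sweep (le r q)
effect x mw (eq r q) {cols} {σ} fits st = record
  { state≡  = trans (sweepState-pairs S true cols) (trans (same-correct (pairs S cols))
      (cong₂ _≡ᵇ_ (trans (val₁-pairs S cols) (stored st r)) (trans (val₂-pairs S cols) (stored st q))))
  ; stores′ = ++[] (store-keep S true refl st)
  ; output≡ = silent _ _ cols refl ; head≡ = refl ; width≤ = id }
  where S = sweep (eq r q)
effect x mw grow {cols} {σ} fits st = record
  { state≡  = sweepState-keep S _ cols refl
  ; stores′ = store-extend (store-keep (sweep grow) false refl st)
  ; output≡ = silent _ _ cols refl ; head≡ = refl ; width≤ = λ _ → fits }
  where S = sweep grow
effect x mw isOne {cols} {σ} fits st = record
  { state≡  = sweepState-keep S _ cols refl
  ; stores′ = ++[] (store-keep (sweep isOne) _ refl st)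
  ; output≡ = silent _ _ cols refl ; head≡ = refl ; width≤ = id }
  where S = sweep isOne
effect x mw (move d) {cols} {σ} fits st = record
  { state≡  = sweepState-keep S _ cols refl
  ; stores′ = ++[] (record { length-cols = length-cols st′ ; stored = stored st′ })
  ; output≡ = silent _ _ cols refl ; head≡ = refl ; width≤ = id }
  where
  S = sweep (move d)
  st′ = store-keep S false refl st
effect x mw (put l) {cols} {σ} fits st = record
  { state≡  = sweepState-keep S _ cols refl
  ; stores′ = ++[] (record { length-cols = length-cols st′ ; stored = stored st′ })
  ; output≡ = cong (_++ [ l ]) (sweepOutput-silent _ _ cols refl) ; head≡ = refl ; width≤ = id }
  where
  S = sweep (put l)
  st′ = store-keep S false refl st

open Sweep

-- Program logic

module _ (x : List Letter) (maxWidth iterations : ℕ) where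

  data Runs  : Prog → Mem → Maybe Mem → (Mem → Set) → Set₁
  -- The number bounds the remaining iterations. It belongs to the derivation and not to the
  -- program: the machine keeps no such counter, and the bound is what yields its running time.
  data Loop (i : Instr) (p : Prog) : ℕ → Mem → Maybe Mem → (Mem → Set) → Set₁

  -- Runs p σ m Q: started in σ, the program p terminates on all computation
  -- paths that do not reject; exactly one of them ends in σ′ if m is just σ′,
  -- and all others end in a state satisfying Q.
  data Runs where
    skip✓   : ∀ {σ Q} → Runs skip σ (just σ) Q
    skip✗   : ∀ {σ Q} → Q σ → Runs skip σ nothing Q
    fail✗   : ∀ {σ Q} → Runs fail σ nothing Q
    seq✓    : ∀ {p q σ σ′ m R Q} → Runs p σ (just σ′) R → Runs q σ′ m Q →
              (∀ {τ} → R τ → Runs q τ nothing Q) → Runs (p ⨾ q) σ m Q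
    seq✗    : ∀ {p q σ R Q} → Runs p σ nothing R →
              (∀ {τ} → R τ → Runs q τ nothing Q) → Runs (p ⨾ q) σ nothing Q
    then    : ∀ {i p q σ m Q} → Fits x maxWidth i σ → test x maxWidth i σ ≡ true →
              Runs p (post x maxWidth i σ) m Q → Runs (branch i p q) σ m Q
    else    : ∀ {i p q σ m Q} → Fits x maxWidth i σ → test x maxWidth i σ ≡ false →
              Runs q (post x maxWidth i σ) m Q → Runs (branch i p q) σ m Q
    loop    : ∀ {i p σ m Q} → Loop i p iterations σ m Q → Runs (while i p) σ m Q
    chooseˡ : ∀ {p q σ m Q} → Runs p σ m Q → Runs q σ nothing Q → Runs (choose p q) σ m Q
    chooseʳ : ∀ {p q σ m Q} → Runs p σ nothing Q → Runs q σ m Q → Runs (choose p q) σ m Q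
    weaken  : ∀ {p σ m Q R} → Runs p σ m Q → (∀ {τ} → Q τ → R τ) → Runs p σ m R

  data Loop i p where
    stop✓ : ∀ {f σ Q} → Fits x maxWidth i σ → test x maxWidth i σ ≡ false →
            Loop i p f σ (just (post x maxWidth i σ)) Q
    stop✗ : ∀ {f σ Q} → Fits x maxWidth i σ → test x maxWidth i σ ≡ false → Q (post x maxWidth i σ) →
            Loop i p f σ nothing Q
    more✓ : ∀ {f σ σ′ m R Q} → Fits x maxWidth i σ → test x maxWidth i σ ≡ true →
            Runs p (post x maxWidth i σ) (just σ′) R → Loop i p f σ′ m Q →
            (∀ {τ} → R τ → Loop i p f τ nothing Q) → Loop i p (suc f) σ m Q
    more✗ : ∀ {f σ R Q} → Fits x maxWidth i σ → test x maxWidth i σ ≡ true →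
            Runs p (post x maxWidth i σ) nothing R →
            (∀ {τ} → R τ → Loop i p f τ nothing Q) → Loop i p (suc f) σ nothing Q

-- Compilation

Sym : Set
Sym = ⊤ ⊎ Col

pattern □ = inj₁ tt
pattern col c = inj₂ c

-- A sweep starts and ends on the blank left of the columns: `enter` leaves it, `forth` carries the
-- one-bit state to the blank at the right end, and `back` carries the final state home.
OpState : Set
OpState = ⊤ ⊎ (Bool ⊎ Bool)

pattern enter   = inj₁ tt
pattern forth b = inj₂ (inj₁ b)
pattern back b  = inj₂ (inj₂ b)

-- The control states are positions in the program text. `skip` and `fail` have none, since `entry`
-- goes straight on to the continuation or to `reject`.
Pos : Prog → Set
Pos skip           = ⊥
Pos fail           = ⊥
Pos (p ⨾ q)        = Pos p ⊎ Pos q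
Pos (branch i p q) = OpState ⊎ (Pos p ⊎ Pos q)
Pos (while i p)    = OpState ⊎ Pos p
Pos (choose p q)   = ⊤ ⊎ (Pos p ⊎ Pos q)

OpState-finite : Finite OpState
OpState-finite = ⊎-finite ⊤-finite (⊎-finite Bool-finite Bool-finite)

Pos-finite : ∀ p → Finite (Pos p)
Pos-finite skip           = ⊥-finite
Pos-finite fail           = ⊥-finite
Pos-finite (p ⨾ q)        = ⊎-finite (Pos-finite p) (Pos-finite q)
Pos-finite (branch i p q) = ⊎-finite OpState-finite (⊎-finite (Pos-finite p) (Pos-finite q))
Pos-finite (while i p)    = ⊎-finite OpState-finite (Pos-finite p)
Pos-finite (choose p q)   = ⊎-finite ⊤-finite (⊎-finite (Pos-finite p) (Pos-finite q))

extensionSym : Sweep → Sym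
extensionSym S = if extends S then col (constant registerCount false) else □

module _ {Q : Set} where

  mkMove : Control Q → Direction → Sym → Direction → Maybe Letter → Move Q Sym 1
  mkMove k d s d′ e = record { next = k ; inputMove = d ; workMoves = (s , d′) ∷ [] ; emit = e }

  opMove : Sweep → (OpState → Q) → (Bool → Control Q) → OpState → InputCell → Sym → Move Q Sym 1
  opMove S ι exit enter     cell s       = mkMove (run (ι (forth (init S cell)))) stay s right nothing
  opMove S ι exit (forth b) cell □       = mkMove (run (ι (back b))) stay (extensionSym S) left nothing
  opMove S ι exit (forth b) cell (col c) = mkMove (run (ι (forth (stepState S b c)))) stay (col (stepCol S b c)) right (emission S c)
  opMove S ι exit (back b)  cell □       = mkMove (exit b) (moves S) □ stay (puts S)
  opMove S ι exit (back b)  cell (col c) = mkMove (run (ι (back b))) stay (col c) left nothing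

  -- `k` is the control that follows p, and `ι` embeds the positions of p into the states of the
  -- whole machine. Sequencing therefore costs no step.
  entry : (p : Prog) → (Pos p → Q) → Control Q → Control Q
  entry skip           ι k = k
  entry fail           ι k = reject
  entry (p ⨾ q)        ι k = entry p (ι ∘ inj₁) (entry q (ι ∘ inj₂) k)
  entry (branch i p q) ι k = run (ι (inj₁ enter))
  entry (while i p)    ι k = run (ι (inj₁ enter))
  entry (choose p q)   ι k = run (ι (inj₁ tt))

  branchExit : ∀ i p q → (Pos (branch i p q) → Q) → Control Q → Bool → Control Q
  branchExit i p q ι k true  = entry p (ι ∘ inj₂ ∘ inj₁) k
  branchExit i p q ι k false = entry q (ι ∘ inj₂ ∘ inj₂) k

  whileExit : ∀ i p → (Pos (while i p) → Q) → Control Q → Bool → Control Q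
  whileExit i p ι k true  = entry p (ι ∘ inj₂) (run (ι (inj₁ enter)))
  whileExit i p ι k false = k

  trans′ : (p : Prog) → (Pos p → Q) → Control Q → Pos p → InputCell → Sym → List⁺ (Move Q Sym 1)
  trans′ (p ⨾ q)        ι k (inj₁ a)        = trans′ p (ι ∘ inj₁) (entry q (ι ∘ inj₂) k) a
  trans′ (p ⨾ q)        ι k (inj₂ a)        = trans′ q (ι ∘ inj₂) k a
  trans′ (branch i p q) ι k (inj₁ o)        = λ cell s → opMove (sweep i) (ι ∘ inj₁) (branchExit i p q ι k) o cell s ∷⁺ []
  trans′ (branch i p q) ι k (inj₂ (inj₁ a)) = trans′ p (ι ∘ inj₂ ∘ inj₁) k a
  trans′ (branch i p q) ι k (inj₂ (inj₂ a)) = trans′ q (ι ∘ inj₂ ∘ inj₂) k a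
  trans′ (while i p)    ι k (inj₁ o)        = λ cell s → opMove (sweep i) (ι ∘ inj₁) (whileExit i p ι k) o cell s ∷⁺ []
  trans′ (while i p)    ι k (inj₂ a)        = trans′ p (ι ∘ inj₂) (run (ι (inj₁ enter))) a
  trans′ (choose p q)   ι k (inj₁ tt)       = λ cell s →
    mkMove (entry p (ι ∘ inj₂ ∘ inj₁) k) stay s stay nothing ∷⁺ (mkMove (entry q (ι ∘ inj₂ ∘ inj₂) k) stay s stay nothing ∷ [])
  trans′ (choose p q)   ι k (inj₂ (inj₁ a)) = trans′ p (ι ∘ inj₂ ∘ inj₁) k a
  trans′ (choose p q)   ι k (inj₂ (inj₂ a)) = trans′ q (ι ∘ inj₂ ∘ inj₂) k a

compile : Prog → Machine
compile p = record
  { State        = ⊤ ⊎ Pos p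
  ; stateCount   = proj₁ states
  ; stateFinite  = proj₂ states
  -- A separate start state, since `entry` may be `accept` or `reject`, which are not states.
  ; start        = inj₁ tt
  ; Symbol       = Sym
  ; symbolCount  = proj₁ symbols
  ; symbolFinite = proj₂ symbols
  ; blank        = □
  ; tapeCount    = 1
  ; δ            = δ
  }
  where
  states = ⊎-finite ⊤-finite (Pos-finite p)
  symbols = ⊎-finite ⊤-finite (Tup-finite Bool-finite registerCount)
  δ : ⊤ ⊎ Pos p → InputCell → Vec Sym 1 → List⁺ (Move (⊤ ⊎ Pos p) Sym 1)
  δ (inj₁ tt) cell (s ∷ []) = mkMove (entry p inj₂ accept) stay s stay nothing ∷⁺ []
  δ (inj₂ a)  cell (s ∷ []) = trans′ p inj₂ accept a cell s

-- Computation trees of a machine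

module Trees (M : Machine) (x : List Letter) (memory : ℕ) where
  open Machine M

  moves-of : State → ℕ → Vec (Tape Symbol) tapeCount → List⁺ (Move State Symbol tapeCount)
  moves-of q h ts = δ q (inputCell x h) (Vec.map scanned ts)


  -- A computation tree of bounded height that respects the memory bound throughout and has at most
  -- one accepting leaf. The last index is the output at that leaf, or `nothing` if all leaves
  -- reject.
  data Tree : Configuration M → ℕ → Maybe (List Letter) → Set where
    accepting : ∀ {h ts o t} → space M (configuration accept h ts o) ≤ memory → Tree (configuration accept h ts o) t (just o)
    rejecting : ∀ {h ts o t} → space M (configuration reject h ts o) ≤ memory → Tree (configuration reject h ts o) t nothing
    single    : ∀ {q h ts o t r m} → space M (configuration (run q) h ts o) ≤ memory → moves-of q h ts ≡ m ∷⁺ [] →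
                Tree (perform M x (configuration (run q) h ts o) m) t r → Tree (configuration (run q) h ts o) (suc t) r
    doubleˡ   : ∀ {q h ts o t r m m′} → space M (configuration (run q) h ts o) ≤ memory → moves-of q h ts ≡ m ∷⁺ (m′ ∷ []) →
                Tree (perform M x (configuration (run q) h ts o) m) t r →
                Tree (perform M x (configuration (run q) h ts o) m′) t nothing → Tree (configuration (run q) h ts o) (suc t) r
    doubleʳ   : ∀ {q h ts o t r m m′} → space M (configuration (run q) h ts o) ≤ memory → moves-of q h ts ≡ m ∷⁺ (m′ ∷ []) →
                Tree (perform M x (configuration (run q) h ts o) m) t nothing →
                Tree (perform M x (configuration (run q) h ts o) m′) t r → Tree (configuration (run q) h ts o) (suc t) r

  Tree-≤ : ∀ {c t t′ r} → t ≤ t′ → Tree c t r → Tree c t′ r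
  Tree-≤ t≤ (accepting s) = accepting s
  Tree-≤ t≤ (rejecting s) = rejecting s
  Tree-≤ (s≤s t≤) (single s e t) = single s e (Tree-≤ t≤ t)
  Tree-≤ (s≤s t≤) (doubleˡ s e t t′) = doubleˡ s e (Tree-≤ t≤ t) (Tree-≤ t≤ t′)
  Tree-≤ (s≤s t≤) (doubleʳ s e t t′) = doubleʳ s e (Tree-≤ t≤ t) (Tree-≤ t≤ t′)

  count : ∀ {c c′} → Star (Step M x) c c′ → ℕ
  count = fold (λ _ _ → ℕ) (λ _ k → suc k) 0


  spaceHere : ∀ {c t r} → Tree c t r → space M c ≤ memory
  spaceHere (accepting s) = s
  spaceHere (rejecting s) = s
  spaceHere (single s _ _) = s
  spaceHere (doubleˡ s _ _ _) = s
  spaceHere (doubleʳ s _ _ _) = s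

  bounded : ∀ {c t r} → Tree c t r → ∀ {c′} (ρ : Star (Step M x) c c′) → count ρ ≤ t × space M c′ ≤ memory
  bounded t ε = z≤n , spaceHere t
  bounded (single s e t) (st ◅ ρ) rewrite e with st
  ... | here refl = let a , b = bounded t ρ in s≤s a , b
  bounded (doubleˡ s e t t′) (st ◅ ρ) rewrite e with st
  ... | here refl = let a , b = bounded t ρ in s≤s a , b
  ... | there (here refl) = let a , b = bounded t′ ρ in s≤s a , b
  bounded (doubleʳ s e t t′) (st ◅ ρ) rewrite e with st
  ... | here refl = let a , b = bounded t ρ in s≤s a , b
  ... | there (here refl) = let a , b = bounded t′ ρ in s≤s a , b

  record Accepting (c : Configuration M) : Set where
    constructor acceptingRun
    field
      {end}   : Configuration M
      run-to  : Star (Step M x) c end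
      accepts : control end ≡ accept

  open Accepting public

  none : ∀ {c t} → Tree c t nothing → ¬ Accepting c
  none (rejecting s) (acceptingRun ε ())
  none (single s e t) (acceptingRun (st ◅ ρ) a) rewrite e with st
  ... | here refl = none t (acceptingRun ρ a)
  none (doubleˡ s e t t′) (acceptingRun (st ◅ ρ) a) rewrite e with st
  ... | here refl = none t (acceptingRun ρ a)
  ... | there (here refl) = none t′ (acceptingRun ρ a)
  none (doubleʳ s e t t′) (acceptingRun (st ◅ ρ) a) rewrite e with st
  ... | here refl = none t (acceptingRun ρ a)
  ... | there (here refl) = none t′ (acceptingRun ρ a)

  -- Formulated for an arbitrary list in place of `successors`, so that an equation describing the
  -- list can be matched with `refl` when the choice of a successor is shown to be unique.
  FirstStep : List (Configuration M) → Set
  FirstStep cs = Σ[ c ∈ Configuration M ] (c ∈ cs × Accepting c)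

  UniqueAccepting : List Letter → Configuration M → Set
  UniqueAccepting o c = Σ[ a ∈ Accepting c ] (output (end a) ≡ o × (∀ a′ → a′ ≡ a))

  UniqueFirstStep : List Letter → List (Configuration M) → Set
  UniqueFirstStep o cs = Σ[ s ∈ FirstStep cs ] (output (end (proj₂ (proj₂ s))) ≡ o × (∀ s′ → s′ ≡ s))

  uniqueSingle : ∀ {cs c o} → cs ≡ c ∷ [] → UniqueAccepting o c → UniqueFirstStep o cs
  uniqueSingle refl (a , o≡ , u) = (_ , here refl , a) , o≡ , λ where
    (_ , here refl , a′) → cong (λ b → _ , here refl , b) (u a′)

  uniqueDoubleˡ : ∀ {cs c c′ o} → cs ≡ c ∷ c′ ∷ [] → UniqueAccepting o c → ¬ Accepting c′ → UniqueFirstStep o cs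
  uniqueDoubleˡ refl (a , o≡ , u) n = (_ , here refl , a) , o≡ , λ where
    (_ , here refl , a′)         → cong (λ b → _ , here refl , b) (u a′)
    (_ , there (here refl) , a′) → contradiction a′ n

  uniqueDoubleʳ : ∀ {cs c c′ o} → cs ≡ c ∷ c′ ∷ [] → ¬ Accepting c → UniqueAccepting o c′ → UniqueFirstStep o cs
  uniqueDoubleʳ refl n (a , o≡ , u) = (_ , there (here refl) , a) , o≡ , λ where
    (_ , here refl , a′)         → contradiction a′ n
    (_ , there (here refl) , a′) → cong (λ b → _ , there (here refl) , b) (u a′)

  prepend : ∀ {c} → FirstStep (successors M x c) → Accepting c
  prepend (_ , st , acceptingRun ρ a) = acceptingRun (st ◅ ρ) a

  uniqueRunning : ∀ {q h ts oₜ o} → let c = configuration (run q) h ts oₜ in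
                  UniqueFirstStep o (successors M x c) → UniqueAccepting o c
  uniqueRunning (s , o≡ , u) = prepend s , o≡ , λ where
    (acceptingRun ε ())
    (acceptingRun (st ◅ ρ) a) → cong prepend (u (_ , st , acceptingRun ρ a))

  unique : ∀ {c t o} → Tree c t (just o) → UniqueAccepting o c
  unique (accepting s) = acceptingRun ε refl , refl , λ where
    (acceptingRun ε refl) → refl
  unique (single {q} {h} {ts} {o} s e t)      = uniqueRunning (uniqueSingle (cong (map (perform M x (configuration (run q) h ts o)) ∘ toList) e) (unique t))
  unique (doubleˡ {q} {h} {ts} {o} s e t t′)  = uniqueRunning (uniqueDoubleˡ (cong (map (perform M x (configuration (run q) h ts o)) ∘ toList) e) (unique t) (none t′))
  unique (doubleʳ {q} {h} {ts} {o} s e t t′)  = uniqueRunning (uniqueDoubleʳ (cong (map (perform M x (configuration (run q) h ts o)) ∘ toList) e) (none t) (unique t′))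

open Sweep

cost : ℕ → ℕ → Prog → ℕ
cost iterations opTime skip           = 0
cost iterations opTime fail           = 0
cost iterations opTime (p ⨾ q)        = cost iterations opTime p + cost iterations opTime q
cost iterations opTime (branch i p q) = opTime + (cost iterations opTime p + cost iterations opTime q)
cost iterations opTime (while i p)    = iterations * (opTime + cost iterations opTime p) + opTime
cost iterations opTime (choose p q)   = suc (cost iterations opTime p + cost iterations opTime q)

[]≢∷ʳ : ∀ {A : Set} (xs : List A) {y} → [] ≢ xs ++ [ y ]
[]≢∷ʳ []       ()
[]≢∷ʳ (_ ∷ _) ()

-- A sweep over w columns takes 1 + (w + 1) + (w + 1) steps: entering, then forth and back, each
-- time including the blank at the far end.
opTimeFor : ℕ → ℕ
opTimeFor maxWidth = 2 * maxWidth + 4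

module Soundness (main : Prog) (x : List Letter) (maxWidth iterations : ℕ) where

  M : Machine
  M = compile main
  open Machine M using (State)

  memory : ℕ
  memory = maxWidth + 3

  open Trees M x memory

  opTime : ℕ
  opTime = opTimeFor maxWidth

  -- The tape with the given cells to the left of the head (nearest first) and
  -- the others from the head on.
  tapeAt : List Sym → List Sym → Tape Sym
  tapeAt l []      = tape l □ []
  tapeAt l (s ∷ r) = tape l s r

  -- Tapes record visited cells only. Most sweeps leave a visited blank right of the columns, but
  -- `grow` turns that blank into a column, and initially it has not been visited.
  data Blanks : List Sym → Set where
    none₀ : Blanks []
    one   : Blanks (□ ∷ [])

  bl≤ : ∀ {bl} → Blanks bl → length bl ≤ 1
  bl≤ none₀ = z≤n
  bl≤ one   = s≤s z≤n

  config : Control State → ℕ → Tape Sym → List Letter → Configuration M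
  config k h t o = configuration k h (t ∷ []) o

  Tree-config : ∀ {k k′ h h′ τ τ′ o o′ t r} → k′ ≡ k → h′ ≡ h → τ′ ≡ τ → o′ ≡ o →
                Tree (config k h τ o) t r → Tree (config k′ h′ τ′ o′) t r
  Tree-config refl refl refl refl tr = tr

  Tree-time : ∀ {c t t′ r} → t ≡ t′ → Tree c t r → Tree c t′ r
  Tree-time refl tr = tr

  home : List Col → List Sym → Tape Sym
  home cols bl = tape [] □ (map col cols ++ bl)

  data Represents (k : Control State) (σ : Mem) : Configuration M → Set where
    represents : ∀ {cols bl} → Stores cols σ → width σ ≤ maxWidth → Blanks bl →
                 Represents k σ (config k (hd σ) (home cols bl) (out σ))

  WiredOp : (S : Sweep) → (OpState → State) → (Bool → Control State) → Set
  WiredOp S ι exit = ∀ o cell s → Machine.δ M (ι o) cell (s ∷ []) ≡ opMove S ι exit o cell s ∷⁺ []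

  extensionSyms : Sweep → List Sym
  extensionSyms S = [ extensionSym S ]

  shiftʳ : ∀ l a r → shift M right (tape l a r) ≡ tapeAt (a ∷ l) r
  shiftʳ l a []      = refl
  shiftʳ l a (b ∷ r) = refl

  room : ∀ a b → a + b ≤ maxWidth → ∀ c → c ≤ b + 1 → (a + 1 + suc c) + 0 ≤ memory
  room a b ab c c≤ = ≤-trans (≤-reflexive (l a c)) (≤-trans (+-monoˡ-≤ 2 (+-monoʳ-≤ a c≤)) (≤-trans (≤-reflexive (l′ a b)) (+-monoˡ-≤ 3 ab)))
    where
    l : ∀ a c → a + 1 + suc c + 0 ≡ a + c + 2
    l = solve-∀
    l′ : ∀ a b → a + (b + 1) + 2 ≡ a + b + 3
    l′ = solve-∀

  module _ (S : Sweep) (ι : OpState → State) (exit : Bool → Control State) (wired : WiredOp S ι exit) where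

    -- The scanned cell and the cells to its left are given by an equation, because which of them
    -- comes first is known only after splitting `acc`.
    backward : ∀ acc rest h o b t r →
               length acc + length rest ≤ maxWidth + 1 →
               Tree (config (exit b) (moveInput x (moves S) h) (tape [] □ (map col acc ʳ++ rest)) (append o (puts S))) t r →
               ∀ s l → s ∷ l ≡ map col acc ++ [ □ ] →
               Tree (config (run (ι (back b))) h (tape l s rest) o) (suc (length acc) + t) r
    backward [] rest h o b t r len tr s l refl = single sp (wired (back b) _ □) tr
      where
      sp : suc (length rest) + 0 ≤ memory
      sp = ≤-trans (≤-reflexive (+-identityʳ _)) (≤-trans (s≤s len) (≤-trans (≤-reflexive (sym (+-suc maxWidth 1))) (+-monoʳ-≤ maxWidth (s≤s (s≤s z≤n)))))
    backward (c ∷ acc) rest h o b t r len tr s l refl = single sp (wired (back b) _ (col c)) (go (map col acc ++ [ □ ]) refl)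
      where
      sp : (length (map col acc ++ [ □ ]) + suc (length rest)) + 0 ≤ memory
      sp = ≤-trans (≤-reflexive (cong (λ n → n + suc (length rest) + 0) (trans (List.length-++ (map col acc)) (cong (_+ 1) (List.length-map col acc)))))
        (≤-trans (≤-reflexive (l₁ (length acc) (length rest))) (≤-trans (s≤s len) (≤-trans (≤-reflexive (sym (+-suc maxWidth 1))) (+-monoʳ-≤ maxWidth (s≤s (s≤s z≤n))))))
        where
        l₁ : ∀ a b → a + 1 + suc b + 0 ≡ suc (suc a + b)
        l₁ = solve-∀
      go : ∀ L → L ≡ map col acc ++ [ □ ] →
           Tree (config (run (ι (back b))) h (shift M left (tape L (col c) rest)) (o ++ [])) (suc (length acc) + t) r
      go [] e = contradiction e ([]≢∷ʳ (map col acc))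
      go (s′ ∷ l′) e rewrite List.++-identityʳ o =
        backward acc (col c ∷ rest) h o b t r (≤-trans (≤-reflexive (+-suc (length acc) (length rest))) len) tr s′ l′ e

    forward : ∀ rest acc bl h o b t r → Blanks bl → length acc + length rest ≤ maxWidth →
              Tree (config (exit (sweepState S b rest)) (moveInput x (moves S) h)
                      (tape [] □ (map col acc ʳ++ (map col (sweepCols S b rest) ++ extensionSyms S)))
                      (append (sweepOutput S o rest) (puts S))) t r →
              Tree (config (run (ι (forth b))) h (tapeAt (map col acc ++ [ □ ]) (map col rest ++ bl)) o)
                   (length rest + (suc (suc (length acc + length rest)) + t)) r
    forward [] acc bl h o b t r bls len tr = subst (λ τ → Tree (config (run (ι (forth b))) h τ o) _ r) (sym (lem bls))
        (single (≤-trans (≤-reflexive (cong (λ n → n + 1 + 0) (trans (List.length-++ (map col acc)) (cong (_+ 1) (List.length-map col acc))))) (room (length acc) 0 len 0 z≤n))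
           (wired (forth b) _ □) (go (map col acc ++ [ □ ]) refl))
      where
      lem : ∀ {bl} → Blanks bl → tapeAt (map col acc ++ [ □ ]) bl ≡ tape (map col acc ++ [ □ ]) □ []
      lem none₀ = refl
      lem one = refl
      go : ∀ L → L ≡ map col acc ++ [ □ ] →
           Tree (config (run (ι (back b))) h (shift M left (tape L (extensionSym S) [])) (o ++ [])) (suc (length acc + 0) + t) r
      go [] e = contradiction e ([]≢∷ʳ (map col acc))
      go (s′ ∷ l′) e rewrite List.++-identityʳ o | +-identityʳ (length acc) =
        backward acc (extensionSyms S) h o b t r (+-monoˡ-≤ 1 len) tr s′ l′ e
    forward (c ∷ rest) acc bl h o b t r bls len tr =
      single sp (wired (forth b) _ (col c))
        (subst (λ τ → Tree (config (run (ι (forth b′))) h τ (append o (emission S c))) (length rest + (suc (suc (length acc + suc (length rest))) + t)) r)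
          (sym (shiftʳ (map col acc ++ [ □ ]) (col (stepCol S b c)) (map col rest ++ bl)))
          (Tree-time (cong (λ n → length rest + (suc (suc n) + t)) (sym (+-suc (length acc) (length rest))))
            (forward rest (stepCol S b c ∷ acc) bl h (append o (emission S c)) b′ t r bls (≤-trans (≤-reflexive (sym (+-suc (length acc) (length rest)))) len) tr)))
      where
      b′ = stepState S b c
      sp : (length (map col acc ++ [ □ ]) + suc (length (map col rest ++ bl))) + 0 ≤ memory
      sp = ≤-trans (≤-reflexive (cong₂ (λ m n → m + suc n + 0)
              (trans (List.length-++ (map col acc)) (cong (_+ 1) (List.length-map col acc)))
              (trans (List.length-++ (map col rest)) (cong (_+ length bl) (List.length-map col rest)))))
           (room (length acc) (suc (length rest)) len (length rest + length bl) (≤-trans (+-monoʳ-≤ (length rest) (bl≤ bls)) (n≤1+n _)))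

    fullSweep : ∀ cols bl h o t r → Blanks bl → length cols ≤ maxWidth →
                let b = init S (inputCell x h) in
                Tree (config (exit (sweepState S b cols)) (moveInput x (moves S) h)
                        (tape [] □ (map col (sweepCols S b cols) ++ extensionSyms S))
                        (append (sweepOutput S o cols) (puts S))) t r →
                Tree (config (run (ι enter)) h (home cols bl) o) (opTime + t) r
    fullSweep cols bl h o t r bls len tr = Tree-≤ time≤
      (single sp (wired enter _ □) (subst₂ (λ τ o′ → Tree (config (run (ι (forth _))) h τ o′) _ r)
          (sym (shiftʳ [] □ (map col cols ++ bl))) (sym (List.++-identityʳ o))
          (forward cols [] bl h o _ t r bls len tr)))
      where
      time≤ : suc (length cols + (suc (suc (length cols)) + t)) ≤ opTime + t
      time≤ = ≤-trans (≤-reflexive (l (length cols) t)) (+-monoˡ-≤ t (+-mono-≤ (*-monoʳ-≤ 2 len) (s≤s (s≤s (s≤s (z≤n {1}))))))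
        where
        l : ∀ a t → suc (a + (suc (suc a) + t)) ≡ 2 * a + 3 + t
        l = solve-∀
      sp : suc (length (map col cols ++ bl)) + 0 ≤ memory
      sp = ≤-trans (≤-reflexive (trans (+-identityʳ _) (cong suc (trans (List.length-++ (map col cols)) (cong (_+ length bl) (List.length-map col cols))))))
        (≤-trans (s≤s (+-mono-≤ len (bl≤ bls))) (≤-trans (≤-reflexive (sym (+-suc maxWidth 1))) (+-monoʳ-≤ maxWidth (s≤s (s≤s z≤n)))))

  extended : ∀ S cols → ∃[ bl ] (Blanks bl × map col cols ++ extensionSyms S ≡ map col (cols ++ extension S) ++ bl)
  extended S cols with extends S
  ... | true  = [] , none₀ , trans (sym (List.map-++ col cols _)) (sym (List.++-identityʳ _))
  ... | false = [ □ ] , one , cong (λ l → map col l ++ [ □ ]) (sym (List.++-identityʳ cols))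

  operate : ∀ i ι exit → WiredOp (sweep i) ι exit → ∀ {σ c t r} → Fits x maxWidth i σ →
            Represents (run (ι enter)) σ c →
            (∀ {c′} → Represents (exit (test x maxWidth i σ)) (post x maxWidth i σ) c′ → Tree c′ t r) →
            Tree c (opTime + t) r
  operate i ι exit wired {σ} {t = t} {r} fits (represents {cols} {bl} st w≤ bls) k =
    let ef = effect x maxWidth i fits st
        bl′ , bls′ , e = extended (sweep i) (sweepCols (sweep i) (init (sweep i) (inputCell x (hd σ))) cols)
    in fullSweep (sweep i) ι exit wired cols bl (hd σ) (out σ) t r bls (≤-trans (≤-reflexive (length-cols st)) w≤)
      (Tree-config (cong exit (state≡ ef)) (head≡ ef) (cong (tape [] □) e) (output≡ ef)
        (k (represents (stores′ ef) (width≤ ef w≤) bls′)))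

  retarget : ∀ (exit : Bool → Control State) {b b′ σ c} → b ≡ b′ → Represents (exit b) σ c → Represents (exit b′) σ c
  retarget exit refl rep = rep

  Wired : (p : Prog) → (Pos p → State) → Control State → Set
  Wired p ι k = ∀ a cell s → Machine.δ M (ι a) cell (s ∷ []) ≡ trans′ p ι k a cell s

  guard : Maybe Mem → Maybe (List Letter) → Maybe (List Letter)
  guard (just _) r = r
  guard nothing  r = nothing

  ContGood : Control State → Maybe Mem → ℕ → Maybe (List Letter) → Set
  ContGood k m t r = ∀ {σ c} → m ≡ just σ → Represents k σ c → Tree c t r

  ContBad : Control State → (Mem → Set) → ℕ → Set
  ContBad k Q t = ∀ {σ c} → Q σ → Represents k σ c → Tree c t nothing

  time : Prog → ℕ
  time = cost iterations opTime

  -- The counterpart of `entry` for trees, by induction on the derivation: a tree of the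
  -- continuation from the designated final state, and rejecting trees from all stray final states,
  -- extend to a tree of the program. The costs add up.
  sound : ∀ {p σ m Q} → Runs x maxWidth iterations p σ m Q → ∀ {ι k t r} → Wired p ι k →
          ContGood k m t r → ContBad k Q t →
          ∀ {c} → Represents (entry p ι k) σ c → Tree c (time p + t) (guard m r)
  soundLoop : ∀ {i p f σ m Q} → Loop x maxWidth iterations i p f σ m Q → ∀ {ι k t r} → Wired (while i p) ι k →
          ContGood k m t r → ContBad k Q t →
          ∀ {c} → Represents (run (ι (inj₁ enter))) σ c → Tree c ((f * (opTime + time p) + opTime) + t) (guard m r)

  spaceOf : ∀ {k σ c} → Represents k σ c → space M c ≤ memory
  spaceOf (represents {cols} {bl} st w≤ bls) =
    ≤-trans (≤-reflexive (trans (+-identityʳ _) (cong suc (trans (List.length-++ (map col cols)) (cong (_+ length bl) (trans (List.length-map col cols) (length-cols st)))))))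
        (≤-trans (s≤s (+-mono-≤ w≤ (bl≤ bls))) (≤-trans (≤-reflexive (sym (+-suc maxWidth 1))) (+-monoʳ-≤ maxWidth (s≤s (s≤s z≤n)))))

  sound skip✓ w kg kb rep = kg refl rep
  sound (skip✗ q) w kg kb rep = kb q rep
  sound fail✗ w kg kb (represents st w≤ bls) = rejecting (spaceOf {k = reject} (represents st w≤ bls))
  sound {p = p ⨾ q} {m = m} (seq✓ d e f) {t = t} w kg kb rep =
    Tree-time (sym (+-assoc (time p) (time q) t))
      (sound d (λ a → w (inj₁ a))
        (λ { refl rep′ → sound e (λ a → w (inj₂ a)) kg kb rep′ })
        (λ r rep′ → sound (f r) {r = nothing} (λ a → w (inj₂ a)) (λ ()) kb rep′) rep)
  sound {p = p ⨾ q} (seq✗ d f) {t = t} w kg kb rep =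
    Tree-time (sym (+-assoc (time p) (time q) t))
      (sound d {r = nothing} (λ a → w (inj₁ a)) (λ ())
        (λ r rep′ → sound (f r) {r = nothing} (λ a → w (inj₂ a)) (λ ()) kb rep′) rep)
  sound {p = branch i p q} (then {m = m} fits tst d) {ι} {k} {t} {r} w kg kb rep =
    Tree-≤ (≤-trans (+-monoʳ-≤ opTime (+-monoˡ-≤ t (m≤m+n (time p) (time q)))) (≤-reflexive (sym (+-assoc opTime _ t))))
      (operate i (ι ∘ inj₁) (branchExit i p q ι k) (λ o → w (inj₁ o)) fits rep
        (λ rep′ → sound d (λ a → w (inj₂ (inj₁ a))) kg kb (retarget (branchExit i p q ι k) tst rep′)))
  sound {p = branch i p q} (else {m = m} fits tst d) {ι} {k} {t} {r} w kg kb rep =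
    Tree-≤ (≤-trans (+-monoʳ-≤ opTime (+-monoˡ-≤ t (m≤n+m (time q) (time p)))) (≤-reflexive (sym (+-assoc opTime _ t))))
      (operate i (ι ∘ inj₁) (branchExit i p q ι k) (λ o → w (inj₁ o)) fits rep
        (λ rep′ → sound d (λ a → w (inj₂ (inj₂ a))) kg kb (retarget (branchExit i p q ι k) tst rep′)))
  sound (loop l) w kg kb rep = soundLoop l w kg kb rep
  sound {p = choose p q} (chooseˡ d e) {ι} {k} {t} {r} w kg kb (represents {cols} {bl} st w≤ bls) =
    doubleˡ (spaceOf {k = run (ι (inj₁ tt))} (represents st w≤ bls)) (w (inj₁ tt) _ □)
      (subst (λ o → Tree (config _ _ _ o) _ _) (sym (List.++-identityʳ _))
        (Tree-≤ (+-monoˡ-≤ t (m≤m+n (time p) (time q))) (sound d (λ a → w (inj₂ (inj₁ a))) kg kb (represents st w≤ bls))))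
      (subst (λ o → Tree (config _ _ _ o) _ _) (sym (List.++-identityʳ _))
        (Tree-≤ (+-monoˡ-≤ t (m≤n+m (time q) (time p))) (sound e {r = nothing} (λ a → w (inj₂ (inj₂ a))) (λ ()) kb (represents st w≤ bls))))
  sound {p = choose p q} (chooseʳ d e) {ι} {k} {t} {r} w kg kb (represents {cols} {bl} st w≤ bls) =
    doubleʳ (spaceOf {k = run (ι (inj₁ tt))} (represents st w≤ bls)) (w (inj₁ tt) _ □)
      (subst (λ o → Tree (config _ _ _ o) _ _) (sym (List.++-identityʳ _))
        (Tree-≤ (+-monoˡ-≤ t (m≤m+n (time p) (time q))) (sound d {r = nothing} (λ a → w (inj₂ (inj₁ a))) (λ ()) kb (represents st w≤ bls))))
      (subst (λ o → Tree (config _ _ _ o) _ _) (sym (List.++-identityʳ _))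
        (Tree-≤ (+-monoˡ-≤ t (m≤n+m (time q) (time p))) (sound e (λ a → w (inj₂ (inj₂ a))) kg kb (represents st w≤ bls))))
  sound (weaken d f) w kg kb rep = sound d w kg (λ q → kb (f q)) rep

  soundLoop {i} {p} {f} (stop✓ fits tst) {ι} {k} {t} {r} w kg kb rep =
    Tree-≤ (+-monoˡ-≤ t (m≤n+m opTime (f * (opTime + time p))))
      (operate i (ι ∘ inj₁) (whileExit i p ι k) (λ o → w (inj₁ o)) fits rep
        (λ rep′ → kg refl (retarget (whileExit i p ι k) tst rep′)))
  soundLoop {i} {p} {f} (stop✗ fits tst q) {ι} {k} {t} {r} w kg kb rep =
    Tree-≤ (+-monoˡ-≤ t (m≤n+m opTime (f * (opTime + time p))))
      (operate i (ι ∘ inj₁) (whileExit i p ι k) (λ o → w (inj₁ o)) fits rep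
        (λ rep′ → kb q (retarget (whileExit i p ι k) tst rep′)))
  soundLoop {i} {p} {suc f} (more✓ fits tst d l g) {ι} {k} {t} {r} w kg kb rep =
    Tree-time (shuffle opTime (time p) f t)
      (operate i (ι ∘ inj₁) (whileExit i p ι k) (λ o → w (inj₁ o)) fits rep
        (λ rep′ → sound d (λ a → w (inj₂ a))
           (λ { refl rep″ → soundLoop l w kg kb rep″ })
           (λ q rep″ → soundLoop (g q) {r = nothing} w (λ ()) kb rep″)
           (retarget (whileExit i p ι k) tst rep′)))
    where
    shuffle : ∀ o a f t → o + (a + (f * (o + a) + o + t)) ≡ (suc f * (o + a) + o) + t
    shuffle = solve-∀
  soundLoop {i} {p} {suc f} (more✗ fits tst d g) {ι} {k} {t} {r} w kg kb rep =
    Tree-time (shuffle opTime (time p) f t)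
      (operate i (ι ∘ inj₁) (whileExit i p ι k) (λ o → w (inj₁ o)) fits rep
        (λ rep′ → sound d {r = nothing} (λ a → w (inj₂ a))
           (λ ())
           (λ q rep″ → soundLoop (g q) {r = nothing} w (λ ()) kb rep″)
           (retarget (whileExit i p ι k) tst rep′)))
    where
    shuffle : ∀ o a f t → o + (a + (f * (o + a) + o + t)) ≡ (suc f * (o + a) + o) + t
    shuffle = solve-∀

  initialMem : Mem
  initialMem = mem (constant registerCount 0) 0 [] 0

  -- At the top level the postcondition of stray paths is empty, so all paths but the designated one
  -- reject.
  correct : ∀ {σ} → Runs x maxWidth iterations main initialMem (just σ) (λ _ → ⊥) →
            RunsWithin M x (suc (time main)) memory
            × Σ[ p ∈ AcceptingPath M x ] ((∀ p′ → p′ ≡ p) × result M x p ≡ out σ)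
  correct {σ} d = within , toPath a , (λ p′ → cong toPath (u (fromPath p′))) , o≡
    where
    done : ∀ {σ′ c} → just σ ≡ just σ′ → Represents accept σ′ c → Tree c 0 (just (out σ))
    done refl (represents st w≤ bls) = accepting (spaceOf {k = accept} (represents st w≤ bls))
    tree : Tree (initial M) (suc (time main)) (just (out σ))
    tree = single (≤-trans (s≤s z≤n) (m≤n+m 3 maxWidth)) refl
      (Tree-time (+-identityʳ (time main))
        (sound d (λ a cell s → refl) done (λ ())
          (represents {cols = []} (record { length-cols = refl ; stored = λ r → sym (get-constant r 0) }) z≤n none₀)))
    ua = unique tree
    a = proj₁ ua
    o≡ = proj₁ (proj₂ ua)
    u = proj₂ (proj₂ ua)
    toPath : Accepting (initial M) → AcceptingPath M x
    toPath a = record { final = end a ; path = run-to a ; accepts = accepts a }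
    fromPath : AcceptingPath M x → Accepting (initial M)
    fromPath p = acceptingRun (AcceptingPath.path p) (AcceptingPath.accepts p)
    within : RunsWithin M x (suc (time main)) memory
    within ρ = bounded tree ρ

-- Derived constructs and proof rules

infixr 4.5 ‼_

‼_ : List Instr → Prog
‼ []       = skip
‼ (i ∷ is) = branch i skip skip ⨾ ‼ is

for : Reg → Reg → Prog → Prog
for i r p = while (lt i r) (p ⨾ ‼ inc i ∷ [])

assert : Instr → Prog
assert i = branch i skip fail

module Logic (x : List Letter) (mw iterations : ℕ) where

  Exec : Prog → Mem → Maybe Mem → (Mem → Set) → Set₁
  Exec = Runs x mw iterations

  After : Instr → Mem → Mem
  After = post x mw

  OK : Instr → Mem → Set
  OK = Fits x mw

  AllOK : List Instr → Mem → Set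
  AllOK []       σ = ⊤
  AllOK (i ∷ is) σ = OK i σ × AllOK is (After i σ)

  AfterAll : List Instr → Mem → Mem
  AfterAll []       σ = σ
  AfterAll (i ∷ is) σ = AfterAll is (After i σ)

  infixr 4 _▹_

  _▹_ : ∀ {p q σ σ′ m Q} → Exec p σ (just σ′) (λ _ → ⊥) → Exec q σ′ m Q → Exec (p ⨾ q) σ m Q
  d ▹ e = seq✓ d e (λ ())

  becomes : ∀ {p σ τ τ′ Q} → τ ≡ τ′ → Exec p σ (just τ) Q → Exec p σ (just τ′) Q
  becomes refl d = d

  startingAt : ∀ {p σ σ′ m Q} → σ ≡ σ′ → Exec p σ′ m Q → Exec p σ m Q
  startingAt refl d = d

  Iterate : Instr → Prog → ℕ → Mem → Maybe Mem → (Mem → Set) → Set₁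
  Iterate = Loop x mw iterations

  ends-in : ∀ {i p fu σ τ τ′ Q} → τ ≡ τ′ → Iterate i p fu σ (just τ) Q → Iterate i p fu σ (just τ′) Q
  ends-in refl l = l

  begins-in : ∀ {i p fu σ σ′ m Q} → σ ≡ σ′ → Iterate i p fu σ′ m Q → Iterate i p fu σ m Q
  begins-in refl l = l

  again : ∀ {i p fu σ σ′ m Q} → OK i σ → test x mw i σ ≡ true → Exec p (After i σ) (just σ′) (λ _ → ⊥) →
          Iterate i p fu σ′ m Q → Iterate i p (suc fu) σ m Q
  again ok e d l = more✓ ok e d l (λ ())

  plain : ∀ i {σ Q} → OK i σ → Exec (branch i skip skip) σ (just (After i σ)) Q
  plain i {σ} ok with test x mw i σ in e
  ... | true  = then ok e skip✓
  ... | false = else ok e skip✓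

  block : ∀ is {σ Q} → AllOK is σ → Exec (‼ is) σ (just (AfterAll is σ)) Q
  block []       ok = skip✓
  block (i ∷ is) (ok , oks) = plain i ok ▹ block is oks

  block✗ : ∀ is {σ} {Q : Mem → Set} → AllOK is σ → Q (AfterAll is σ) → Exec (‼ is) σ nothing Q
  block✗ []       ok         q = skip✗ q
  block✗ (i ∷ is) (ok , oks) q = plain i ok ▹ block✗ is oks q

  passed : ∀ {i σ Q} → OK i σ → test x mw i σ ≡ true → Exec (assert i) σ (just (After i σ)) Q
  passed ok e = then ok e skip✓

  failed : ∀ {i σ Q} → OK i σ → test x mw i σ ≡ false → Exec (assert i) σ nothing Q
  failed ok e = else ok e fail✗

  -- Forgets that a path is the designated one: a wrong guess that still runs to the end becomes a
  -- stray path of the surrounding program.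
  demote : ∀ {p σ τ} {Q Q′ : Mem → Set} → Exec p σ (just τ) Q → (∀ {ρ} → Q ρ → Q′ ρ) → Q′ τ → Exec p σ nothing Q′
  demoteLoop : ∀ {i p fu σ τ} {Q Q′ : Mem → Set} → Iterate i p fu σ (just τ) Q → (∀ {ρ} → Q ρ → Q′ ρ) → Q′ τ → Iterate i p fu σ nothing Q′
  weakenLoop : ∀ {i p fu σ m} {Q Q′ : Mem → Set} → Iterate i p fu σ m Q → (∀ {ρ} → Q ρ → Q′ ρ) → Iterate i p fu σ m Q′
  demote skip✓         f q = skip✗ q
  demote (seq✓ d e g)  f q = seq✓ d (demote e f q) (λ r → weaken (g r) f)
  demote (then ok e d) f q = then ok e (demote d f q)
  demote (else ok e d) f q = else ok e (demote d f q)
  demote (loop l)      f q = loop (demoteLoop l f q)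
  demote (chooseˡ d e) f q = chooseˡ (demote d f q) (weaken e f)
  demote (chooseʳ d e) f q = chooseʳ (weaken d f) (demote e f q)
  demote (weaken d g)  f q = demote d (f ∘ g) q
  demoteLoop (stop✓ ok e)       f q = stop✗ ok e q
  demoteLoop (more✓ ok e d l g) f q = more✓ ok e d (demoteLoop l f q) (λ r → weakenLoop (g r) f)
  weakenLoop (stop✓ ok e)       f = stop✓ ok e
  weakenLoop (stop✗ ok e q)     f = stop✗ ok e (f q)
  weakenLoop (more✓ ok e d l g) f = more✓ ok e d (weakenLoop l f) (λ r → weakenLoop (g r) f)
  weakenLoop (more✗ ok e d g)   f = more✗ ok e d (λ r → weakenLoop (g r) f)

  -- Stray paths may arise in any iteration and are carried along by `Bad`. Counter and limit are
  -- known for them as well, so they leave the loop after as many iterations as the designated path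
  -- `f`.
  for-loop : ∀ i r p (f : ℕ → Mem) (Bad : ℕ → Mem → Set) N →
    (∀ j → val-at i (f j) ≡ j × val-at r (f j) ≡ N) →
    (∀ {j τ} → Bad j τ → val-at i τ ≡ j × val-at r τ ≡ N) →
    (∀ j → j < N → Exec (p ⨾ ‼ inc i ∷ []) (f j) (just (f (suc j))) (Bad (suc j))) →
    (∀ {j τ} → j < N → Bad j τ → Exec (p ⨾ ‼ inc i ∷ []) τ nothing (Bad (suc j))) →
    N ≤ iterations →
    Exec (for i r p) (f 0) (just (f N)) (Bad N)
  for-loop i r p f Bad N fv bv good bad N≤ = loop (goodLoop N 0 iterations (+-identityʳ N) N≤)
    where
    lt≡ : ∀ {j τ} → val-at i τ ≡ j × val-at r τ ≡ N → test x mw (lt i r) τ ≡ (j <ᵇ N)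
    lt≡ (a , b) = cong₂ _<ᵇ_ a b
    badLoop : ∀ k j fu {τ} → k + j ≡ N → k ≤ fu → Bad j τ →
              Loop x mw iterations (lt i r) (p ⨾ ‼ inc i ∷ []) fu τ nothing (Bad N)
    badLoop zero    j fu {τ} refl k≤ b = stop✗ tt (trans (lt≡ {τ = τ} (bv b)) (<ᵇ-false {j} ≤-refl)) b
    badLoop (suc k) j (suc fu) {τ} refl k≤ b = more✗ tt (trans (lt≡ {τ = τ} (bv b)) (<ᵇ-true (s≤s (m≤n+m j k)))) (bad (s≤s (m≤n+m j k)) b)
      (λ b′ → badLoop k (suc j) fu (+-suc k j) (s≤s⁻¹ k≤) b′)
    goodLoop : ∀ k j fu → k + j ≡ N → k ≤ fu →
              Loop x mw iterations (lt i r) (p ⨾ ‼ inc i ∷ []) fu (f j) (just (f N)) (Bad N)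
    goodLoop zero    j fu refl k≤ = stop✓ tt (trans (lt≡ {τ = f j} (fv j)) (<ᵇ-false {j} ≤-refl))
    goodLoop (suc k) j (suc fu) refl k≤ = more✓ tt (trans (lt≡ {τ = f j} (fv j)) (<ᵇ-true (s≤s (m≤n+m j k)))) (good j (s≤s (m≤n+m j k)))
      (goodLoop k (suc j) fu (+-suc k j) (s≤s⁻¹ k≤)) (λ b′ → badLoop k (suc j) fu (+-suc k j) (s≤s⁻¹ k≤) b′)

  for-exact : ∀ i r p (f : ℕ → Mem) N {Q} →
    (∀ j → val-at i (f j) ≡ j × val-at r (f j) ≡ N) →
    (∀ j → j < N → Exec (p ⨾ ‼ inc i ∷ []) (f j) (just (f (suc j))) (λ _ → ⊥)) →
    N ≤ iterations →
    Exec (for i r p) (f 0) (just (f N)) Q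
  for-exact i r p f N fv good N≤ = weaken (for-loop i r p f (λ _ _ → ⊥) N fv (λ ()) good (λ _ ()) N≤) λ()

  -- For programs from which no stray path emerges but whose final state depends on facts about the
  -- graph, so that only a property of it can be stated.
  Ends : Prog → Mem → (Mem → Set) → Set₁
  Ends p σ P = Σ[ σ′ ∈ Mem ] (Exec p σ (just σ′) (λ _ → ⊥) × P σ′)

  Stops : Instr → Prog → ℕ → Mem → (Mem → Set) → Set₁
  Stops i p fu σ P = Σ[ σ′ ∈ Mem ] (Iterate i p fu σ (just σ′) (λ _ → ⊥) × P σ′)

  stops-again : ∀ {i p fu σ σ′ P} → OK i σ → test x mw i σ ≡ true → Exec p (After i σ) (just σ′) (λ _ → ⊥) →
                Stops i p fu σ′ P → Stops i p (suc fu) σ P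
  stops-again ok e d (τ , l , r) = τ , again ok e d l , r

  while-ends : ∀ {i p σ P} → Stops i p iterations σ P → Ends (while i p) σ P
  while-ends (τ , l , r) = τ , loop l , r

  for-ends : ∀ i r p (Inv : ℕ → Mem → Set) N →
    (∀ {j τ} → Inv j τ → val-at i τ ≡ j × val-at r τ ≡ N) →
    (∀ {j τ} → j < N → Inv j τ → Ends (p ⨾ ‼ inc i ∷ []) τ (Inv (suc j))) →
    N ≤ iterations →
    ∀ {σ} → Inv 0 σ → Ends (for i r p) σ (Inv N)
  for-ends i r p Inv N iv step N≤ inv₀ = while-ends (go N 0 iterations (+-identityʳ N) N≤ inv₀)
    where
    go : ∀ k j fu {τ} → k + j ≡ N → k ≤ fu → Inv j τ → Stops (lt i r) (p ⨾ ‼ inc i ∷ []) fu τ (Inv N)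
    go zero    j fu {τ} refl k≤ inv = τ , stop✓ tt (trans (cong₂ _<ᵇ_ (proj₁ (iv inv)) (proj₂ (iv inv))) (<ᵇ-false {j} ≤-refl)) , inv
    go (suc k) j (suc fu) {τ} refl k≤ inv = continue (step (s≤s (m≤n+m j k)) inv)
      where
      continue : Ends (p ⨾ ‼ inc i ∷ []) τ (Inv (suc j)) → Stops (lt i r) (p ⨾ ‼ inc i ∷ []) (suc fu) τ (Inv N)
      continue (σ₁ , d , inv₁) = stops-again tt (trans (cong₂ _<ᵇ_ (proj₁ (iv inv)) (proj₂ (iv inv))) (<ᵇ-true (s≤s (m≤n+m j k)))) d
        (go k (suc j) fu (+-suc k j) (s≤s⁻¹ k≤) inv₁)

-- Registers

pattern ten+ r = suc (suc (suc (suc (suc (suc (suc (suc (suc (suc r)))))))))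

rN rN1 rLg rPw rOff rB rS rT rZ rR rM rKb : Reg
rOk rAns rSrc rD rD1 rC rΣ rC2 rΣ2 rV rU rCnt : Reg
rSum rMn rFnd rTie rLam rCur rX rWt rJ rGo rG rEa : Reg
rEb rPos rI rW rE rP rRem rMm rY : Reg
rN   = 0F
rN1  = 1F
rLg  = 2F
rPw  = 3F
rOff = 4F
rB   = 5F
rS   = 6F
rT   = 7F
rZ   = 8F
rR   = 9F
rM   = ten+ 0F
rKb  = ten+ 1F
rOk  = ten+ 2F
rAns = ten+ 3F
rSrc = ten+ 4F
rD   = ten+ 5F
rD1  = ten+ 6F
rC   = ten+ 7F
rΣ   = ten+ 8F
rC2  = ten+ 9F
rΣ2  = ten+ (ten+ 0F)
rV   = ten+ (ten+ 1F)
rU   = ten+ (ten+ 2F)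
rCnt = ten+ (ten+ 3F)
rSum = ten+ (ten+ 4F)
rMn  = ten+ (ten+ 5F)
rFnd = ten+ (ten+ 6F)
rTie = ten+ (ten+ 7F)
rLam = ten+ (ten+ 8F)
rCur = ten+ (ten+ 9F)
rX   = ten+ (ten+ (ten+ 0F))
rWt  = ten+ (ten+ (ten+ 1F))
rJ   = ten+ (ten+ (ten+ 2F))
rGo  = ten+ (ten+ (ten+ 3F))
rG   = ten+ (ten+ (ten+ 4F))
rEa  = ten+ (ten+ (ten+ 5F))
rEb  = ten+ (ten+ (ten+ 6F))
rPos = ten+ (ten+ (ten+ 7F))
rI   = ten+ (ten+ (ten+ 8F))
rW   = ten+ (ten+ (ten+ 9F))
rE   = ten+ (ten+ (ten+ (ten+ 0F)))
rP   = ten+ (ten+ (ten+ (ten+ 1F)))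
rRem = ten+ (ten+ (ten+ (ten+ 2F)))
rMm  = ten+ (ten+ (ten+ (ten+ 3F)))
rY   = ten+ (ten+ (ten+ (ten+ 4F)))

-- Registers are grouped by the part of the program that changes them, so that a specification
-- mentions only the groups concerned. With the groups made explicit, the equations for reading and
-- writing registers hold by computation.
record Con : Set where
  constructor con
  field cN cN1 cLg cPw cOff cB cS cT cZ : ℕ
record Lev : Set where
  constructor lev
  field lR lM lKb lOk lAns : ℕ
record Chk : Set where
  constructor chk
  field kSrc kD kD1 kC kΣ kC2 kΣ2 kV : ℕ
record Enu : Set where
  constructor enu
  field eU eCnt eSum eMn eFnd eTie : ℕ
record Wlk : Set where
  constructor wlk
  field wLam wCur wX wWt wJ : ℕ
record Tmp : Set where
  constructor tmp
  field tGo tG tEa tEb tPos tI tW tE tP tRem tMm tY : ℕ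

st : Con → Lev → Chk → Enu → Wlk → Tmp → ℕ → List Letter → ℕ → Mem
st κ lv ck en wk tm h o w = mem
  ( cN κ , cN1 κ , cLg κ , cPw κ , cOff κ , cB κ , cS κ , cT κ , cZ κ
  , lR lv , lM lv , lKb lv , lOk lv , lAns lv
  , kSrc ck , kD ck , kD1 ck , kC ck , kΣ ck , kC2 ck , kΣ2 ck , kV ck
  , eU en , eCnt en , eSum en , eMn en , eFnd en , eTie en
  , wLam wk , wCur wk , wX wk , wWt wk , wJ wk
  , tGo tm , tG tm , tEa tm , tEb tm , tPos tm , tI tm , tW tm , tE tm , tP tm , tRem tm , tMm tm , tY tm , tt ) h o w
  where open Con; open Lev; open Chk; open Enu; open Wlk; open Tmp

-- Subroutines expect their result registers to be 0 and add to them, and they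
-- clear their argument registers; rZ is always 0.  Matrix rows of the input
-- have length n + 1 (rN1) because of their separators, and rOff is the position
-- of the first row.
edgeP : Prog
edgeP =
  ‼ (add rPos rOff ∷ add rPos rEb ∷ []) ⨾
  for rI rEa (‼ add rPos rN1 ∷ []) ⨾
  ‼ (clr rI ∷ []) ⨾
  for rI rPos (‼ move right ∷ []) ⨾
  branch isOne (‼ inc rG ∷ []) skip ⨾
  ‼ (clr rI ∷ []) ⨾
  for rI rPos (‼ move left ∷ []) ⨾
  ‼ (clr rI ∷ clr rPos ∷ clr rEa ∷ clr rEb ∷ [])

powerP : Prog
powerP = ‼ (clr rP ∷ inc rP ∷ []) ⨾ for rI rE (‼ add rP rP ∷ []) ⨾ ‼ (clr rI ∷ [])

extractP : Prog
extractP = ‼ sub rRem rP ∷ add rMm rP ∷ []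

hashP : Prog
hashP = ‼ (add rY rY ∷ []) ⨾ branch (le rMm rY) (‼ sub rY rMm ∷ []) skip

-- Everything stays scaled by `rP` = 2^`rE`. Repeated subtraction moves the top digit m of `rRem`
-- into `rMm` as m * 2^`rE`, and doubling modulo that number, starting from 2^`rE`, yields the hash
-- already shifted to its place in the weight.
digitP : Prog
digitP =
  ‼ (sub rE rB ∷ []) ⨾
  powerP ⨾
  while (le rP rRem) extractP ⨾
  ‼ (add rY rP ∷ []) ⨾
  for rI rEa hashP ⨾
  ‼ (clr rI ∷ add rW rY ∷ clr rY ∷ clr rMm ∷ [])

-- rM holds the moduli chosen so far as digits of rB bits each, rKb bits in
-- total, so the weight of rEa is obtained by Horner's rule from a leading 1.
weightP : Prog
weightP =
  ‼ (add rE rKb ∷ add rRem rM ∷ []) ⨾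
  powerP ⨾
  ‼ (add rW rP ∷ []) ⨾
  while (lt rZ rE) digitP ⨾
  ‼ (clr rP ∷ clr rEa ∷ [])

-- Counting up until a nondeterministic stop gives every value below the bound exactly one path.
-- Reaching the bound rejects, which keeps all paths finite.
guessP : Reg → Reg → Prog
guessP r bound =
  ‼ (inc rGo ∷ []) ⨾
  while (lt rZ rGo) (choose (‼ clr rGo ∷ []) (‼ (inc r ∷ []) ⨾ assert (lt r bound)))

extendP : Prog
extendP =
  ‼ (add rEa rCur ∷ add rEb rX ∷ []) ⨾ edgeP ⨾ assert (lt rZ rG) ⨾
  ‼ (clr rG ∷ add rEa rX ∷ []) ⨾ weightP ⨾
  ‼ (add rWt rW ∷ clr rW ∷ clr rCur ∷ add rCur rX ∷ clr rX ∷ [])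

stepP : Prog
stepP = guessP rX rN ⨾ extendP

updateP : Prog
updateP =
  branch (eq rFnd rZ) (‼ inc rFnd ∷ clr rMn ∷ add rMn rWt ∷ [])
    (branch (lt rWt rMn) (‼ clr rMn ∷ add rMn rWt ∷ clr rTie ∷ [])
      (branch (eq rWt rMn) (‼ clr rTie ∷ inc rTie ∷ []) skip))

concludeP : Prog
concludeP =
  assert (eq rCur rU) ⨾
  ‼ (inc rCnt ∷ add rSum rWt ∷ add rEa rU ∷ add rEb rV ∷ []) ⨾
  edgeP ⨾
  branch (lt rZ rG) updateP skip ⨾
  ‼ (clr rG ∷ clr rLam ∷ clr rCur ∷ clr rWt ∷ clr rJ ∷ [])

-- The length is guessed beforehand, so that every walk corresponds to exactly one sequence of
-- choices.
insideP : Prog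
insideP =
  guessP rLam rD1 ⨾
  ‼ (add rCur rSrc ∷ []) ⨾
  for rJ rLam stepP ⨾
  concludeP

-- rC and rΣ are the number and the total minimum weight of the vertices at
-- distance at most rD from rSrc.  Guessing fewer vertices fails on the count and
-- guessing a walk that is not minimum exceeds the total weight.
enumerateP : Prog
enumerateP =
  for rU rN (choose skip insideP) ⨾
  assert (eq rCnt rC) ⨾
  assert (eq rSum rΣ) ⨾
  ‼ (clr rU ∷ clr rCnt ∷ clr rSum ∷ [])

-- Reachability is a by-product of testing: a vertex found from the source `rS` is reachable whether
-- or not the modulus under test passes.
recordP : Prog
recordP = branch (eq rSrc rS) (branch (eq rV rT) (‼ clr rAns ∷ inc rAns ∷ []) skip) skip

countP : Prog
countP = ‼ (inc rC2 ∷ add rΣ2 rMn ∷ add rEa rV ∷ []) ⨾ weightP ⨾ ‼ (add rΣ2 rW ∷ clr rW ∷ [])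

-- Every vertex at distance at most d + 1 except the source has a predecessor at distance at most d,
-- so the larger ball is recomputed as a whole and no vertex has to be remembered. The source, whose
-- minimum walk is empty, is a case of its own.
judgeP : Prog
judgeP = branch (eq rV rSrc) (‼ inc rC2 ∷ [])
  (branch (lt rZ rFnd) (branch (lt rZ rTie) (‼ clr rOk ∷ []) countP ⨾ recordP) skip)

-- After a tie the next enumeration could be ambiguous, but rejecting would kill the only surviving
-- path. The rest of the test is skipped instead, with `rOk` at 0.
vertexP : Prog
vertexP = branch (lt rZ rOk) (enumerateP ⨾ judgeP ⨾ ‼ (clr rMn ∷ clr rFnd ∷ clr rTie ∷ [])) skip

layerP : Prog
layerP =
  ‼ (add rD1 rD ∷ inc rD1 ∷ []) ⨾
  for rV rN vertexP ⨾
  ‼ (clr rC ∷ add rC rC2 ∷ clr rΣ ∷ add rΣ rΣ2 ∷ clr rC2 ∷ clr rΣ2 ∷ clr rD1 ∷ clr rV ∷ [])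

checkP : Prog
checkP =
  ‼ (inc rC ∷ []) ⨾
  for rD rR layerP ⨾
  ‼ (clr rC ∷ clr rΣ ∷ clr rD ∷ [])

-- `rM` has just been shifted by one empty digit, so incrementing it runs through the moduli 1, 2,
-- ... in that digit.
searchP : Prog
searchP = while (eq rOk rZ)
  ( ‼ (inc rM ∷ inc rOk ∷ []) ⨾
    for rSrc rN (branch (lt rZ rOk) checkP skip) ⨾
    ‼ (clr rSrc ∷ []) )

levelsP : Prog
levelsP = while (lt rR rN)
  ( ‼ (add rR rR ∷ add rKb rB ∷ clr rOk ∷ []) ⨾
    for rI rB (‼ add rM rM ∷ []) ⨾
    ‼ (clr rI ∷ []) ⨾
    searchP )

outputP : Prog
outputP =
  for rU rN
    ( for rV rN
        ( ‼ (add rEa rU ∷ add rEb rV ∷ []) ⨾ edgeP ⨾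
          branch (lt rZ rG) (‼ (clr rG ∷ add rEa rV ∷ []) ⨾ weightP ⨾ ‼ (putReg rW ∷ put sep ∷ clr rW ∷ [])) skip ) ⨾
      ‼ (clr rV ∷ []) ) ⨾
  branch (lt rZ rAns) (‼ put (bit 1b) ∷ []) (‼ put (bit 0b) ∷ [])

skipUnaryP : Reg → Prog
skipUnaryP r = while isOne (‼ inc r ∷ move right ∷ inc rOff ∷ []) ⨾ ‼ (move right ∷ inc rOff ∷ [])

-- The width has to grow while n is still being read: `rPw` is the least power of two that is at
-- least `rN`, and a column is added whenever it doubles. Once the logarithm is known, `rB` becomes
-- six times it plus 4, and nested counting loops add the columns that the weights require.
setupP : Prog
setupP =
  ‼ (grow ∷ grow ∷ grow ∷ grow ∷ grow ∷ inc rPw ∷ move right ∷ inc rOff ∷ []) ⨾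
  while isOne (‼ (inc rN ∷ []) ⨾ branch (lt rPw rN) (‼ grow ∷ add rPw rPw ∷ inc rLg ∷ []) skip ⨾ ‼ (move right ∷ inc rOff ∷ [])) ⨾
  ‼ (move right ∷ inc rOff ∷ []) ⨾
  skipUnaryP rS ⨾
  skipUnaryP rT ⨾
  for rI rOff (‼ move left ∷ []) ⨾
  ‼ (clr rI ∷ add rN1 rN ∷ inc rN1 ∷
     add rB rLg ∷ add rB rLg ∷ add rB rLg ∷ add rB rLg ∷ add rB rLg ∷ add rB rLg ∷ inc rB ∷ inc rB ∷ inc rB ∷ inc rB ∷ []) ⨾
  for rI rB (‼ (grow ∷ grow ∷ grow ∷ []) ⨾ for rJ rLg (‼ grow ∷ []) ⨾ ‼ (clr rJ ∷ [])) ⨾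
  ‼ (clr rI ∷ inc rR ∷ []) ⨾
  branch (eq rS rT) (‼ inc rAns ∷ []) skip

mainP : Prog
mainP = setupP ⨾ levelsP ⨾ outputP

-- Correctness of the edge, weight and guessing subroutines

tmp₀ : Tmp
tmp₀ = tmp 0 0 0 0 0 0 0 0 0 0 0 0

edgeArgs : ℕ → ℕ → Tmp
edgeArgs u v = record tmp₀ { tEa = u ; tEb = v }

edgeBit weightArg weightValue guessing : ℕ → Tmp
edgeBit g     = record tmp₀ { tG = g }
weightArg v   = record tmp₀ { tEa = v }
weightValue a = record tmp₀ { tW = a }
guessing g    = record tmp₀ { tGo = g }

record Setting : Set where
  field
    x : List Letter
    mw iterations n lg pw off b s t wd : ℕ
    adj   : ℕ → ℕ → Bool
    adj-< : ∀ {u v} → adj u v ≡ true → v < n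

module Subroutines (𝒮 : Setting) where

  open Setting 𝒮
  open Logic x mw iterations

  κ : Con
  κ = con n (suc n) lg pw off b s t 0

  cap : ℕ
  cap = 2 ^ wd

  S : Lev → Chk → Enu → Wlk → Tmp → List Letter → Mem
  S lv ck en wk tm o = st κ lv ck en wk tm 0 o wd

  -- Specifications as types: the analysis of the test assumes them and stays independent of how
  -- edges and weights are computed.
  EdgeRuns : Set₁
  EdgeRuns = ∀ {lv ck en wk o} u v → u < n → v < n → ∀ {Q} →
    Exec edgeP (S lv ck en wk (edgeArgs u v) o) (just (S lv ck en wk (edgeBit ⌊ adj u v ⌋) o)) Q

  WeightRuns : (ℕ → ℕ) → ℕ → ℕ → ℕ → Set₁
  WeightRuns w R M kb = ∀ {ok ans ck en wk o} v → v < n → ∀ {Q} →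
    Exec weightP (S (lev R M kb ok ans) ck en wk (weightArg v) o) (just (S (lev R M kb ok ans) ck en wk (weightValue (w v)) o)) Q

  module Edges
    (cell : ∀ {u v} → u < n → v < n → inputCell x (off + v + u * suc n) ≡ letter (boolLetter (adj u v)))
    (cell-≤ : ∀ {u v} → u < n → v < n → off + v + u * suc n ≤ length x)
    (room : length x + suc n < cap)
    (length≤ : length x ≤ iterations) (n≤ : n ≤ iterations) where

    position : ℕ → ℕ → ℕ
    position v zero    = off + v
    position v (suc u) = position v u + suc n

    position-≡ : ∀ v u → position v u ≡ off + v + u * suc n
    position-≡ v zero    = sym (+-identityʳ _)
    position-≡ v (suc u) = trans (cong (_+ suc n) (position-≡ v u)) (trans (+-assoc (off + v) _ _) (cong (off + v +_) (+-comm (u * suc n) (suc n))))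

    module _ {lv : Lev} {ck : Chk} {en : Enu} {wk : Wlk} {o : List Letter} (u v : ℕ) (u<n : u < n) (v<n : v < n) where

      private
        pos : ℕ
        pos = position v u

        tm : ℕ → ℕ → ℕ → Tmp
        tm g p i = record tmp₀ { tG = g ; tEa = u ; tEb = v ; tPos = p ; tI = i }

        at : Tmp → ℕ → Mem
        at τ h = st κ lv ck en wk τ h o wd

        pos-≤ : ∀ {j} → j < n → position v j ≤ length x
        pos-≤ {j} j<n = ≤-trans (≤-reflexive (position-≡ v j)) (cell-≤ j<n v<n)

        <cap : ∀ {i} → i ≤ length x + suc n → i < cap
        <cap i≤ = ≤-<-trans i≤ room

        off+v≤ : off + v ≤ length x
        off+v≤ = pos-≤ (≤-<-trans z≤n u<n)

        move-right : ∀ {j} → j < pos → moveInput x right j ≡ suc j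
        move-right j< = m≤n⇒m⊓n≡m (s≤s (<⇒≤ (<-≤-trans j< (pos-≤ u<n))))

        readBit : ∀ {Q} → Exec (branch isOne (‼ inc rG ∷ []) skip) (at (tm 0 pos pos) pos) (just (at (tm ⌊ adj u v ⌋ pos pos) pos)) Q
        readBit with adj u v | trans (cong (inputCell x) (position-≡ v u)) (cell u<n v<n)
        ... | true  | e = then tt (cong isOneᵇ e) (block _ (<cap (≤-trans (s≤s z≤n) (m≤n+m (suc n) (length x))) , tt))
        ... | false | e = else tt (cong isOneᵇ e) skip✓

      edge-spec : ∀ {Q} → Exec edgeP (S lv ck en wk (edgeArgs u v) o)
                            (just (S lv ck en wk (edgeBit ⌊ adj u v ⌋) o)) Q
      edge-spec =
        block _ (<cap (≤-trans (m≤m+n off v) (≤-trans off+v≤ (m≤m+n _ _))) , <cap (≤-trans off+v≤ (m≤m+n _ _)) , tt) ▹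
        for-exact rI rEa _ (λ j → at (tm 0 (position v j) j) 0) u (λ j → refl , refl)
          (λ j j< → block _ (<cap (+-monoˡ-≤ (suc n) (pos-≤ (<-trans j< u<n))) , tt) ▹ block _ (<cap (≤-trans (<-trans j< u<n) (≤-trans (n≤1+n n) (m≤n+m (suc n) (length x)))) , tt))
          (≤-trans (<⇒≤ u<n) n≤) ▹
        block _ (tt , tt) ▹
        for-exact rI rPos _ (λ j → at (tm 0 pos j) j) pos (λ j → refl , refl)
          (λ j j< → becomes (cong (at (tm 0 pos (suc j))) (move-right j<))
            (block _ (tt , tt) ▹ block _ (<cap (≤-trans j< (≤-trans (pos-≤ u<n) (m≤m+n _ _))) , tt))) pos≤it ▹
        readBit ▹
        block _ (tt , tt) ▹
        becomes (cong (at (tm ⌊ adj u v ⌋ pos pos)) (n∸n≡0 pos))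
        (for-exact rI rPos _ (λ j → at (tm ⌊ adj u v ⌋ pos j) (pos ∸ j)) pos (λ j → refl , refl)
          (λ j j< → becomes (cong (at (tm ⌊ adj u v ⌋ pos (suc j))) (pred[m∸n]≡m∸[1+n] pos j))
            (block _ (tt , tt) ▹ block _ (<cap (≤-trans j< (≤-trans (pos-≤ u<n) (m≤m+n _ _))) , tt))) pos≤it) ▹
        block _ (tt , tt , tt , tt , tt)
        where
        pos≤it = ≤-trans (pos-≤ u<n) length≤

  module Weights (base : ℕ) (base≡ : base ≡ 2 ^ b) where

    weightFrom : ℕ → List ℕ → ℕ → ℕ
    weightFrom a []       v = a
    weightFrom a (m ∷ hs) v = weightFrom (a * base + hash m v) hs v

    pack : List ℕ → ℕ
    pack []       = 0
    pack (m ∷ hs) = m * 2 ^ (length hs * b) + pack hs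

    data Hashes : List ℕ → Set where
      []  : Hashes []
      _∷_ : ∀ {m hs} → 0 < m × m < base → Hashes hs → Hashes (m ∷ hs)

    power-suc : ∀ k → 2 ^ (suc k * b) ≡ base * 2 ^ (k * b)
    power-suc k = trans (^-distribˡ-+-* 2 b (k * b)) (cong (_* 2 ^ (k * b)) (sym base≡))

    pack-< : ∀ {hs} → Hashes hs → pack hs < 2 ^ (length hs * b)
    pack-< []                                 = s≤s z≤n
    pack-< {m ∷ hs} ((_ , m<) ∷ h) = <-≤-trans (+-monoʳ-< (m * p) (pack-< h))
      (≤-trans (≤-reflexive (+-comm (m * p) p)) (≤-trans (*-monoˡ-≤ p m<) (≤-reflexive (sym (power-suc (length hs))))))
      where p = 2 ^ (length hs * b)

    module _ {R ok ans : ℕ} {ck : Chk} {en : Enu} {wk : Wlk} {o : List Letter} (hs : List ℕ) (v : ℕ)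
      (hashes : Hashes hs)
      (room : 2 * 2 ^ (length hs * b) < cap) (v<cap : v < cap)
      (kb≤ : length hs * b ≤ iterations) (hs≤ : length hs ≤ iterations) (base≤ : base ≤ iterations) (v≤ : v ≤ iterations) where

      private
        K : ℕ
        K = length hs

        lv : Lev
        lv = lev R (pack hs) (K * b) ok ans

        tm : ℕ → ℕ → ℕ → ℕ → ℕ → ℕ → ℕ → Mem
        tm i w e p r mm y = S lv ck en wk (record tmp₀ { tEa = v ; tI = i ; tW = w ; tE = e ; tP = p ; tRem = r ; tMm = mm ; tY = y }) o

        <cap : ∀ {a} → a ≤ 2 * 2 ^ (K * b) → a < cap
        <cap a≤ = ≤-<-trans a≤ room

        double : ℕ → ℕ
        double zero    = 1
        double (suc j) = double j + double j

        double-≡ : ∀ j → double j ≡ 2 ^ j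
        double-≡ zero    = refl
        double-≡ (suc j) = trans (cong₂ _+_ (double-≡ j) (double-≡ j)) (cong (2 ^ j +_) (sym (+-identityʳ (2 ^ j))))

        powers-≤ : ∀ {e} → e ≤ K * b → 2 ^ e ≤ 2 * 2 ^ (K * b)
        powers-≤ e≤ = ≤-trans (^-monoʳ-≤ 2 e≤) (m≤n*m _ 2)

        power-spec : ∀ {w e p r mm y Q} → e ≤ K * b → Exec powerP (tm 0 w e p r mm y) (just (tm 0 w e (2 ^ e) r mm y)) Q
        power-spec {w} {e} {p} {r} {mm} {y} e≤ =
          block _ (tt , <cap (≤-trans (m^n>0 2 e) (powers-≤ e≤)) , tt) ▹
          becomes (cong (λ p → tm e w e p r mm y) (double-≡ e))
            (for-exact rI rE _ (λ j → tm j w e (double j) r mm y) e (λ j → refl , refl)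
              (λ j j< → block _ (<cap (≤-trans (≤-reflexive (double-≡ (suc j))) (powers-≤ (≤-trans j< e≤))) , tt) ▹
                        block _ (<cap (≤-trans (<⇒≤ (n<2^n (suc j))) (powers-≤ (≤-trans j< e≤))) , tt))
              (≤-trans e≤ kb≤)) ▹
          block _ (tt , tt)

        extract : ∀ {w e p y r} → r < p → ∀ q fu acc → q ≤ fu → acc + q * p ≤ 2 * 2 ^ (K * b) → ∀ {Q} →
                  Iterate (le rP rRem) extractP fu (tm 0 w e p (q * p + r) acc y)
                    (just (tm 0 w e p r (acc + q * p) y)) Q
        extract {w} {e} {p} {y} {r} r<p zero fu acc q≤ bd = ends-in (cong (λ m → tm 0 w e p r m y) (sym (+-identityʳ acc))) (stop✓ tt (<ᵇ-false {p} {suc r} r<p))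
        extract {w} {e} {p} {y} {r} r<p (suc q) (suc fu) acc q≤ bd =
          ends-in (cong (λ m → tm 0 w e p r m y) (+-assoc acc p (q * p)))
            (again tt (<ᵇ-true (s≤s p≤))
              (becomes (cong (λ a → tm 0 w e p a (acc + p) y) sub≡) (block _ (p≤ , <cap (≤-trans (≤-trans (m≤m+n (acc + p) (q * p)) (≤-reflexive (+-assoc acc p (q * p)))) bd) , tt)))
              (extract r<p q fu (acc + p) (s≤s⁻¹ q≤) (≤-trans (≤-reflexive (+-assoc acc p (q * p))) bd)))
          where
          p≤ : p ≤ p + q * p + r
          p≤ = ≤-trans (m≤m+n p (q * p)) (m≤m+n _ r)
          sub≡ : p + q * p + r ∸ p ≡ q * p + r
          sub≡ = trans (cong (_∸ p) (+-assoc p (q * p) r)) (m+n∸m≡n p (q * p + r))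

        -- `rY` and the modulus share the factor p, which commutes with doubling and with the
        -- conditional subtraction.
        hash-loop : ∀ {w e r m p} → 0 < m → 0 < p → 2 * (m * p) ≤ 2 * 2 ^ (K * b) → ∀ {Q} →
                    Exec (for rI rEa hashP)
                      (tm 0 w e p r (m * p) (1 * p)) (just (tm v w e p r (m * p) (hash m v * p))) Q
        hash-loop {w} {e} {r} {m} {p} m>0 p>0 bd =
          for-exact rI rEa _ (λ j → tm j w e p r (m * p) (hash m j * p)) v (λ j → refl , refl)
            (λ j j< → (block _ (<cap (y≤ j) , tt) ▹ reduceStep j) ▹ block _ (≤-<-trans j< v<cap , tt)) v≤
          where
          y≤ : ∀ j → hash m j * p + hash m j * p ≤ 2 * 2 ^ (K * b)
          y≤ j = ≤-trans (+-mono-≤ (*-monoˡ-≤ p (hash-≤ m>0 j)) (≤-trans (*-monoˡ-≤ p (hash-≤ m>0 j)) (m≤m+n (m * p) 0))) bd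
          reduceStep : ∀ j {Q} → Exec (branch (le rMm rY) (‼ sub rY rMm ∷ []) skip) (tm j w e p r (m * p) (hash m j * p + hash m j * p))
                         (just (tm j w e p r (m * p) (hash m (suc j) * p))) Q
          reduceStep j with reduce-cases m (hash m j + hash m j)
          ... | inj₁ (m≤ , e₁) = then tt (<ᵇ-true (s≤s le₁)) (becomes (cong (tm j w e p r (m * p)) y≡) (block _ (le₁ , tt)))
            where
            le₁ : m * p ≤ hash m j * p + hash m j * p
            le₁ = ≤-trans (*-monoˡ-≤ p m≤) (≤-reflexive (*-distribʳ-+ p (hash m j) (hash m j)))
            y≡ : hash m j * p + hash m j * p ∸ m * p ≡ hash m (suc j) * p
            y≡ = trans (cong (_∸ m * p) (sym (*-distribʳ-+ p (hash m j) (hash m j)))) (trans (sym (*-distribʳ-∸ p (hash m j + hash m j) m)) (cong (_* p) (sym e₁)))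
          ... | inj₂ (y<m , e₁) = else tt (<ᵇ-false {m * p} (≤-trans (≤-reflexive (cong suc (sym (*-distribʳ-+ p (hash m j) (hash m j))))) (*-monoˡ-< p {{>-nonZero p>0}} y<m)))
              (becomes (cong (tm j w e p r (m * p)) (trans (sym (*-distribʳ-+ p (hash m j) (hash m j))) (cong (_* p) (sym e₁)))) skip✓)

        -- `rW` holds the accumulator a of Horner's rule, already shifted to its final position. The
        -- bound on `suc a` is invariant because a * base + hash stays below suc a * base.
        levels : ∀ rest → Hashes rest → ∀ a fu → length rest ≤ K → length rest ≤ fu → 0 < a → suc a * 2 ^ (length rest * b) ≤ 2 * 2 ^ (K * b) → ∀ {Q} →
          Iterate (lt rZ rE) digitP fu
            (tm 0 (a * 2 ^ (length rest * b)) (length rest * b) (2 ^ (length rest * b)) (pack rest) 0 0)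
            (just (tm 0 (weightFrom a rest v) 0 1 0 0 0)) Q
        levels [] _ a fu len fu≤ a>0 bd =
          ends-in (cong (λ w → tm 0 w 0 1 0 0 0) (*-identityʳ a)) (stop✓ tt refl)
        levels (m ∷ rest) ((m>0 , m<) ∷ hrest) a (suc fu) len fu≤ a>0 bd =
          again tt (<ᵇ-true e>0)
            ( block _ (b≤e , tt) ▹
              startingAt (cong (λ e → tm 0 w e (2 ^ (suc k * b)) (pack (m ∷ rest)) 0 0) (m+n∸m≡n b (k * b)))
                ( power-spec {w} {k * b} {2 ^ (suc k * b)} {pack (m ∷ rest)} {0} {0} kb≤K ▹
                  loop (extract {w} {k * b} {p} {0} {pack rest} (pack-< hrest) m iterations 0 (≤-trans (<⇒≤ m<) base≤) mp≤) ▹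
                  block _ (<cap (powers-≤ kb≤K) , tt) ▹
                  startingAt (cong (tm 0 w (k * b) p (pack rest) (m * p)) (sym (*-identityˡ p))) (hash-loop {w} {k * b} {pack rest} {m} {p} m>0 p>0 2mp≤) ▹
                  becomes (cong (λ w → tm 0 w (k * b) p (pack rest) 0 0) w≡)
                    (block _ (tt , <cap w≤ , tt , tt , tt)) ) )
            ih
          where
          k = length rest
          p = 2 ^ (k * b)
          w = a * 2 ^ (suc k * b)
          p>0 = m^n>0 2 (k * b)
          kb≤K : k * b ≤ K * b
          kb≤K = *-monoˡ-≤ b (<⇒≤ len)
          b≤e : b ≤ b + k * b
          b≤e = m≤m+n b (k * b)
          b>0 : 0 < b
          b>0 = go b refl
            where
            go : ∀ c → b ≡ c → 0 < b
            go zero e = contradiction (≤-<-trans m>0 (<-≤-trans m< (≤-reflexive (trans base≡ (cong (2 ^_) e))))) (λ { (s≤s ()) })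
            go (suc c) e = subst (0 <_) (sym e) (s≤s z≤n)
          e>0 : 0 < b + k * b
          e>0 = <-≤-trans b>0 b≤e
          2mp≤ : 2 * (m * p) ≤ 2 * 2 ^ (K * b)
          2mp≤ = *-monoʳ-≤ 2 (≤-trans (*-monoˡ-≤ p (<⇒≤ m<)) (≤-trans (≤-reflexive (sym (power-suc k))) (^-monoʳ-≤ 2 (*-monoˡ-≤ b len))))
          mp≤ : m * p ≤ 2 * 2 ^ (K * b)
          mp≤ = ≤-trans (m≤n*m (m * p) 2) 2mp≤
          w≡ : w + hash m v * p ≡ (a * base + hash m v) * p
          w≡ = trans (cong (λ q → a * q + hash m v * p) (power-suc k)) (trans (cong (_+ hash m v * p) (sym (*-assoc a base p))) (sym (*-distribʳ-+ p (a * base) (hash m v))))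
          bd′ : suc (a * base + hash m v) * p ≤ 2 * 2 ^ (K * b)
          bd′ = ≤-trans (*-monoˡ-≤ p (≤-trans (≤-reflexive (sym (+-suc (a * base) (hash m v)))) (≤-trans (+-monoʳ-≤ (a * base) (≤-<-trans (hash-≤ m>0 v) m<)) (≤-reflexive (+-comm (a * base) base)))))
                  (≤-trans (≤-reflexive (trans (*-assoc (suc a) base p) (cong (suc a *_) (sym (power-suc k))))) bd)
          w≤ : w + hash m v * p ≤ 2 * 2 ^ (K * b)
          w≤ = ≤-trans (≤-reflexive w≡) (≤-trans (*-monoˡ-≤ p (n≤1+n (a * base + hash m v))) bd′)
          a′>0 : 0 < a * base + hash m v
          a′>0 = <-≤-trans (*-mono-≤ a>0 (≤-<-trans z≤n m<)) (m≤m+n (a * base) (hash m v))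
          ih = λ {Q : Mem → Set} → levels rest hrest (a * base + hash m v) fu (<⇒≤ len) (s≤s⁻¹ fu≤)
                 a′>0 bd′ {Q}

        whole = levels hs hashes 1 iterations ≤-refl hs≤ (s≤s z≤n) ≤-refl

      weight-spec : ∀ {Q} → Exec weightP (S lv ck en wk (weightArg v) o)
                                 (just (S lv ck en wk (weightValue (weightFrom 1 hs v)) o)) Q
      weight-spec =
        block _ (<cap (≤-trans (<⇒≤ (n<2^n (K * b))) (powers-≤ ≤-refl)) , <cap (≤-trans (<⇒≤ (pack-< hashes)) (powers-≤ ≤-refl)) , tt) ▹
        power-spec {0} {K * b} {0} {pack hs} {0} {0} ≤-refl ▹
        block _ (<cap (powers-≤ ≤-refl) , tt) ▹
        loop (begins-in (cong (λ w → tm 0 w (K * b) (2 ^ (K * b)) (pack hs) 0 0) (sym (*-identityˡ (2 ^ (K * b))))) whole) ▹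
        block _ (tt , tt , tt)

  -- `σ y g` is the memory with guess y and flag g, known only through what the loop reads and
  -- writes, so that one proof covers the guessing of vertices and of lengths.
  module Guess {r bound : Reg} {N : ℕ} (σ : ℕ → ℕ → Mem)
    (incGo : ∀ y g → After (inc rGo) (σ y g) ≡ σ y (suc g))
    (clrGo : ∀ y g → After (clr rGo) (σ y g) ≡ σ y 0)
    (incR  : ∀ y g → After (inc r) (σ y g) ≡ σ (suc y) g)
    (atZ     : ∀ y g → val-at rZ (σ y g) ≡ 0)
    (atGo    : ∀ y g → val-at rGo (σ y g) ≡ g)
    (atR     : ∀ y g → val-at r (σ y g) ≡ y)
    (atBound : ∀ y g → val-at bound (σ y g) ≡ N)
    (atWidth : ∀ y g → Mem.width (σ y g) ≡ wd)
    (N>0 : 0 < N) (N<cap : N < cap) (N< : N < iterations) where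

    Other : Maybe ℕ → Mem → Set
    Other tgt τ = ∃[ y ] (y < N × just y ≢ tgt × τ ≡ σ y 0)

    private
      body : Prog
      body = choose (‼ clr rGo ∷ []) (‼ (inc r ∷ []) ⨾ assert (lt r bound))

      fits : ∀ i → i < N → suc (val-at r (σ i 1)) < 2 ^ Mem.width (σ i 1)
      fits i i<N = subst₂ (λ a w → suc a < 2 ^ w) (sym (atR i 1)) (sym (atWidth i 1)) (≤-<-trans i<N N<cap)

      running : ∀ i → test x mw (lt rZ rGo) (σ i 1) ≡ true
      running i = cong₂ _<ᵇ_ (atZ i 1) (atGo i 1)

      stopped : ∀ i → test x mw (lt rZ rGo) (σ i 0) ≡ false
      stopped i = cong₂ _<ᵇ_ (atZ i 0) (atGo i 0)

      halt✗ : ∀ i {Q : Mem → Set} → Q (σ i 0) → Exec (‼ clr rGo ∷ []) (σ i 1) nothing Q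
      halt✗ i {Q} q = block✗ _ (tt , tt) (subst Q (sym (clrGo i 1)) q)

      incremented : ∀ i → i < N → ∀ {Q} → Exec (‼ inc r ∷ []) (σ i 1) (just (σ (suc i) 1)) Q
      incremented i i<N = becomes (incR i 1) (block _ (fits i i<N , tt))

      below : ∀ i → test x mw (lt r bound) (σ (suc i) 1) ≡ (suc i <ᵇ N)
      below i = cong₂ _<ᵇ_ (atR (suc i) 1) (atBound (suc i) 1)

      continue✗ : ∀ i → i < N → ∀ {Q : Mem → Set} → (suc i < N → Q (σ (suc i) 1)) →
                  Exec (‼ (inc r ∷ []) ⨾ assert (lt r bound)) (σ i 1) nothing Q
      continue✗ i i<N q with suc i <? N
      ... | yes i+1< = incremented i i<N ▹ then tt (trans (below i) (<ᵇ-true i+1<)) (skip✗ (q i+1<))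
      ... | no i+1≮  = incremented i i<N ▹ else tt (trans (below i) (<ᵇ-false (≮⇒≥ i+1≮))) fail✗

      loop✗ : ∀ tgt k i fu → N ≤ k + i → k < fu → i < N → (∀ y → i ≤ y → just y ≢ tgt) →
              Iterate (lt rZ rGo) body fu (σ i 1) nothing (Other tgt)
      loop✗ tgt zero    i fu       N≤ k< i<N far = contradiction (<-≤-trans i<N N≤) (<-irrefl refl)
      loop✗ tgt (suc k) i (suc fu) N≤ k< i<N far = more✗ {R = λ τ → τ ≡ σ i 0 ⊎ (τ ≡ σ (suc i) 1 × suc i < N)} tt (running i)
        (chooseˡ (halt✗ i (inj₁ refl)) (continue✗ i i<N (λ i+1< → inj₂ (refl , i+1<))))
        λ where
          (inj₁ refl)          → stop✗ tt (stopped i) (i , i<N , far i ≤-refl , refl)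
          (inj₂ (refl , i+1<)) → loop✗ tgt k (suc i) fu (≤-trans N≤ (≤-reflexive (sym (+-suc k i)))) (s≤s⁻¹ k<) i+1< (λ y i<y → far y (<⇒≤ i<y))

      loop✓ : ∀ y k i fu → N ≤ k + i → k < fu → i ≤ y → y < N →
              Iterate (lt rZ rGo) body fu (σ i 1) (just (σ y 0)) (Other (just y))
      loop✓ y zero    i fu       N≤ k< i≤y y<N = contradiction (<-≤-trans (≤-<-trans i≤y y<N) N≤) (<-irrefl refl)
      loop✓ y (suc k) i (suc fu) N≤ k< i≤y y<N with m≤n⇒m<n∨m≡n i≤y
      ... | inj₁ i<y  = more✓ {R = λ τ → τ ≡ σ i 0} tt (running i)
        (chooseʳ (halt✗ i refl)
          (incremented i (≤-<-trans i≤y y<N) ▹ then tt (trans (below i) (<ᵇ-true (≤-<-trans i<y y<N))) skip✓))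
        (loop✓ y k (suc i) fu (≤-trans N≤ (≤-reflexive (sym (+-suc k i)))) (s≤s⁻¹ k<) i<y y<N)
        λ { refl → stop✗ tt (stopped i) (i , ≤-<-trans i≤y y<N , (λ { refl → <-irrefl refl i<y }) , refl) }
      ... | inj₂ refl = more✓ {R = λ τ → τ ≡ σ (suc i) 1 × suc i < N} tt (running i)
        (chooseˡ (becomes (clrGo i 1) (block _ (tt , tt))) (continue✗ i y<N (λ i+1< → refl , i+1<)))
        (stop✓ tt (stopped i))
        λ { (refl , i+1<) → loop✗ (just i) k (suc i) fu (≤-trans N≤ (≤-reflexive (sym (+-suc k i)))) (s≤s⁻¹ k<) i+1<
                              (λ { y i<y refl → <-irrefl refl i<y }) }

      started : Exec (‼ inc rGo ∷ []) (σ 0 0) (just (σ 0 1)) (λ _ → ⊥)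
      started = becomes (incGo 0 0) (block _ (subst₂ (λ a w → suc a < 2 ^ w) (sym (atGo 0 0)) (sym (atWidth 0 0)) (≤-<-trans N>0 N<cap) , tt))

    -- Each value below N ends exactly one path, so any one of them, or none, may be declared the
    -- designated guess.
    guess-spec : ∀ tgt → (∀ {y} → tgt ≡ just y → y < N) →
      Exec (guessP r bound) (σ 0 0) (Maybe.map (λ y → σ y 0) tgt) (Other tgt)
    guess-spec nothing  tgt< = started ▹ loop (loop✗ nothing N 0 iterations (≤-reflexive (sym (+-identityʳ N))) N< N>0 (λ _ _ ()))
    guess-spec (just y) tgt< = started ▹ loop (loop✓ y N 0 iterations (≤-reflexive (sym (+-identityʳ N))) N< z≤n (tgt< refl))

-- Guessing a vertex of a ball together with a walk to it

record Best : Set where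
  constructor best
  field least found tied : ℕ

open Best public

-- The effect of `updateP` on its three registers. `found` tells whether `least` is meaningful yet,
-- and a new least value cancels earlier ties.
update : ℕ → Best → Best
update a (best l zero    t) = best a 1 t
update a (best l (suc f) t) =
  if a <ᵇ l then best a (suc f) 0 else if a ≡ᵇ l then best l (suc f) 1 else best l (suc f) t

enuAt : ℕ → ℕ → ℕ → Best → Enu
enuAt u c s (best l f t) = enu u c s l f t

wlk₀ : Wlk
wlk₀ = wlk 0 0 0 0 0

-- What a test assumes about the weights at hand. `room` covers the largest numbers that occur, sums
-- over the vertices of weights of walks with at most R + 1 edges.
record Weighting (𝒮 : Setting) : Set₁ where
  open Setting 𝒮
  open Subroutines 𝒮 using (EdgeRuns; WeightRuns; cap)
  open Walks n adj adj-< using (LengthFirst)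
  field
    w : ℕ → ℕ
    R M kb maxWeight : ℕ
    edge-run    : EdgeRuns
    weight-run  : WeightRuns w R M kb
    w≤          : ∀ v → w v ≤ maxWeight
    lengthFirst : LengthFirst w
    room        : suc (suc n) * (suc (suc R) * suc maxWeight) < cap
    n<          : n < iterations
    R<          : R < iterations

record Spot {𝒮 : Setting} (𝒲 : Weighting 𝒮) : Set where
  open Setting 𝒮
  open Weighting 𝒲
  field
    src   : ℕ
    src<n : src < n
    d     : ℕ
    d<R   : d < R
    c D c2 D2 v : ℕ
    v<n   : v < n
    ok ans : ℕ
    o      : List Letter

module Enumeration (𝒮 : Setting) (𝒲 : Weighting 𝒮) where

  open Setting 𝒮
  open Weighting 𝒲
  open Logic x mw iterations
  open Subroutines 𝒮
  open Walks n adj adj-<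

  <cap : ∀ {a} → a ≤ suc (suc n) * (suc (suc R) * suc maxWeight) → a < cap
  <cap a≤ = ≤-<-trans a≤ room

  n+2≤ : suc (suc n) ≤ suc (suc n) * (suc (suc R) * suc maxWeight)
  n+2≤ = m≤m*n (suc (suc n)) (suc (suc R) * suc maxWeight)

  row≤ : suc (suc R) * suc maxWeight ≤ suc (suc n) * (suc (suc R) * suc maxWeight)
  row≤ = m≤n*m (suc (suc R) * suc maxWeight) (suc (suc n))

  R+2≤ : suc (suc R) ≤ suc (suc n) * (suc (suc R) * suc maxWeight)
  R+2≤ = ≤-trans (m≤m*n (suc (suc R)) (suc maxWeight)) row≤

  vertex< : ∀ {u} → u < n → u < cap
  vertex< u<n = <cap (≤-trans (<⇒≤ u<n) (≤-trans (n≤1+n n) (≤-trans (n≤1+n _) n+2≤)))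

  walk≤ : ∀ {j} → j ≤ suc R → ∀ {q} → q ≤ j * maxWeight → q ≤ suc R * maxWeight
  walk≤ j≤ q≤ = ≤-trans q≤ (*-monoˡ-≤ maxWeight j≤)

  oneRow : suc R * maxWeight ≤ suc (suc R) * suc maxWeight
  oneRow = *-mono-≤ (n≤1+n (suc R)) (n≤1+n maxWeight)

  wsum≤ : ∀ zs → wsum w zs ≤ length zs * maxWeight
  wsum≤ zs = wsum-≤ w maxWeight zs w≤

  module FromSource (𝒫 : Spot 𝒲) where

    open Spot 𝒫

    lv : Lev
    lv = lev R M kb ok ans

    ck : Chk
    ck = chk src d (suc d) c D c2 D2 v

    end : ℕ → List ℕ → ℕ
    end a []       = a
    end a (z ∷ zs) = end z zs

    walk-to-end : ∀ {a zs z} → Walk a zs z → end a zs ≡ z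
    walk-to-end []      = refl
    walk-to-end (_ ∷ p) = walk-to-end p

    module _ (en : Enu) where

      at : ℕ → ℕ → ℕ → ℕ → Mem
      at lam a q j = S lv ck en (wlk lam a 0 q j) tmp₀ o

      guessed : ℕ → ℕ → ℕ → ℕ → ℕ → Mem
      guessed lam a q j y = S lv ck en (wlk lam a y q j) tmp₀ o

      extend-spec : ∀ {lam a q j y} → a < n → adj a y ≡ true → q + w y < cap → ∀ {Q} →
                    Exec extendP (guessed lam a q j y) (just (at lam y (q + w y) j)) Q
      extend-spec {lam} {a} {q} {j} {y} a<n e q< =
        block _ (vertex< a<n , vertex< (adj-< e) , tt) ▹
        edge-run {lv} {ck} {en} {wlk lam a y q j} {o} a y a<n (adj-< e) ▹
        then tt (cong (λ b → 0 <ᵇ ⌊ b ⌋) e) skip✓ ▹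
        block _ (tt , vertex< (adj-< e) , tt) ▹
        weight-run {ok} {ans} {ck} {en} {wlk lam a y q j} {o} y (adj-< e) ▹
        block _ (q< , tt , tt , vertex< (adj-< e) , tt , tt)

      extend-fail : ∀ {lam a q j y} → a < n → y < n → adj a y ≡ false → ∀ {Q} → Exec extendP (guessed lam a q j y) nothing Q
      extend-fail {lam} {a} {q} {j} {y} a<n y<n e =
        block _ (vertex< a<n , vertex< y<n , tt) ▹
        edge-run {lv} {ck} {en} {wlk lam a y q j} {o} a y a<n y<n ▹
        seq✗ {R = λ _ → ⊥} (else tt (cong (λ b → 0 <ᵇ ⌊ b ⌋) e) fail✗) (λ ())

      step-spec : ∀ {lam a q j} → a < n → (∀ y → q + w y < cap) → ∀ tgt → (∀ {y} → tgt ≡ just y → adj a y ≡ true) →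
                  Exec stepP (at lam a q j) (Maybe.map (λ y → at lam y (q + w y) j) tgt)
                    (λ τ → ∃[ y ] (adj a y ≡ true × just y ≢ tgt × τ ≡ at lam y (q + w y) j))
      step-spec {lam} {a} {q} {j} a<n q< tgt tgt-adj = dispatch tgt tgt-adj (guess-spec tgt (adj-< ∘ tgt-adj))
        where
        open Guess {rX} {rN} {n} (λ y g → S lv ck en (wlk lam a y q j) (guessing g) o)
          (λ _ _ → refl) (λ _ _ → refl) (λ _ _ → refl) (λ _ _ → refl) (λ _ _ → refl) (λ _ _ → refl) (λ _ _ → refl) (λ _ _ → refl)
          (≤-<-trans z≤n a<n) (<cap (≤-trans (n≤1+n n) (≤-trans (n≤1+n _) n+2≤))) n<
        others : ∀ {tgt τ} → Other tgt τ → Exec extendP τ nothing (λ τ → ∃[ y ] (adj a y ≡ true × just y ≢ tgt × τ ≡ at lam y (q + w y) j))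
        others {tgt} (y , y<n , ≢tgt , refl) = decide (adj a y) refl
          where
          decide : ∀ c → adj a y ≡ c → Exec extendP (guessed lam a q j y) nothing (λ τ → ∃[ y ] (adj a y ≡ true × just y ≢ tgt × τ ≡ at lam y (q + w y) j))
          decide true  e = demote {Q = λ _ → ⊥} (extend-spec a<n e (q< y)) (λ ()) (y , e , ≢tgt , refl)
          decide false e = extend-fail a<n y<n e
        dispatch : ∀ tgt → (∀ {y} → tgt ≡ just y → adj a y ≡ true) →
          Exec (guessP rX rN) (at lam a q j) (Maybe.map (guessed lam a q j) tgt) (Other tgt) →
          Exec stepP (at lam a q j) (Maybe.map (λ y → at lam y (q + w y) j) tgt)
            (λ τ → ∃[ y ] (adj a y ≡ true × just y ≢ tgt × τ ≡ at lam y (q + w y) j))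
        dispatch nothing  _       g = seq✗ g others
        dispatch (just y) tgt-adj g = seq✓ g (extend-spec a<n (tgt-adj refl) (q< y)) others

      -- Each walk with r further edges from a is guessed on its own path. The target is any such
      -- walk or none, so one proof covers the designated path and those that have already strayed.
      walk-loop : ∀ {lam} → lam ≤ d → ∀ r j a q fu → r + j ≡ lam → r ≤ fu → a < n → q ≤ j * maxWeight →
        ∀ tgt → (∀ {zs} → tgt ≡ just zs → length zs ≡ r × ∃[ z ] Walk a zs z) →
        {Q : Mem → Set} → (∀ {zs z} → Walk a zs z → length zs ≡ r → just zs ≢ tgt → Q (at lam (end a zs) (q + wsum w zs) lam)) →
        Iterate (lt rJ rLam) (stepP ⨾ ‼ inc rJ ∷ []) fu (at lam a q j)
          (Maybe.map (λ zs → at lam (end a zs) (q + wsum w zs) lam) tgt) Q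
      walk-loop {lam} lam≤ zero j a q fu refl r≤ a<n q≤ nothing tgtW {Q} cl =
        stop✗ tt (<ᵇ-false {lam} ≤-refl) (subst Q (cong (λ q → at lam a q lam) (+-identityʳ q)) (cl [] refl λ()))
      walk-loop {lam} lam≤ zero j a q fu refl r≤ a<n q≤ (just []) tgtW cl =
        ends-in (cong (λ q → at lam a q lam) (sym (+-identityʳ q))) (stop✓ tt (<ᵇ-false {lam} ≤-refl))
      walk-loop {lam} lam≤ zero j a q fu refl r≤ a<n q≤ (just (z ∷ zs)) tgtW cl = contradiction (proj₁ (tgtW refl)) λ()
      walk-loop {lam} lam≤ (suc r) j a q (suc fu) refl r≤ a<n q≤ tgt tgtW {Q} cl = dispatch tgt tgtW cl
        where
        j< : j < suc (r + j)
        j< = s≤s (m≤n+m j r)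
        j≤R : suc j ≤ suc R
        j≤R = s≤s (≤-trans (<⇒≤ (<-≤-trans j< lam≤)) (<⇒≤ d<R))
        step≤ : ∀ y → q + w y ≤ suc j * maxWeight
        step≤ y = ≤-trans (+-mono-≤ q≤ (w≤ y)) (≤-reflexive (+-comm (j * maxWeight) maxWeight))
        q< : ∀ y → q + w y < cap
        q< y = <cap (≤-trans (walk≤ j≤R (step≤ y)) (≤-trans oneRow row≤))
        incJ : suc j < cap
        incJ = <cap (≤-trans j≤R (≤-trans (n≤1+n _) R+2≤))
        Next : Maybe ℕ → Mem → Set
        Next tgt τ = ∃[ y ] (adj a y ≡ true × just y ≢ tgt × τ ≡ at lam y (q + w y) (suc j))
        advance : ∀ tgt → (∀ {y} → tgt ≡ just y → adj a y ≡ true) →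
          Exec (stepP ⨾ ‼ inc rJ ∷ []) (at lam a q j) (Maybe.map (λ y → at lam y (q + w y) (suc j)) tgt) (Next tgt)
        advance nothing  ta = seq✗ (step-spec a<n q< nothing ta) (λ { (y , e , ne , refl) → block✗ _ (incJ , tt) (y , e , ne , refl) })
        advance (just y) ta = seq✓ (step-spec a<n q< (just y) ta) (block _ (incJ , tt)) (λ { (y , e , ne , refl) → block✗ _ (incJ , tt) (y , e , ne , refl) })
        reassoc : ∀ y zs → at lam (end y zs) (q + w y + wsum w zs) lam ≡ at lam (end y zs) (q + (w y + wsum w zs)) lam
        reassoc y zs = cong (λ q → at lam (end y zs) q lam) (+-assoc q (w y) (wsum w zs))
        rest✗ : ∀ {tgt Q} → (∀ {zs z} → Walk a zs z → length zs ≡ suc r → just zs ≢ tgt → Q (at lam (end a zs) (q + wsum w zs) lam)) →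
          ∀ {y} → adj a y ≡ true → (∀ zs → just (y ∷ zs) ≢ tgt) →
          Iterate (lt rJ rLam) (stepP ⨾ ‼ inc rJ ∷ []) fu (at lam y (q + w y) (suc j)) nothing Q
        rest✗ {tgt} {Q} cl {y} e ne = walk-loop lam≤ r (suc j) y (q + w y) fu (+-suc r j) (s≤s⁻¹ r≤) (adj-< e) (step≤ y) nothing (λ ())
          (λ {zs} p len _ → subst Q (sym (reassoc y zs)) (cl (e ∷ p) (cong suc len) (ne zs)))
        dispatch : ∀ tgt → (∀ {zs} → tgt ≡ just zs → length zs ≡ suc r × ∃[ z ] Walk a zs z) →
          {Q : Mem → Set} → (∀ {zs z} → Walk a zs z → length zs ≡ suc r → just zs ≢ tgt → Q (at lam (end a zs) (q + wsum w zs) lam)) →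
          Iterate (lt rJ rLam) (stepP ⨾ ‼ inc rJ ∷ []) (suc fu) (at lam a q j) (Maybe.map (λ zs → at lam (end a zs) (q + wsum w zs) lam) tgt) Q
        dispatch nothing tgtW cl = more✗ tt (<ᵇ-true j<) (advance nothing λ()) (λ { (y , e , _ , refl) → rest✗ {nothing} cl e (λ _ ()) })
        dispatch (just []) tgtW cl = contradiction (proj₁ (tgtW refl)) λ()
        dispatch (just (y ∷ ys)) tgtW cl = follow (tgtW refl) cl
          where
          follow : length (y ∷ ys) ≡ suc r × (∃[ z ] Walk a (y ∷ ys) z) →
            {Q : Mem → Set} → (∀ {zs z} → Walk a zs z → length zs ≡ suc r → just zs ≢ just (y ∷ ys) → Q (at lam (end a zs) (q + wsum w zs) lam)) →
            Iterate (lt rJ rLam) (stepP ⨾ ‼ inc rJ ∷ []) (suc fu) (at lam a q j) (just (at lam (end y ys) (q + (w y + wsum w ys)) lam)) Q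
          follow (len , z , e ∷ p) {Q} cl = more✓ tt (<ᵇ-true j<) (advance (just y) (λ { refl → e }))
              (ends-in (reassoc y ys) (walk-loop lam≤ r (suc j) y (q + w y) fu (+-suc r j) (s≤s⁻¹ r≤) (adj-< e) (step≤ y) (just ys)
                (λ { refl → suc-injective len , z , p })
                (λ {zs} p′ len′ ne → subst Q (sym (reassoc y zs)) (cl (e ∷ p′) (cong suc len′) (λ { refl → ne refl })))))
              (λ { (y′ , e′ , ne , refl) → rest✗ {just (y ∷ ys)} cl e′ (λ { zs refl → ne refl }) })

    rows≤ : ∀ {u q sm} → u < n → q ≤ suc R * maxWeight → sm ≤ u * (suc R * maxWeight) → sm + q ≤ suc u * (suc R * maxWeight)
    rows≤ {u} u<n q≤ sm≤ = ≤-trans (+-mono-≤ sm≤ q≤) (≤-reflexive (+-comm (u * (suc R * maxWeight)) _))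

    rows< : ∀ {u q} → u ≤ n → q ≤ suc u * (suc R * maxWeight) → q < cap
    rows< u≤n q≤ = <cap (≤-trans q≤ (*-mono-≤ (s≤s (m≤n⇒m≤1+n u≤n)) oneRow))

    consider : ℕ → ℕ → Best → Best
    consider u a β = if adj u v then update a β else β

    afterwards : ℕ → ℕ → ℕ → Best → ℕ → Mem
    afterwards u cnt sm β a = S lv ck (enuAt u (suc cnt) (sm + a) (consider u a β)) wlk₀ tmp₀ o

    update-spec : ∀ {u cnt sm β lam a j tm} → a < cap → ∀ {Q} →
      Exec updateP (S lv ck (enuAt u cnt sm β) (wlk lam u 0 a j) tm o)
           (just (S lv ck (enuAt u cnt sm (update a β)) (wlk lam u 0 a j) tm o)) Q
    update-spec {β = best l zero t} {a = a} a< = then tt refl (block _ (<cap (≤-trans (s≤s z≤n) n+2≤) , tt , a< , tt))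
    update-spec {u} {cnt} {sm} {best l (suc f) t} {lam} {a} {j} {tm} a< = decide (a <ᵇ l) (a ≡ᵇ l) refl refl
      where
      decide : ∀ c e → (a <ᵇ l) ≡ c → (a ≡ᵇ l) ≡ e → ∀ {Q} →
        Exec updateP (S lv ck (enuAt u cnt sm (best l (suc f) t)) (wlk lam u 0 a j) tm o)
          (just (S lv ck (enuAt u cnt sm (if c then best a (suc f) 0 else if e then best l (suc f) 1 else best l (suc f) t)) (wlk lam u 0 a j) tm o)) Q
      decide true  _     e₁ e₂ = else tt refl (then tt e₁ (block _ (tt , a< , tt , tt)))
      decide false true  e₁ e₂ = else tt refl (else tt e₁ (then tt e₂ (block _ (tt , <cap (≤-trans (s≤s z≤n) n+2≤) , tt))))
      decide false false e₁ e₂ = else tt refl (else tt e₁ (else tt e₂ skip✓))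

    module _ {u cnt sm : ℕ} {β : Best} (u<n : u < n) (cnt≤ : cnt ≤ u) (sm≤ : sm ≤ u * (suc R * maxWeight)) where

      conclude-spec : ∀ {lam a} → a ≤ suc R * maxWeight → ∀ {Q} →
        Exec concludeP (at (enuAt u cnt sm β) lam u a lam) (just (afterwards u cnt sm β a)) Q
      conclude-spec {lam} {a} a≤ =
        passed tt (≡ᵇ-refl u) ▹
        block _ (<cap (≤-trans (s≤s (≤-trans cnt≤ (<⇒≤ u<n))) (≤-trans (n≤1+n _) n+2≤)) , rows< (<⇒≤ u<n) (rows≤ u<n a≤ sm≤) , vertex< u<n , vertex< v<n , tt) ▹
        edge-run {lv} {ck} {enuAt u (suc cnt) (sm + a) β} {wlk lam u 0 a lam} {o} u v u<n v<n ▹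
        tail (adj u v)
        where
        en′ : Best → Enu
        en′ = enuAt u (suc cnt) (sm + a)
        a< : a < cap
        a< = <cap (≤-trans a≤ (≤-trans oneRow row≤))
        tail : ∀ c {Q} → Exec (branch (lt rZ rG) updateP skip ⨾ ‼ (clr rG ∷ clr rLam ∷ clr rCur ∷ clr rWt ∷ clr rJ ∷ []))
          (S lv ck (en′ β) (wlk lam u 0 a lam) (edgeBit ⌊ c ⌋) o) (just (S lv ck (en′ (if c then update a β else β)) wlk₀ tmp₀ o)) Q
        tail true  = then tt refl (update-spec {u} {suc cnt} {sm + a} {β} {lam} {a} {lam} {edgeBit 1} a<) ▹ block _ (tt , tt , tt , tt , tt , tt)
        tail false = else tt refl skip✓ ▹ block _ (tt , tt , tt , tt , tt , tt)

      -- A walk with the wrong endpoint is rejected at once, so stray paths only ever carry genuine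
      -- walks to u.
      conclude-other : ∀ {lam a c} → c ≢ u → ∀ {Q} → Exec concludeP (at (enuAt u cnt sm β) lam c a lam) nothing Q
      conclude-other c≢u = seq✗ {R = λ _ → ⊥} (failed tt (≡ᵇ-false c≢u)) (λ ())

      walked-spec : ∀ {lam} → lam ≤ d → ∀ tgt → (∀ {zs} → tgt ≡ just zs → length zs ≡ lam × Walk src zs u) →
        {Q : Mem → Set} → (∀ {zs} → Walk src zs u → length zs ≡ lam → just zs ≢ tgt → Q (afterwards u cnt sm β (wsum w zs))) →
        Exec (‼ (add rCur rSrc ∷ []) ⨾ for rJ rLam stepP ⨾ concludeP) (at (enuAt u cnt sm β) lam 0 0 0)
             (Maybe.map (λ zs → afterwards u cnt sm β (wsum w zs)) tgt) Q
      walked-spec {lam} lam≤ tgt tgtW {Q} cl = block _ (vertex< src<n , tt) ▹ dispatch tgt tgtW cl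
        where
        en = enuAt u cnt sm β
        a≤ : ∀ {zs} → length zs ≡ lam → wsum w zs ≤ suc R * maxWeight
        a≤ {zs} refl = ≤-trans (wsum≤ zs) (*-monoˡ-≤ maxWeight (≤-trans lam≤ (≤-trans (<⇒≤ d<R) (n≤1+n R))))
        Arrived : Maybe (List ℕ) → Mem → Set
        Arrived tgt τ = ∃[ zs ] ∃[ z ] (Walk src zs z × length zs ≡ lam × just zs ≢ tgt × τ ≡ at en lam (end src zs) (wsum w zs) lam)
        walking : ∀ tgt → (∀ {zs} → tgt ≡ just zs → length zs ≡ lam × Walk src zs u) →
          Exec (for rJ rLam stepP) (at en lam src 0 0) (Maybe.map (λ zs → at en lam (end src zs) (wsum w zs) lam) tgt) (Arrived tgt)
        walking tgt tgtW = loop (walk-loop en lam≤ lam 0 src 0 iterations (+-identityʳ lam) (<⇒≤ (≤-<-trans lam≤ (<-trans d<R R<))) src<n z≤n tgt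
          (λ e → proj₁ (tgtW e) , u , proj₂ (tgtW e)) (λ {zs} {z} p len ne → zs , z , p , len , ne , refl))
        arrive✗ : ∀ {tgt Q} → (∀ {zs} → Walk src zs u → length zs ≡ lam → just zs ≢ tgt → Q (afterwards u cnt sm β (wsum w zs))) →
          ∀ {τ} → Arrived tgt τ → Exec concludeP τ nothing Q
        arrive✗ {Q = Q} cl (zs , z , p , len , ne , refl) = decide (z ≟ u)
          where
          decide : Dec (z ≡ u) → Exec concludeP (at en lam (end src zs) (wsum w zs) lam) nothing Q
          decide (yes z≡u) = startingAt (cong (λ c → at en lam c (wsum w zs) lam) (trans (walk-to-end p) z≡u))
                           (demote {Q = λ _ → ⊥} (conclude-spec (a≤ {zs} len)) (λ ()) (cl (subst (Walk src zs) z≡u p) len ne))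
          decide (no z≢u)  = conclude-other (λ e → z≢u (trans (sym (walk-to-end p)) e))
        dispatch : ∀ tgt → (∀ {zs} → tgt ≡ just zs → length zs ≡ lam × Walk src zs u) →
          {Q : Mem → Set} → (∀ {zs} → Walk src zs u → length zs ≡ lam → just zs ≢ tgt → Q (afterwards u cnt sm β (wsum w zs))) →
          Exec (for rJ rLam stepP ⨾ concludeP) (at en lam src 0 0) (Maybe.map (λ zs → afterwards u cnt sm β (wsum w zs)) tgt) Q
        dispatch nothing   tgtW cl = seq✗ (walking nothing tgtW) (arrive✗ cl)
        dispatch (just zs) tgtW cl = seq✓ (walking (just zs) tgtW)
          (startingAt (cong (λ c → at en lam c (wsum w zs) lam) (walk-to-end (proj₂ (tgtW refl)))) (conclude-spec (a≤ {zs} (proj₁ (tgtW refl)))))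
          (arrive✗ cl)

      inside-spec : ∀ tgt → (∀ {zs} → tgt ≡ just zs → length zs ≤ d × Walk src zs u) →
        {Q : Mem → Set} → (∀ {zs} → Walk src zs u → length zs ≤ d → just zs ≢ tgt → Q (afterwards u cnt sm β (wsum w zs))) →
        Exec insideP (S lv ck (enuAt u cnt sm β) wlk₀ tmp₀ o) (Maybe.map (λ zs → afterwards u cnt sm β (wsum w zs)) tgt) Q
      inside-spec tgt tgtW {Q} cl = dispatch tgt tgtW cl
        where
        en = enuAt u cnt sm β
        open Guess {rLam} {rD1} {suc d} (λ y g → S lv ck en (wlk y 0 0 0 0) (guessing g) o)
          (λ _ _ → refl) (λ _ _ → refl) (λ _ _ → refl) (λ _ _ → refl) (λ _ _ → refl) (λ _ _ → refl) (λ _ _ → refl) (λ _ _ → refl)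
          (s≤s z≤n) (<cap (≤-trans (≤-trans d<R (≤-trans (n≤1+n R) (n≤1+n _))) R+2≤)) (≤-<-trans d<R R<)
        wrong : ∀ {tgt Q} → (∀ {zs} → Walk src zs u → length zs ≤ d → just zs ≢ tgt → Q (afterwards u cnt sm β (wsum w zs))) →
          ∀ {τ} → Other (Maybe.map length tgt) τ → Exec (‼ (add rCur rSrc ∷ []) ⨾ for rJ rLam stepP ⨾ concludeP) τ nothing Q
        wrong {tgt} cl (y , y< , ne , refl) = walked-spec (s≤s⁻¹ y<) nothing (λ ())
          (λ {zs} p len _ → cl p (≤-trans (≤-reflexive len) (s≤s⁻¹ y<)) (λ e → ne (trans (cong just (sym len)) (cong (Maybe.map length) e))))
        dispatch : ∀ tgt → (∀ {zs} → tgt ≡ just zs → length zs ≤ d × Walk src zs u) →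
          {Q : Mem → Set} → (∀ {zs} → Walk src zs u → length zs ≤ d → just zs ≢ tgt → Q (afterwards u cnt sm β (wsum w zs))) →
          Exec insideP (S lv ck en wlk₀ tmp₀ o) (Maybe.map (λ zs → afterwards u cnt sm β (wsum w zs)) tgt) Q
        dispatch nothing   tgtW cl = seq✗ (guess-spec nothing λ()) (wrong {nothing} cl)
        dispatch (just zs) tgtW cl = seq✓ (guess-spec (just (length zs)) (λ { refl → s≤s (proj₁ (tgtW refl)) }))
          (walked-spec (proj₁ (tgtW refl)) (just zs) (λ { refl → refl , proj₂ (tgtW refl) })
            (λ {zs′} p len ne → cl p (≤-trans (≤-reflexive len) (proj₁ (tgtW refl))) ne))
          (wrong {just zs} cl)
 
 
 
 

-- Breadth-first layers and the Bellman recursion for minimum weights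

module Balls (n : ℕ) (adj : ℕ → ℕ → Bool) (adj-< : ∀ {u v} → adj u v ≡ true → v < n)
  (w : ℕ → ℕ) (maxWeight : ℕ) (w≤ : ∀ v → w v ≤ maxWeight) where

  open Walks n adj adj-<

  module _ (lengthFirst : LengthFirst w) (src : ℕ) (src<n : src < n) where

    private
      Found : ℕ → Set
      Found v = (∃[ xs ] (Min w src xs v × length xs < n)) ⊎ (∀ ys → ¬ Walk src ys v)

      within : ∀ {v} → ℕ → Found v → Bool
      within d (inj₁ (xs , _)) = length xs <ᵇ suc d
      within d (inj₂ _)        = false

      leastWeight : ∀ {v} → Found v → ℕ
      leastWeight (inj₁ (xs , _)) = wsum w xs
      leastWeight (inj₂ _)        = 0

    -- Membership is read off from a walk of minimum weight, whose length is the distance because of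
    -- `lengthFirst`.
    inBall : ℕ → ℕ → Bool
    inBall d v = within d (minimum w v src<n)

    minWeight : ℕ → ℕ
    minWeight v = leastWeight (minimum w v src<n)

    ball-cases : ∀ d v → (∃[ xs ] (Min w src xs v × length xs ≤ d × inBall d v ≡ true × minWeight v ≡ wsum w xs))
                         ⊎ (inBall d v ≡ false × (∀ zs → Walk src zs v → length zs ≤ d → ⊥))
    ball-cases d v with minimum w v src<n
    ... | inj₂ ∄ = inj₂ (refl , λ zs p _ → ∄ zs p)
    ... | inj₁ (xs , mn , _) with length xs <? suc d
    ...   | yes l = inj₁ (xs , mn , s≤s⁻¹ l , <ᵇ-true l , refl)
    ...   | no ¬l = inj₂ (<ᵇ-false (≮⇒≥ ¬l) , λ zs p l → ¬l (s≤s (≤-trans (shortest-≤ (lengthFirst src<n mn) p) l)))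

    in-ball : ∀ {d v zs} → Walk src zs v → length zs ≤ d → ∃[ xs ] (Min w src xs v × length xs ≤ d × inBall d v ≡ true × minWeight v ≡ wsum w xs)
    in-ball {d} {v} {zs} p l with ball-cases d v
    ... | inj₁ r       = r
    ... | inj₂ (_ , ∄) = ⊥-elim (∄ zs p l)

    out-ball : ∀ {d v} → (∀ zs → Walk src zs v → length zs ≤ d → ⊥) → inBall d v ≡ false
    out-ball {d} {v} ∄ with ball-cases d v
    ... | inj₁ (xs , mn , l , _) = ⊥-elim (∄ xs (proj₁ mn) l)
    ... | inj₂ (e , _) = e

    from-ball : ∀ {d v} → inBall d v ≡ true → ∃[ xs ] (Min w src xs v × length xs ≤ d × minWeight v ≡ wsum w xs)
    from-ball {d} {v} e with ball-cases d v
    ... | inj₁ (xs , mn , l , _ , m) = xs , mn , l , m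
    ... | inj₂ (e′ , _) = contradiction (trans (sym e) e′) λ()

    min-≡ : ∀ {v xs ys} → Min w src xs v → Min w src ys v → wsum w xs ≡ wsum w ys
    min-≡ (p , m) (q , m′) = ≤-antisym (m _ q) (m′ _ p)

    minWeight-≤ : ∀ {d v} → inBall d v ≡ true → minWeight v ≤ d * maxWeight
    minWeight-≤ e = let xs , _ , l , m = from-ball e in ≤-trans (≤-reflexive m) (≤-trans (wsum-≤ w maxWeight xs w≤) (*-monoˡ-≤ maxWeight l))

    -- The two quantities of double inductive counting, as partial results over the vertices below
    -- k, which makes them loop invariants.
    countTo sumTo : ℕ → ℕ → ℕ
    countTo d zero    = 0
    countTo d (suc k) = if inBall d k then suc (countTo d k) else countTo d k
    sumTo d zero    = 0
    sumTo d (suc k) = if inBall d k then sumTo d k + minWeight k else sumTo d k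

    countTo-≤ : ∀ d k → countTo d k ≤ k
    countTo-≤ d zero = z≤n
    countTo-≤ d (suc k) with inBall d k
    ... | true  = s≤s (countTo-≤ d k)
    ... | false = m≤n⇒m≤1+n (countTo-≤ d k)

    sumTo-≤ : ∀ d k → sumTo d k ≤ k * (d * maxWeight)
    sumTo-≤ d zero = z≤n
    sumTo-≤ d (suc k) with inBall d k in e
    ... | true  = ≤-trans (+-mono-≤ (sumTo-≤ d k) (minWeight-≤ e)) (≤-reflexive (+-comm (k * (d * maxWeight)) _))
    ... | false = ≤-trans (sumTo-≤ d k) (m≤n+m _ (d * maxWeight))

    UniqueAt : ℕ → ℕ → Set
    UniqueAt d v = ∀ {xs ys} → Min w src xs v → Min w src ys v → length xs ≤ d → xs ≡ ys

    UniqueFrom : ℕ → Set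
    UniqueFrom d = ∀ v → UniqueAt d v

    min-source : ∀ {xs} → Min w src xs src → xs ≡ []
    min-source {[]}     mn = refl
    min-source {x ∷ xs} mn = contradiction (shortest-≤ (lengthFirst src<n mn) []) λ()

    unique-source : ∀ d → UniqueAt d src
    unique-source d mx my _ = trans (min-source mx) (sym (min-source my))

    unique₀ : UniqueFrom 0
    unique₀ v {[]} mx@([] , _) my l = sym (min-source my)

    source-in-ball : ∀ d → inBall d src ≡ true × minWeight src ≡ 0
    source-in-ball d = let xs , mn , _ , e , m = in-ball {d} {src} [] z≤n in e , trans m (cong (wsum w) (min-source mn))

    count₀ : ∀ k → (k ≤ src × countTo 0 k ≡ 0 × sumTo 0 k ≡ 0) ⊎ (src < k × countTo 0 k ≡ 1 × sumTo 0 k ≡ 0)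
    count₀ zero = inj₁ (z≤n , refl , refl)
    count₀ (suc k) with k ≟ src
    count₀ (suc k) | yes refl with inBall 0 k | source-in-ball 0 | count₀ k
    ... | .true | refl , m | inj₁ (_ , c , s) = inj₂ (≤-refl , cong suc c , cong₂ _+_ s m)
    ... | .true | refl , m | inj₂ (k<k , _) = contradiction k<k (<-irrefl refl)
    count₀ (suc k) | no k≢src with inBall 0 k | out-ball {0} {k} (λ { [] [] _ → k≢src refl }) | count₀ k
    ... | .false | refl | inj₁ (k≤ , c , s) = inj₁ (≤∧≢⇒< k≤ k≢src , c , s)
    ... | .false | refl | inj₂ (k> , c , s) = inj₂ (m≤n⇒m≤1+n k> , c , s)

    count₀-total : countTo 0 n ≡ 1 × sumTo 0 n ≡ 0
    count₀-total with count₀ n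
    ... | inj₁ (n≤ , _) = contradiction (<-≤-trans src<n n≤) (<-irrefl refl)
    ... | inj₂ (_ , e)  = e

    module Step (d v : ℕ) where

      -- The contents of the best-predecessor registers after a correct enumeration of the vertices
      -- below u.
      bestTo : ℕ → Best
      bestTo zero    = best 0 0 0
      bestTo (suc u) = if inBall d u then (if adj u v then update (minWeight u) (bestTo u) else bestTo u) else bestTo u

      Pred : ℕ → Set
      Pred u = inBall d u ≡ true × adj u v ≡ true

      -- The possible readings of the registers. `Untied` includes that no other predecessor attains
      -- the least weight, and `Tied` exhibits two that do.
      NoPred Untied Tied : ℕ → Best → Set
      NoPred k β = found β ≡ 0 × tied β ≡ 0 × (∀ u → u < k → ¬ Pred u)
      Untied k β = found β ≡ 1 × tied β ≡ 0 × (∃[ u ] (u < k × Pred u × minWeight u ≡ least β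
                     × (∀ u′ → u′ < k → Pred u′ → least β ≤ minWeight u′ × (minWeight u′ ≡ least β → u′ ≡ u))))
      Tied k β = found β ≡ 1 × tied β ≡ 1 × (∃[ u ] ∃[ u′ ] (u < k × u′ < k × Pred u × Pred u′ × minWeight u ≡ least β × minWeight u′ ≡ least β × u ≢ u′))
                     × (∀ u′ → u′ < k → Pred u′ → least β ≤ minWeight u′)

      Summary : ℕ → Best → Set
      Summary k β = NoPred k β ⊎ Untied k β ⊎ Tied k β

      summary-skip : ∀ {k β} → ¬ Pred k → Summary k β → Summary (suc k) β
      summary-skip ¬p (inj₁ (f , t , ∄)) = inj₁ (f , t , below-suc ∄ ¬p)
      summary-skip ¬p (inj₂ (inj₁ (f , t , u , u< , pu , e , min))) =
        inj₂ (inj₁ (f , t , u , m≤n⇒m≤1+n u< , pu , e , below-suc min (λ p → contradiction p ¬p)))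
      summary-skip ¬p (inj₂ (inj₂ (f , t , (u , u′ , u< , u′< , r) , min))) =
        inj₂ (inj₂ (f , t , (u , u′ , m≤n⇒m≤1+n u< , m≤n⇒m≤1+n u′< , r) , below-suc min (λ p → contradiction p ¬p)))

      summary-add : ∀ {k β} → Pred k → Summary k β → Summary (suc k) (update (minWeight k) β)
      summary-add {k} {best l zero t} p (inj₁ (_ , refl , ∄)) =
        inj₂ (inj₁ (refl , refl , k , ≤-refl , p , refl , below-suc (λ u u< pu → contradiction pu (∄ u u<)) (λ _ → ≤-refl , λ _ → refl)))
      summary-add {k} {best l zero t} p (inj₂ (inj₁ (() , _)))
      summary-add {k} {best l zero t} p (inj₂ (inj₂ (() , _)))
      summary-add {k} {best l (suc f) t} p sm with minWeight k <ᵇ l in e₁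
      ... | true = let a<l = <ᵇ⇒< (minWeight k) l (subst T (sym e₁) _) in lower a<l sm
        where
        lower : minWeight k < l → Summary k (best l (suc f) t) → Summary (suc k) (best (minWeight k) (suc f) 0)
        lower a<l (inj₁ (() , _))
        lower a<l (inj₂ (inj₁ (refl , _ , _ , _ , _ , _ , min))) = inj₂ (inj₁ (refl , refl , k , ≤-refl , p , refl ,
          below-suc (λ u u< pu → <⇒≤ (<-≤-trans a<l (proj₁ (min u u< pu))) , λ e → contradiction (<-≤-trans a<l (proj₁ (min u u< pu))) (<-irrefl (sym e))) (λ _ → ≤-refl , λ _ → refl)))
        lower a<l (inj₂ (inj₂ (refl , _ , _ , min))) = inj₂ (inj₁ (refl , refl , k , ≤-refl , p , refl ,
          below-suc (λ u u< pu → <⇒≤ (<-≤-trans a<l (min u u< pu)) , λ e → contradiction (<-≤-trans a<l (min u u< pu)) (<-irrefl (sym e))) (λ _ → ≤-refl , λ _ → refl)))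
      ... | false with minWeight k ≡ᵇ l in e₂
      ...   | true = tie (≡ᵇ⇒≡ (minWeight k) l (subst T (sym e₂) _)) sm
        where
        tie : minWeight k ≡ l → Summary k (best l (suc f) t) → Summary (suc k) (best l (suc f) 1)
        tie a≡l (inj₁ (() , _))
        tie a≡l (inj₂ (inj₁ (refl , _ , u , u< , pu , e , min))) = inj₂ (inj₂ (refl , refl ,
          (u , k , m≤n⇒m≤1+n u< , ≤-refl , pu , p , e , a≡l , λ { refl → <-irrefl refl u< }) ,
          below-suc (λ u′ u′< pu′ → proj₁ (min u′ u′< pu′)) (λ _ → ≤-reflexive (sym a≡l))))
        tie a≡l (inj₂ (inj₂ (refl , _ , (u , u′ , u< , u′< , r) , min))) = inj₂ (inj₂ (refl , refl ,
          (u , u′ , m≤n⇒m≤1+n u< , m≤n⇒m≤1+n u′< , r) , below-suc min (λ _ → ≤-reflexive (sym a≡l))))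
      ...   | false = higher sm
        where
        l≤a : l ≤ minWeight k
        l≤a = ≮⇒≥ (λ a<l → subst T e₁ (<⇒<ᵇ a<l))
        a≢l : minWeight k ≢ l
        a≢l e = subst T e₂ (≡⇒≡ᵇ (minWeight k) l e)
        higher : Summary k (best l (suc f) t) → Summary (suc k) (best l (suc f) t)
        higher (inj₁ (() , _))
        higher (inj₂ (inj₁ (ff , tt′ , u , u< , pu , e , min))) = inj₂ (inj₁ (ff , tt′ , u , m≤n⇒m≤1+n u< , pu , e ,
          below-suc min (λ _ → l≤a , λ e′ → contradiction e′ a≢l)))
        higher (inj₂ (inj₂ (ff , tt′ , (u , u′ , u< , u′< , r) , min))) = inj₂ (inj₂ (ff , tt′ ,
          (u , u′ , m≤n⇒m≤1+n u< , m≤n⇒m≤1+n u′< , r) , below-suc min (λ _ → l≤a)))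

      summary : ∀ k → Summary k (bestTo k)
      summary zero = inj₁ (refl , refl , λ u ())
      summary (suc k) with inBall d k in e₁ | adj k v in e₂
      ... | false | _     = summary-skip (λ p → contradiction (trans (sym e₁) (proj₁ p)) λ()) (summary k)
      ... | true  | false = summary-skip (λ p → contradiction (trans (sym e₂) (proj₂ p)) λ()) (summary k)
      ... | true  | true  = summary-add (e₁ , e₂) (summary k)

      last-step : ∀ {u x xs} → adj u x ≡ true → Walk x xs v → ∃[ ys ] ∃[ a ] (x ∷ xs ≡ ys ++ v ∷ [] × Walk u ys a × adj a v ≡ true)
      last-step         e []       = [] , _ , refl , [] , e
      last-step {x = x} e (e′ ∷ p) = let ys , a , xs≡ , q , ea = last-step e′ p in x ∷ ys , a , cong (x ∷_) xs≡ , e ∷ q , ea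

      module _ (v≢src : v ≢ src) where

        length-snoc : ∀ (ys : List ℕ) → length (ys ++ v ∷ []) ≡ suc (length ys)
        length-snoc ys = trans (List.length-++ ys) (+-comm (length ys) 1)

        wsum-snoc : ∀ (ys : List ℕ) → wsum w (ys ++ v ∷ []) ≡ wsum w ys + w v
        wsum-snoc ys = trans (wsum-++ w ys (v ∷ [])) (cong (wsum w ys +_) (+-identityʳ (w v)))

        -- Bellman's principle: without its last edge a minimum walk is still minimum, and its new
        -- endpoint lies in the ball of radius d.
        before-last : ∀ {xs} → Min w src xs v → length xs ≤ suc d →
          ∃[ ys ] ∃[ a ] (xs ≡ ys ++ v ∷ [] × Min w src ys a × length ys ≤ d × a < n × Pred a × minWeight a ≡ wsum w ys)
        before-last {[]}     ([] , _) l = contradiction refl v≢src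
        before-last {x ∷ xs} mn@(e₀ ∷ p , _) l with last-step e₀ p
        ... | ys , a , xs≡ , q , ea =
          let mn′ = min-prefix ys (subst (λ l → Min w src l v) xs≡ mn) q (ea ∷ [])
              l′ = s≤s⁻¹ (≤-trans (≤-reflexive (trans (sym (length-snoc ys)) (cong length (sym xs≡)))) l)
              zs , mz , _ , e , m = in-ball q l′
          in ys , a , xs≡ , mn′ , l′ , walk-end src<n q , (e , ea) , trans m (min-≡ mz mn′)

        no-pred⇒out : NoPred n (bestTo n) → inBall (suc d) v ≡ false
        no-pred⇒out (_ , _ , ∄) = out-ball λ zs p l → absurd zs p l
          where
          absurd : ∀ zs → Walk src zs v → length zs ≤ suc d → ⊥
          absurd zs p l = let xs , mn , l′ , _ = in-ball p l
                              ys , a , _ , _ , _ , a<n , pa , _ = before-last mn l′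
                          in ∄ a a<n pa

        pred-walk : ∀ {u} → Pred u → ∃[ ys ] (Min w src ys u × length ys ≤ d × minWeight u ≡ wsum w ys × Walk src (ys ++ v ∷ []) v)
        pred-walk (e , ea) = let ys , mn , l , m = from-ball e in ys , mn , l , m , walk-++ (proj₁ mn) (ea ∷ [])

        -- One inequality comes from extending a minimum walk to the best predecessor by v, the
        -- other from removing the last edge of a minimum walk to v.
        found⇒in : ∀ {u} → u < n → Pred u → (∀ u′ → u′ < n → Pred u′ → minWeight u ≤ minWeight u′) →
                   inBall (suc d) v ≡ true × minWeight v ≡ minWeight u + w v
        found⇒in {u} u<n pu min =
          let ys , mn , l , m , p = pred-walk pu
              xs , mx , lx , e , mv = in-ball p (≤-trans (≤-reflexive (length-snoc ys)) (s≤s l))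
              zs , a , xs≡ , mz , lz , a<n , pa , ma = before-last mx lx
          in e , ≤-antisym
            (≤-trans (≤-reflexive mv) (≤-trans (proj₂ mx (ys ++ v ∷ []) p) (≤-reflexive (trans (wsum-snoc ys) (cong (_+ w v) (sym m))))))
            (≤-trans (+-monoˡ-≤ (w v) (≤-trans (min a a<n pa) (≤-reflexive ma))) (≤-reflexive (trans (sym (wsum-snoc zs)) (trans (cong (wsum w) (sym xs≡)) (sym mv)))))

        last-weight : ∀ {xs a} → inBall (suc d) v ≡ true × minWeight v ≡ a + w v → Min w src xs v → length xs ≤ suc d →
          ∃[ ys ] ∃[ u ] (xs ≡ ys ++ v ∷ [] × Min w src ys u × length ys ≤ d × u < n × Pred u × minWeight u ≡ a)
        last-weight {xs} {a} (e , mv) mn l =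
          let ys , u , xs≡ , my , ly , u<n , pu , mu = before-last mn l
              zs , mz , _ , mz≡ = from-ball e
          in ys , u , xs≡ , my , ly , u<n , pu , trans mu (+-cancelʳ-≡ (w v) (wsum w ys) a (begin
               wsum w ys + w v          ≡⟨ sym (wsum-snoc ys) ⟩
               wsum w (ys ++ v ∷ [])    ≡⟨ cong (wsum w) (sym xs≡) ⟩
               wsum w xs                ≡⟨ min-≡ mn mz ⟩
               wsum w zs                ≡⟨ sym mz≡ ⟩
               minWeight v              ≡⟨ mv ⟩
               a + w v                  ∎))
          where open ≡-Reasoning

        untied⇒in : Untied n (bestTo n) → inBall (suc d) v ≡ true × minWeight v ≡ least (bestTo n) + w v
        untied⇒in (_ , _ , u , u<n , pu , e , min) =
          let i , m = found⇒in u<n pu (λ u′ u′< p → ≤-trans (≤-reflexive e) (proj₁ (min u′ u′< p))) in i , trans m (cong (_+ w v) e)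

        -- Every minimum walk to v passes through the only best predecessor, and up to there it is
        -- unique by the hypothesis on the smaller ball.
        untied⇒unique : UniqueFrom d → Untied n (bestTo n) → UniqueAt (suc d) v
        untied⇒unique uniq un@(_ , _ , u , u<n , pu , e , min) mx my l =
          let l′ = ≤-trans (shortest-≤ (lengthFirst src<n my) (proj₁ mx)) l
              xs₁ , a , ex , mx₁ , lx , a<n , pa , ea = last-weight (untied⇒in un) mx l
              ys₁ , c , ey , my₁ , ly , c<n , pc , ec = last-weight (untied⇒in un) my l′
              a≡c = trans (proj₂ (min a a<n pa) ea) (sym (proj₂ (min c c<n pc) ec))
          in trans ex (trans (cong (_++ v ∷ []) (uniq c (subst (Min w src xs₁) a≡c mx₁) my₁ lx)) (sym ey))

        -- Both best predecessors extend to minimum walks to v, and equal lists would agree in their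
        -- last vertex but one. A tie is thus a certificate that the modulus is bad.
        tied⇒¬unique : Tied n (bestTo n) → ¬ UniqueAt (suc d) v
        tied⇒¬unique (_ , _ , (u , u′ , u<n , u′<n , pu , pu′ , e , e′ , u≢u′) , min) uniq =
          let ys , my , ly , mu , p = pred-walk pu
              zs , mz , lz , mu′ , q = pred-walk pu′
              i , mv = found⇒in u<n pu (λ a a< pa → ≤-trans (≤-reflexive e) (min a a< pa))
              ys≡ = uniq (minimal ys p (trans (sym mu) refl) mv i) (minimal zs q (trans (sym mu′) (trans e′ (sym e))) mv i)
                        (≤-trans (≤-reflexive (length-snoc ys)) (s≤s ly))
          in u≢u′ (walk-end-unique (proj₁ my) (subst (λ l → Walk src l u′) (sym (List.∷ʳ-injectiveˡ ys zs ys≡)) (proj₁ mz)))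
          where
          minimal : ∀ ys → Walk src (ys ++ v ∷ []) v → wsum w ys ≡ minWeight u →
                    minWeight v ≡ minWeight u + w v → inBall (suc d) v ≡ true → Min w src (ys ++ v ∷ []) v
          minimal ys p wy mv i = p , λ zs q → let xs , mx , _ , mx≡ = from-ball i in
            ≤-trans (≤-reflexive (trans (wsum-snoc ys) (trans (cong (_+ w v) wy) (trans (sym mv) mx≡)))) (proj₂ mx zs q)

-- Correctness of the uniqueness test from one source

enu₀ : Enu
enu₀ = enu 0 0 0 0 0 0

module Check (𝒮 : Setting) (𝒲 : Weighting 𝒮) (o : List Letter) where

  open Setting 𝒮
  open Weighting 𝒲
  open Logic x mw iterations
  open Subroutines 𝒮
  open Walks n adj adj-<
  open Balls n adj adj-< w maxWeight w≤

  module Source (src : ℕ) (src<n : src < n) where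

    inB : ℕ → ℕ → Bool
    inB = inBall lengthFirst src src<n
    mwt : ℕ → ℕ
    mwt = minWeight lengthFirst src src<n
    cnt sm : ℕ → ℕ → ℕ
    cnt = countTo lengthFirst src src<n
    sm = sumTo lengthFirst src src<n
    Unique : ℕ → Set
    Unique = UniqueFrom lengthFirst src src<n
    UniqueV : ℕ → ℕ → Set
    UniqueV = UniqueAt lengthFirst src src<n

    cnt-in : ∀ {d k} → inB d k ≡ true → cnt d (suc k) ≡ suc (cnt d k)
    cnt-in {d} {k} e = cong (λ b → if b then suc (cnt d k) else cnt d k) e
    cnt-out : ∀ {d k} → inB d k ≡ false → cnt d (suc k) ≡ cnt d k
    cnt-out {d} {k} e = cong (λ b → if b then suc (cnt d k) else cnt d k) e
    sm-in : ∀ {d k} → inB d k ≡ true → sm d (suc k) ≡ sm d k + mwt k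
    sm-in {d} {k} e = cong (λ b → if b then sm d k + mwt k else sm d k) e
    sm-out : ∀ {d k} → inB d k ≡ false → sm d (suc k) ≡ sm d k
    sm-out {d} {k} e = cong (λ b → if b then sm d k + mwt k else sm d k) e

    module Enumerate (d : ℕ) (d<R : d < R) (c2 D2 v : ℕ) (v<n : v < n) (ok ans : ℕ) (uniq : Unique d) where

      spot : Spot 𝒲
      spot = record { src = src ; src<n = src<n ; d = d ; d<R = d<R ; c = cnt d n ; D = sm d n ; c2 = c2 ; D2 = D2 ; v = v ; v<n = v<n ; ok = ok ; ans = ans ; o = o }

      open Enumeration.FromSource 𝒮 𝒲 spot using (lv; ck; afterwards; consider; inside-spec)
      open Balls.Step n adj adj-< w maxWeight w≤ lengthFirst src src<n d v using (bestTo)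

      private
        unit : ℕ
        unit = suc R * maxWeight

        -- A wrong path never catches up. Omitting a vertex of the ball leaves the count short for
        -- good, since only vertices of the ball can be added; with the right count, one walk
        -- heavier than the minimum leaves the sum too large for good. A short count may come with
        -- any sum, so the comparison is lexicographic.
        Lagging : ℕ → ℕ → ℕ → Set
        Lagging u c a = c < cnt d u ⊎ (c ≡ cnt d u × sm d u < a)

        state : ℕ → ℕ → ℕ → Best → Mem
        state u c a β = S lv ck (enuAt u c a β) wlk₀ tmp₀ o

        Bad : ℕ → Mem → Set
        Bad u τ = ∃[ c ] ∃[ a ] ∃[ β ] (τ ≡ state u c a β × c ≤ u × a ≤ u * unit × Lagging u c a)

        Bad′ : ℕ → Mem → Set
        Bad′ u τ = ∃[ c ] ∃[ a ] ∃[ β ] (τ ≡ state u c a β × c ≤ suc u × a ≤ suc u * unit × Lagging (suc u) c a)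

        f : ℕ → Mem
        f u = state u (cnt d u) (sm d u) (bestTo u)

        best-in : ∀ {u} → inB d u ≡ true → bestTo (suc u) ≡ consider u (mwt u) (bestTo u)
        best-in {u} e = cong (λ b → if b then consider u (mwt u) (bestTo u) else bestTo u) e
        best-out : ∀ {u} → inB d u ≡ false → bestTo (suc u) ≡ bestTo u
        best-out {u} e = cong (λ b → if b then consider u (mwt u) (bestTo u) else bestTo u) e

        incU : ∀ {u} → u < n → suc u < cap
        incU u<n = Enumeration.<cap 𝒮 𝒲 (≤-trans u<n (≤-trans (n≤1+n n) (≤-trans (n≤1+n _) (m≤m*n (suc (suc n)) (suc (suc R) * suc maxWeight)))))

        sm≤ : ∀ u → sm d u ≤ u * unit
        sm≤ u = ≤-trans (sumTo-≤ lengthFirst src src<n d u) (*-monoʳ-≤ u (*-monoˡ-≤ maxWeight (≤-trans (<⇒≤ d<R) (n≤1+n R))))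

        grow≤ : ∀ {u a q} → a ≤ u * unit → q ≤ unit → a + q ≤ suc u * unit
        grow≤ {u} a≤ q≤ = ≤-trans (+-mono-≤ a≤ q≤) (≤-reflexive (+-comm (u * unit) unit))

        walk≤unit : ∀ {zs} → length zs ≤ d → wsum w zs ≤ unit
        walk≤unit {zs} l = ≤-trans (wsum-≤ w maxWeight zs w≤) (*-monoˡ-≤ maxWeight (≤-trans l (≤-trans (<⇒≤ d<R) (n≤1+n R))))

        lag-skip : ∀ {u c a} → Lagging u c a → Lagging (suc u) c a
        lag-skip {u} {c} lag with inB d u in e
        ... | false = lag
        ... | true with lag
        ...   | inj₁ c< = inj₁ (m≤n⇒m≤1+n c<)
        ...   | inj₂ (refl , _) = inj₁ ≤-refl

        -- The guessed walk shows that u lies in the ball, so the true count rises too, and the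
        -- guessed weight is at least the true one.
        lag-add : ∀ {u c a zs} → Walk src zs u → length zs ≤ d → Lagging u c a → Lagging (suc u) (suc c) (a + wsum w zs)
        lag-add {u} {c} {a} {zs} p l lag with in-ball lengthFirst src src<n p l
        ... | xs , mn , _ , e , m with lag
        ...   | inj₁ c< = inj₁ (subst (suc c <_) (sym (cnt-in e)) (s≤s c<))
        ...   | inj₂ (refl , a>) = inj₂ (sym (cnt-in e) , subst (_< a + wsum w zs) (sym (sm-in e))
                  (+-mono-<-≤ a> (≤-trans (≤-reflexive m) (proj₂ mn zs p))))

        finish : ∀ {u} → u < n → ∀ {τ} → Bad′ u τ → Exec (‼ inc rU ∷ []) τ nothing (Bad (suc u))
        finish u<n (c , a , β , refl , c≤ , a≤ , lag) = block✗ _ (incU u<n , tt) (c , a , β , refl , c≤ , a≤ , lag)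

        bad-step : ∀ {u τ} → u < n → Bad u τ → Exec (choose skip insideP ⨾ ‼ inc rU ∷ []) τ nothing (Bad (suc u))
        bad-step {u} u<n (c , a , β , refl , c≤ , a≤ , lag) = seq✗
          (chooseˡ (skip✗ (c , a , β , refl , m≤n⇒m≤1+n c≤ , ≤-trans a≤ (m≤n+m _ unit) , lag-skip lag))
            (inside-spec {u} {c} {a} {β} u<n c≤ a≤ nothing (λ ()) (λ {zs} p l _ →
              suc c , a + wsum w zs , consider u (wsum w zs) β , refl , s≤s c≤ , grow≤ {u} a≤ (walk≤unit {zs} l) , lag-add p l lag)))
          (finish u<n)

        outside-step : ∀ u → u < n → inB d u ≡ false → (∀ zs → Walk src zs u → length zs ≤ d → ⊥) →
                       Exec (choose skip insideP ⨾ ‼ inc rU ∷ []) (f u) (just (f (suc u))) (Bad (suc u))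
        outside-step u u<n e ∄ = seq✓ {R = Bad′ u}
          (chooseˡ skip✓ (inside-spec {u} {cnt d u} {sm d u} {bestTo u} u<n (countTo-≤ lengthFirst src src<n d u) (sm≤ u) nothing (λ ()) (λ {zs} p l _ → ⊥-elim (∄ zs p l))))
          (becomes f≡ (block _ (incU u<n , tt))) (finish u<n)
          where
          f≡ : state (suc u) (cnt d u) (sm d u) (bestTo u) ≡ f (suc u)
          f≡ = trans (cong₂ (λ c a → state (suc u) c a (bestTo u)) (sym (cnt-out e)) (sym (sm-out e))) (cong (state (suc u) (cnt d (suc u)) (sm d (suc u))) (sym (best-out e)))

        inside-step : ∀ u → u < n → ∀ {xs} → Min w src xs u → length xs ≤ d → inB d u ≡ true → mwt u ≡ wsum w xs →
                      Exec (choose skip insideP ⨾ ‼ inc rU ∷ []) (f u) (just (f (suc u))) (Bad (suc u))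
        inside-step u u<n {xs} mn l e m = seq✓ {R = Bad′ u}
          (chooseʳ (skip✗ (cnt d u , sm d u , bestTo u , refl , m≤n⇒m≤1+n (countTo-≤ lengthFirst src src<n d u) , ≤-trans (sm≤ u) (m≤n+m _ unit) ,
              inj₁ (subst (cnt d u <_) (sym (cnt-in e)) ≤-refl)))
            (inside-spec {u} {cnt d u} {sm d u} {bestTo u} u<n (countTo-≤ lengthFirst src src<n d u) (sm≤ u) (just xs) (λ { refl → l , proj₁ mn }) others))
          (becomes f≡ (block _ (incU u<n , tt))) (finish u<n)
          where
          f≡ : state (suc u) (suc (cnt d u)) (sm d u + wsum w xs) (consider u (wsum w xs) (bestTo u)) ≡ f (suc u)
          f≡ = trans (cong (λ q → state (suc u) (suc (cnt d u)) (sm d u + q) (consider u q (bestTo u))) (sym m))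
            (trans (cong₂ (λ c a → state (suc u) c a (consider u (mwt u) (bestTo u))) (sym (cnt-in e)) (sym (sm-in e)))
              (cong (state (suc u) (cnt d (suc u)) (sm d (suc u))) (sym (best-in e))))
          others : ∀ {zs} → Walk src zs u → length zs ≤ d → just zs ≢ just xs → Bad′ u (afterwards u (cnt d u) (sm d u) (bestTo u) (wsum w zs))
          others {zs} p l′ ne = suc (cnt d u) , sm d u + wsum w zs , consider u (wsum w zs) (bestTo u) , refl ,
            s≤s (countTo-≤ lengthFirst src src<n d u) , grow≤ {u} (sm≤ u) (walk≤unit {zs} l′) ,
            inj₂ (sym (cnt-in e) , subst (_< sm d u + wsum w zs) (sym (sm-in e)) (+-monoʳ-< (sm d u) heavier))
            where
            heavier : mwt u < wsum w zs
            -- Here uniqueness up to d enters: another walk of the same weight would leave count and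
            -- sum correct, and two paths would survive.
            heavier = ≤∧≢⇒< (≤-trans (≤-reflexive m) (proj₂ mn zs p))
              (λ e′ → ne (cong just (uniq u (p , λ ys q → ≤-trans (≤-reflexive (trans (sym e′) m)) (proj₂ mn ys q)) mn l′)))

        good-step : ∀ u → u < n → Exec (choose skip insideP ⨾ ‼ inc rU ∷ []) (f u) (just (f (suc u))) (Bad (suc u))
        good-step u u<n = decide (ball-cases lengthFirst src src<n d u)
          where
          decide : (∃[ xs ] (Min w src xs u × length xs ≤ d × inB d u ≡ true × mwt u ≡ wsum w xs)) ⊎ (inB d u ≡ false × (∀ zs → Walk src zs u → length zs ≤ d → ⊥)) →
                   Exec (choose skip insideP ⨾ ‼ inc rU ∷ []) (f u) (just (f (suc u))) (Bad (suc u))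
          decide (inj₁ (xs , mn , l , e , m)) = inside-step u u<n mn l e m
          decide (inj₂ (e , ∄))               = outside-step u u<n e ∄

      enumerate-spec : ∀ {Q} → Exec enumerateP (S lv ck enu₀ wlk₀ tmp₀ o) (just (S lv ck (enuAt 0 0 0 (bestTo n)) wlk₀ tmp₀ o)) Q
      enumerate-spec = seq✓ (for-loop rU rN _ f Bad n (λ j → refl , refl) (λ { (_ , _ , _ , refl , _) → refl , refl }) good-step bad-step (<⇒≤ n<))
        (passed tt (≡ᵇ-refl (cnt d n)) ▹ passed tt (≡ᵇ-refl (sm d n)) ▹ block _ (tt , tt , tt , tt))
        rejected
        where
        rejected : ∀ {τ Q} → Bad n τ → Exec (assert (eq rCnt rC) ⨾ assert (eq rSum rΣ) ⨾ ‼ (clr rU ∷ clr rCnt ∷ clr rSum ∷ [])) τ nothing Q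
        rejected (c , a , β , refl , _ , _ , inj₁ c<) = seq✗ {R = λ _ → ⊥} (failed tt (≡ᵇ-false (<⇒≢ c<))) (λ ())
        rejected (c , a , β , refl , _ , _ , inj₂ (refl , a>)) = passed tt (≡ᵇ-refl (cnt d n)) ▹
          seq✗ {R = λ _ → ⊥} (failed tt (≡ᵇ-false (λ e → <⇒≢ a> (sym e)))) (λ ())

    -- The answer is either untouched or set to 1 with a walk as evidence, so it stays sound through
    -- failed tests.
    AnsStep : ℕ → ℕ → Set
    AnsStep ans₀ ans = ans ≡ ans₀ ⊎ (ans ≡ 1 × ∃[ zs ] Walk s zs t)

    private
      unit : ℕ
      unit = suc R * maxWeight

      <cap : ∀ {a} → a ≤ suc (suc n) * (suc (suc R) * suc maxWeight) → a < cap
      <cap a≤ = ≤-<-trans a≤ room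

      n+2≤ : suc (suc n) ≤ suc (suc n) * (suc (suc R) * suc maxWeight)
      n+2≤ = m≤m*n (suc (suc n)) (suc (suc R) * suc maxWeight)

      R+2≤ : suc (suc R) ≤ suc (suc n) * (suc (suc R) * suc maxWeight)
      R+2≤ = ≤-trans (m≤m*n (suc (suc R)) (suc maxWeight)) (m≤n*m _ (suc (suc n)))

      vertex< : ∀ {u} → u ≤ suc n → u < cap
      vertex< u≤n = <cap (≤-trans u≤n (≤-trans (n≤1+n (suc n)) n+2≤))

      rows< : ∀ {u q} → u ≤ suc n → q ≤ u * unit → q < cap
      rows< u≤ q≤ = <cap (≤-trans q≤ (*-mono-≤ (m≤n⇒m≤1+n u≤) (*-mono-≤ (n≤1+n (suc R)) (n≤1+n maxWeight))))

      one< : 1 < cap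
      one< = vertex< (s≤s z≤n)

    lift : ∀ {d} → d < R → ¬ Unique (suc d) → ¬ Unique R
    lift d<R ¬u u = ¬u (λ v mx my l → u v mx my (≤-trans l d<R))

    L : ℕ → ℕ → ℕ → ℕ → ℕ → Mem
    L ok ans c D j = S (lev R M kb ok ans) (chk src j 0 c D 0 0 0) enu₀ wlk₀ tmp₀ o

    LayerDone : ℕ → ℕ → ℕ → ℕ → ℕ → Set
    LayerDone d ok ans c D = (ok ≡ 1 × c ≡ cnt (suc d) n × D ≡ sm (suc d) n × Unique (suc d) × (src ≡ s → t ≢ src → t < n → inB (suc d) t ≡ true → ans ≡ 1))
      ⊎ (ok ≡ 0 × ¬ Unique R)

    AfterLayer : ℕ → ℕ → Mem → Set
    AfterLayer ans₀ d τ = ∃[ ok ] ∃[ ans ] ∃[ c ] ∃[ D ] (τ ≡ L ok ans c D d × AnsStep ans₀ ans × LayerDone d ok ans c D)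

    module Layer (d : ℕ) (d<R : d < R) (ans₀ : ℕ) where

      V : ℕ → ℕ → ℕ → ℕ → ℕ → ℕ → ℕ → Mem
      V ok ans c D c2 D2 k = S (lev R M kb ok ans) (chk src d (suc d) c D c2 D2 k) enu₀ wlk₀ tmp₀ o

      -- The clause on the answer excludes t = src, because the source case of `judgeP` records
      -- nothing; s = t is answered during setup.
      Fine : ℕ → ℕ → ℕ → ℕ → ℕ → ℕ → Set
      Fine c D ans c2 D2 k = c ≡ cnt d n × D ≡ sm d n × Unique d × c2 ≡ cnt (suc d) k × D2 ≡ sm (suc d) k
        × (∀ v → v < k → UniqueV (suc d) v)
        × (src ≡ s → t ≢ src → t < k → inB (suc d) t ≡ true → ans ≡ 1)

      -- The size bounds are kept outside the alternative: after a tie the counters lose their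
      -- meaning but are still copied, which must not overflow.
      Inv : ℕ → ℕ → ℕ → Mem → Set
      Inv c D k τ = ∃[ ok ] ∃[ ans ] ∃[ c2 ] ∃[ D2 ] (τ ≡ V ok ans c D c2 D2 k × c2 ≤ k × D2 ≤ k * unit × AnsStep ans₀ ans
        × ((ok ≡ 1 × Fine c D ans c2 D2 k) ⊎ (ok ≡ 0 × ¬ Unique R)))

      module _ (ans c2 D2 v : ℕ) (v<n : v < n) (c2≤ : c2 ≤ v) (D2≤ : D2 ≤ v * unit) (step : AnsStep ans₀ ans)
               (fine : Fine (cnt d n) (sm d n) ans c2 D2 v) where

        open Balls.Step n adj adj-< w maxWeight w≤ lengthFirst src src<n d v

        private
          uniq : Unique d
          uniq = proj₁ (proj₂ (proj₂ fine))
          c2≡ = proj₁ (proj₂ (proj₂ (proj₂ fine)))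
          D2≡ = proj₁ (proj₂ (proj₂ (proj₂ (proj₂ fine))))
          uniqBelow = proj₁ (proj₂ (proj₂ (proj₂ (proj₂ (proj₂ fine)))))
          ansBelow = proj₂ (proj₂ (proj₂ (proj₂ (proj₂ (proj₂ fine)))))

          β : Best
          β = bestTo n

          J : ℕ → ℕ → ℕ → ℕ → Mem
          J ok ans c2 D2 = S (lev R M kb ok ans) (chk src d (suc d) (cnt d n) (sm d n) c2 D2 v) (enuAt 0 0 0 β) wlk₀ tmp₀ o

          recorded : ℕ
          recorded = if src ≡ᵇ s then (if v ≡ᵇ t then 1 else ans) else ans

          record-spec : ∀ {ok c2 D2 Q} → Exec recordP (J ok ans c2 D2) (just (J ok recorded c2 D2)) Q
          record-spec {ok} {c2} {D2} = decide (src ≡ᵇ s) (v ≡ᵇ t) refl refl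
            where
            decide : ∀ a e → (src ≡ᵇ s) ≡ a → (v ≡ᵇ t) ≡ e → ∀ {Q} →
              Exec recordP (J ok ans c2 D2) (just (J ok (if a then (if e then 1 else ans) else ans) c2 D2)) Q
            decide true  true  e₁ e₂ = then tt e₁ (then tt e₂ (block _ (tt , one< , tt)))
            decide true  false e₁ e₂ = then tt e₁ (else tt e₂ skip✓)
            decide false _     e₁ e₂ = else tt e₁ skip✓

          record-step : (∃[ zs ] Walk src zs v) → AnsStep ans₀ recorded
          record-step (zs , p) with src ≡ᵇ s in e₁ | v ≡ᵇ t in e₂
          ... | true  | true  = inj₂ (refl , zs , subst₂ (λ a c → Walk a zs c) (≡ᵇ⇒≡ src s (subst T (sym e₁) _)) (≡ᵇ⇒≡ v t (subst T (sym e₂) _)) p)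
          ... | true  | false = step
          ... | false | _     = step

          record-done : src ≡ s → t ≡ v → recorded ≡ 1
          record-done refl refl rewrite ≡ᵇ-refl src | ≡ᵇ-refl v = refl

          record-keep : ans ≡ 1 → recorded ≡ 1
          record-keep refl with src ≡ᵇ s | v ≡ᵇ t
          ... | true  | true  = refl
          ... | true  | false = refl
          ... | false | _     = refl

          judged : ∀ {ok ans′ c2′ D2′} → AnsStep ans₀ ans′ → c2′ ≤ suc v → D2′ ≤ suc v * unit →
            Exec judgeP (J 1 ans c2 D2) (just (J ok ans′ c2′ D2′)) (λ _ → ⊥) →
            (ok ≡ 1 × Fine (cnt d n) (sm d n) ans′ c2′ D2′ (suc v)) ⊎ (ok ≡ 0 × ¬ Unique R) →
            Ends (vertexP ⨾ ‼ inc rV ∷ []) (V 1 ans (cnt d n) (sm d n) c2 D2 v) (Inv (cnt d n) (sm d n) (suc v))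
          judged st c≤ D≤ j alt = _ ,
            (then tt refl (Enumerate.enumerate-spec d d<R c2 D2 v v<n 1 ans uniq ▹ j ▹ block _ (tt , tt , tt , tt)) ▹ block _ (vertex< (m≤n⇒m≤1+n v<n) , tt)) ,
            (_ , _ , _ , _ , refl , c≤ , D≤ , st , alt)

          fine′ : ∀ {ans′ c2′ D2′} → c2′ ≡ cnt (suc d) (suc v) → D2′ ≡ sm (suc d) (suc v) → UniqueV (suc d) v →
                  (ans ≡ 1 → ans′ ≡ 1) → (src ≡ s → t ≢ src → t ≡ v → inB (suc d) t ≡ true → ans′ ≡ 1) →
                  Fine (cnt d n) (sm d n) ans′ c2′ D2′ (suc v)
          fine′ c≡ D≡ u keep new = refl , refl , uniq , c≡ , D≡ , below-suc uniqBelow u ,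
            λ e₁ e₂ t< i → case-below t< (λ t<v → keep (ansBelow e₁ e₂ t<v i)) (λ t≡v → new e₁ e₂ t≡v i)
            where
            case-below : ∀ {A : Set} → t < suc v → (t < v → A) → (t ≡ v → A) → A
            case-below t< f g with m≤n⇒m<n∨m≡n t<
            ... | inj₁ t<v  = f (s≤s⁻¹ t<v)
            ... | inj₂ refl = g refl

          D2+≤ : ∀ {a} → a ≤ unit → D2 + a ≤ suc v * unit
          D2+≤ a≤ = ≤-trans (+-mono-≤ D2≤ a≤) (≤-reflexive (+-comm (v * unit) unit))

        VertexEnds : Set₁
        VertexEnds = Ends (vertexP ⨾ ‼ inc rV ∷ []) (V 1 ans (cnt d n) (sm d n) c2 D2 v) (Inv (cnt d n) (sm d n) (suc v))

        source-step : v ≡ src → VertexEnds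
        source-step refl = judged step (s≤s c2≤) (≤-trans D2≤ (m≤n+m _ unit))
          (then tt (≡ᵇ-refl v) (block _ (vertex< (m≤n⇒m≤1+n (≤-trans (s≤s c2≤) v<n)) , tt)))
          (inj₁ (refl , fine′ (trans (cong suc c2≡) (sym (cnt-in inside))) (trans D2≡ (trans (sym (+-identityʳ _)) (trans (cong (sm (suc d) v +_) (sym weightless)) (sym (sm-in inside)))))
            (unique-source lengthFirst v src<n (suc d)) id (λ _ t≢ t≡ → contradiction t≡ t≢)))
          where
          inside = proj₁ (source-in-ball lengthFirst v src<n (suc d))
          weightless = proj₂ (source-in-ball lengthFirst v src<n (suc d))

        unreached-step : v ≢ src → NoPred n β → VertexEnds
        unreached-step v≢src np@(f≡ , _) = judged step (m≤n⇒m≤1+n c2≤) (≤-trans D2≤ (m≤n+m _ unit))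
          (else tt (≡ᵇ-false v≢src) (else tt (cong (0 <ᵇ_) f≡) skip✓))
          (inj₁ (refl , fine′ (trans c2≡ (sym (cnt-out outside))) (trans D2≡ (sym (sm-out outside)))
            (λ {xs} mx _ l → contradiction (trans (sym outside) (proj₁ (proj₂ (proj₂ (proj₂ (in-ball lengthFirst src src<n (proj₁ mx) l)))))) λ())
            id (λ { _ _ refl i → contradiction (trans (sym outside) i) λ() })))
          where outside = no-pred⇒out v≢src np

        untied-step : v ≢ src → Untied n β → VertexEnds
        untied-step v≢src un@(f≡ , t≡ , u , _ , pu , _) = judged (record-step walk) (s≤s c2≤) (D2+≤ total≤)
          (else tt (≡ᵇ-false v≢src) (then tt (cong (0 <ᵇ_) f≡)
            (else tt (cong (0 <ᵇ_) t≡)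
              ( block _ (vertex< (m≤n⇒m≤1+n (≤-trans (s≤s c2≤) v<n)) , rows< (s≤s (<⇒≤ v<n)) (D2+≤ (≤-trans (m≤m+n (least β) (w v)) total≤)) , vertex< (≤-trans (<⇒≤ v<n) (n≤1+n n)) , tt) ▹
                weight-run {1} {ans} {chk src d (suc d) (cnt d n) (sm d n) (suc c2) (D2 + least β) v} {enuAt 0 0 0 β} {wlk₀} {o} v v<n ▹
                becomes (cong (J 1 ans (suc c2)) (+-assoc D2 (least β) (w v)))
                  (block _ (≤-<-trans (≤-reflexive (+-assoc D2 (least β) (w v))) (rows< (s≤s (<⇒≤ v<n)) (D2+≤ total≤)) , tt , tt)) ) ▹
             record-spec {1} {suc c2} {D2 + (least β + w v)})))
          (inj₁ (refl , fine′ (trans (cong suc c2≡) (sym (cnt-in (proj₁ inside)))) (trans (cong₂ _+_ D2≡ (sym (proj₂ inside))) (sym (sm-in (proj₁ inside))))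
            (untied⇒unique v≢src uniq un) record-keep (λ e₁ _ e₂ _ → record-done e₁ e₂)))
          where
          inside = untied⇒in v≢src un
          walk : ∃[ zs ] Walk src zs v
          walk = let ys , _ , _ , _ , p = pred-walk v≢src pu in _ , p
          total≤ : least β + w v ≤ unit
          total≤ = ≤-trans (≤-reflexive (sym (proj₂ inside))) (≤-trans (minWeight-≤ lengthFirst src src<n (proj₁ inside)) (*-monoˡ-≤ maxWeight (m≤n⇒m≤1+n d<R)))

        tied-step : v ≢ src → Tied n β → VertexEnds
        tied-step v≢src ti@(f≡ , t≡ , (u , _ , _ , _ , pu , _) , _) = judged (record-step walk) (m≤n⇒m≤1+n c2≤) (≤-trans D2≤ (m≤n+m _ unit))
          (else tt (≡ᵇ-false v≢src) (then tt (cong (0 <ᵇ_) f≡) (then tt (cong (0 <ᵇ_) t≡) (block _ (tt , tt)) ▹ record-spec {0} {c2} {D2})))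
          (inj₂ (refl , lift d<R (λ un → tied⇒¬unique v≢src ti (un v))))
          where
          walk : ∃[ zs ] Walk src zs v
          walk = let ys , _ , _ , _ , p = pred-walk v≢src pu in _ , p

        vertex-step : VertexEnds
        vertex-step = decide (v ≟ src) (summary n)
          where
          decide : Dec (v ≡ src) → Summary n β → VertexEnds
          decide (yes v≡src) _              = source-step v≡src
          decide (no v≢src) (inj₁ np)        = unreached-step v≢src np
          decide (no v≢src) (inj₂ (inj₁ un)) = untied-step v≢src un
          decide (no v≢src) (inj₂ (inj₂ ti)) = tied-step v≢src ti

      layer-step : ∀ {c D k τ} → k < n → Inv c D k τ → Ends (vertexP ⨾ ‼ inc rV ∷ []) τ (Inv c D (suc k))
      layer-step {k = k} k<n (_ , ans , c2 , D2 , refl , c2≤ , D2≤ , st , inj₁ (refl , fine@(refl , refl , _))) =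
        vertex-step ans c2 D2 k k<n c2≤ D2≤ st fine
      layer-step k<n (_ , ans , c2 , D2 , refl , c2≤ , D2≤ , st , inj₂ (refl , ¬u)) = _ ,
        (else tt refl skip✓ ▹ block _ (vertex< (m≤n⇒m≤1+n k<n) , tt)) ,
        (0 , ans , c2 , D2 , refl , m≤n⇒m≤1+n c2≤ , ≤-trans D2≤ (m≤n+m _ unit) , st , inj₂ (refl , ¬u))

      layer-spec : ∀ {ok ans c D} → AnsStep ans₀ ans → (ok ≡ 1 × c ≡ cnt d n × D ≡ sm d n × Unique d) ⊎ (ok ≡ 0 × ¬ Unique R) →
        Ends layerP (L ok ans c D d) (AfterLayer ans₀ d)
      layer-spec {ok} {ans} {c} {D} st alt =
        conclude (for-ends rV rN vertexP (Inv c D) n (λ { (_ , _ , _ , _ , refl , _) → refl , refl }) layer-step (<⇒≤ n<)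
          (ok , ans , 0 , 0 , refl , z≤n , z≤n , st , start alt))
        where
        start : (ok ≡ 1 × c ≡ cnt d n × D ≡ sm d n × Unique d) ⊎ (ok ≡ 0 × ¬ Unique R) →
                (ok ≡ 1 × Fine c D ans 0 0 0) ⊎ (ok ≡ 0 × ¬ Unique R)
        start (inj₁ (e , c≡ , D≡ , u)) = inj₁ (e , c≡ , D≡ , u , refl , refl , (λ _ ()) , (λ _ _ ()))
        start (inj₂ r) = inj₂ r
        everywhere : (∀ v → v < n → UniqueV (suc d) v) → Unique (suc d)
        everywhere u v mx = u v (walk-end src<n (proj₁ mx)) mx
        conclude : Ends (for rV rN vertexP) (V ok ans c D 0 0 0) (Inv c D n) → Ends layerP (L ok ans c D d) (AfterLayer ans₀ d)
        conclude (_ , ρ , ok′ , ans′ , c2 , D2 , refl , c2≤ , D2≤ , st′ , alt′) = _ ,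
          (block _ (<cap (≤-trans (<⇒≤ d<R) (≤-trans (n≤1+n R) (≤-trans (n≤1+n _) R+2≤))) , <cap (≤-trans d<R (≤-trans (n≤1+n R) (≤-trans (n≤1+n _) R+2≤))) , tt) ▹ ρ ▹
           block _ (tt , vertex< (m≤n⇒m≤1+n c2≤) , tt , rows< (n≤1+n n) D2≤ , tt , tt , tt , tt , tt)) ,
          (ok′ , ans′ , c2 , D2 , refl , st′ , final alt′)
          where
          final : (ok′ ≡ 1 × Fine c D ans′ c2 D2 n) ⊎ (ok′ ≡ 0 × ¬ Unique R) → LayerDone d ok′ ans′ c2 D2
          final (inj₁ (e , _ , _ , _ , c≡ , D≡ , u , a)) = inj₁ (e , c≡ , D≡ , everywhere u , a)
          final (inj₂ r) = inj₂ r

    module _ (ans₀ : ℕ) (R>0 : 0 < R) where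

      private
        Inv : ℕ → Mem → Set
        Inv j τ = j ≤ R × ∃[ ok ] ∃[ ans ] ∃[ c ] ∃[ D ] (τ ≡ L ok ans c D j × AnsStep ans₀ ans
          × ((ok ≡ 1 × c ≡ cnt j n × D ≡ sm j n × Unique j × (0 < j → src ≡ s → t ≢ src → t < n → inB j t ≡ true → ans ≡ 1)) ⊎ (ok ≡ 0 × ¬ Unique R)))

        inv-step : ∀ {j τ} → j < R → Inv j τ → Ends (layerP ⨾ ‼ inc rD ∷ []) τ (Inv (suc j))
        inv-step {j} j<R (_ , ok , ans , c , D , refl , st , alt) = conclude (Layer.layer-spec j j<R ans₀ st (entering alt))
          where
          entering : (ok ≡ 1 × c ≡ cnt j n × D ≡ sm j n × Unique j × (0 < j → src ≡ s → t ≢ src → t < n → inB j t ≡ true → ans ≡ 1)) ⊎ (ok ≡ 0 × ¬ Unique R) →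
                   (ok ≡ 1 × c ≡ cnt j n × D ≡ sm j n × Unique j) ⊎ (ok ≡ 0 × ¬ Unique R)
          entering (inj₁ (e , c≡ , D≡ , u , _)) = inj₁ (e , c≡ , D≡ , u)
          entering (inj₂ r) = inj₂ r
          conclude : Ends layerP (L ok ans c D j) (AfterLayer ans₀ j) → Ends (layerP ⨾ ‼ inc rD ∷ []) (L ok ans c D j) (Inv (suc j))
          conclude (_ , ρ , ok′ , ans′ , c′ , D′ , refl , st′ , alt′) = _ ,
            (ρ ▹ block _ (<cap (≤-trans j<R (≤-trans (n≤1+n R) (≤-trans (n≤1+n _) R+2≤))) , tt)) ,
            (j<R , ok′ , ans′ , c′ , D′ , refl , st′ , leaving alt′)
            where
            leaving : _ → _
            leaving (inj₁ (e , c≡ , D≡ , u , a)) = inj₁ (e , c≡ , D≡ , u , λ _ → a)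
            leaving (inj₂ r) = inj₂ r

      Outcome : Mem → Set
      Outcome τ = ∃[ ok ] ∃[ ans ] (τ ≡ S (lev R M kb ok ans) (chk src 0 0 0 0 0 0 0) enu₀ wlk₀ tmp₀ o × AnsStep ans₀ ans
        × ((ok ≡ 1 × Unique R × (src ≡ s → t ≢ src → t < n → inB R t ≡ true → ans ≡ 1)) ⊎ (ok ≡ 0 × ¬ Unique R)))

      check-spec : Ends checkP (S (lev R M kb 1 ans₀) (chk src 0 0 0 0 0 0 0) enu₀ wlk₀ tmp₀ o) Outcome
      check-spec = conclude (for-ends rD rR layerP Inv R (λ { (_ , _ , _ , _ , _ , refl , _) → refl , refl }) inv-step (<⇒≤ R<)
          -- The ball of radius 0 contains the source alone, with weight 0.
          (z≤n , 1 , ans₀ , 1 , 0 , refl , inj₁ refl , inj₁ (refl , sym (proj₁ (count₀-total lengthFirst src src<n)) , sym (proj₂ (count₀-total lengthFirst src src<n)) ,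
            unique₀ lengthFirst src src<n , λ ())))
        where
        conclude : Ends (for rD rR layerP) (L 1 ans₀ 1 0 0) (Inv R) → Ends checkP (S (lev R M kb 1 ans₀) (chk src 0 0 0 0 0 0 0) enu₀ wlk₀ tmp₀ o) Outcome
        conclude (_ , ρ , _ , ok , ans , c , D , refl , st , alt) = _ ,
          (block _ (one< , tt) ▹ ρ ▹ block _ (tt , tt , tt , tt)) , ok , ans , refl , st , leaving alt
          where
          leaving : _ → _
          leaving (inj₁ (e , _ , _ , u , a)) = inj₁ (e , u , a R>0)
          leaving (inj₂ r) = inj₂ r
 
 

-- Search for the moduli, doubling of the radius, and output

chk₀ : Chk
chk₀ = chk 0 0 0 0 0 0 0 0

module Driver (𝒮 : Setting) (base : ℕ) (base≡ : base ≡ 2 ^ Setting.b 𝒮) where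

  open Setting 𝒮
  open Logic x mw iterations
  open Subroutines 𝒮
  open Weights base base≡
  open Walks n adj adj-<

  weightFrom-++ : ∀ a hs m v → weightFrom a (hs ++ [ m ]) v ≡ weightFrom a hs v * base + hash m v
  weightFrom-++ a []       m v = refl
  weightFrom-++ a (h ∷ hs) m v = weightFrom-++ (a * base + hash h v) hs m v

  pack-++ : ∀ hs m → pack (hs ++ [ m ]) ≡ pack hs * base + m
  pack-++ []       m = trans (+-identityʳ _) (*-identityʳ m)
  pack-++ (h ∷ hs) m = begin
    h * 2 ^ (length (hs ++ [ m ]) * b) + pack (hs ++ [ m ])   ≡⟨ cong₂ (λ k p → h * 2 ^ (k * b) + p) (trans (List.length-++ hs) (+-comm (length hs) 1)) (pack-++ hs m) ⟩
    h * 2 ^ (suc (length hs) * b) + (pack hs * base + m)      ≡⟨ cong (λ p → h * p + (pack hs * base + m)) (power-suc (length hs)) ⟩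
    h * (base * 2 ^ (length hs * b)) + (pack hs * base + m)   ≡⟨ l h base (2 ^ (length hs * b)) (pack hs) m ⟩
    (h * 2 ^ (length hs * b) + pack hs) * base + m            ∎
    where
    open ≡-Reasoning
    l : ∀ h c p q m → h * (c * p) + (q * c + m) ≡ (h * p + q) * c + m
    l = solve-∀

  Hashes-++ : ∀ {hs m} → Hashes hs → 0 < m × m < base → Hashes (hs ++ [ m ])
  Hashes-++ []      r = r ∷ []
  Hashes-++ (p ∷ h) r = p ∷ Hashes-++ h r

  -- `room` is stated for radius 2n: the radius is doubled only while it is below n.
  record Bounds : Set₁ where
    field
      edge-run   : EdgeRuns
      s<n        : s < n
      t<n        : t < n
      n≤pw       : n ≤ 2 ^ lg
      room       : ∀ {K} → K ≤ lg → suc (suc n) * (suc (suc (n + n)) * suc (2 * 2 ^ (K * b))) < cap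
      hash-room  : n * hashBound ≤ base
      hashBound< : hashBound < base
      base≤      : base ≤ iterations
      lgb≤       : lg * b ≤ iterations
      lg≤        : lg ≤ iterations
      b≤         : b ≤ iterations
      2n<        : n + n < iterations

  module Phases (ℬ : Bounds) where

    open Bounds ℬ

    n<it : n < iterations
    n<it = ≤-<-trans (m≤m+n n n) 2n<

    St : Lev → Chk → List Letter → Mem
    St lv ck o = S lv ck enu₀ wlk₀ tmp₀ o

    Reach : Set
    Reach = ∃[ zs ] Walk s zs t

    module Level (hs : List ℕ) (hashes : Hashes hs) (K≤ : length hs ≤ lg) where

      K : ℕ
      K = length hs

      double-room : 2 * 2 ^ (K * b) < cap
      double-room = ≤-<-trans (≤-trans (n≤1+n _) (≤-trans (m≤n*m _ (suc (suc (n + n)))) (m≤n*m _ (suc (suc n))))) (room K≤)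

      weight≤ : ∀ v → suc (weightFrom 1 hs v) ≤ 2 * 2 ^ (K * b)
      weight≤ v = go hs hashes 1 ≤-refl
        where
        go : ∀ rest → Hashes rest → ∀ a → suc a * 2 ^ (length rest * b) ≤ 2 * 2 ^ (K * b) → suc (weightFrom a rest v) ≤ 2 * 2 ^ (K * b)
        go []         _                    a bd = ≤-trans (≤-reflexive (sym (*-identityʳ (suc a)))) bd
        go (m ∷ rest) ((m>0 , m<) ∷ hrest) a bd = go rest hrest (a * base + hash m v)
          (≤-trans (*-monoˡ-≤ p (≤-trans (≤-reflexive (sym (+-suc (a * base) (hash m v)))) (≤-trans (+-monoʳ-≤ (a * base) (≤-<-trans (hash-≤ m>0 v) m<)) (≤-reflexive (+-comm (a * base) base)))))
                  (≤-trans (≤-reflexive (trans (*-assoc (suc a) base p) (cong (suc a *_) (sym (power-suc (length rest)))))) bd))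
          where p = 2 ^ (length rest * b)

      weight-run : ∀ {R ok ans ck en wk o} v → v < n → ∀ {Q} →
        Exec weightP (S (lev R (pack hs) (K * b) ok ans) ck en wk (weightArg v) o)
             (just (S (lev R (pack hs) (K * b) ok ans) ck en wk (weightValue (weightFrom 1 hs v)) o)) Q
      weight-run v v<n = weight-spec hs v hashes double-room
        (≤-<-trans (≤-trans (<⇒≤ v<n) (≤-trans (≤-trans (n≤1+n n) (n≤1+n _)) (m≤m*n (suc (suc n)) (suc (suc (n + n)) * suc (2 * 2 ^ (K * b)))))) (room K≤))
        (≤-trans (*-monoˡ-≤ b K≤) lgb≤) (≤-trans K≤ lg≤) base≤ (<⇒≤ (<-trans v<n n<it))

      -- The weight is given up to pointwise equality, so that `refine` can stand for the Horner
      -- form of a list extended by one modulus.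
      module Test (w : ℕ → ℕ) (w≡ : ∀ v → weightFrom 1 hs v ≡ w v) (lengthFirst : LengthFirst w) (R : ℕ) (R≤ : R ≤ n + n) (R>0 : 0 < R) (o : List Letter) where

        M : ℕ
        M = pack hs

        kb : ℕ
        kb = K * b

        w≤ : ∀ v → w v ≤ 2 * 2 ^ (K * b)
        w≤ v = ≤-trans (≤-reflexive (sym (w≡ v))) (<⇒≤ (weight≤ v))

        w-run : WeightRuns w R M kb
        w-run {ok} {ans} {ck} {en} {wk} {o} v v<n = becomes (cong (λ a → S (lev R M kb ok ans) ck en wk (weightValue a) o) (w≡ v)) (weight-run {R} {ok} {ans} {ck} {en} {wk} {o} v v<n)

        room′ : suc (suc n) * (suc (suc R) * suc (2 * 2 ^ (K * b))) < cap
        room′ = ≤-<-trans (*-monoʳ-≤ (suc (suc n)) (*-monoˡ-≤ (suc (2 * 2 ^ (K * b))) (s≤s (s≤s R≤)))) (room K≤)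

        weighting : Weighting 𝒮
        weighting = record
          { w = w ; R = R ; M = M ; kb = kb ; maxWeight = 2 * 2 ^ (K * b) ; edge-run = edge-run ; weight-run = w-run
          ; w≤ = w≤ ; lengthFirst = lengthFirst ; room = room′ ; n< = n<it ; R< = ≤-<-trans R≤ 2n< }

        UniqueSrc : ℕ → Set
        UniqueSrc u = ∀ v {xs ys} → Min w u xs v → Min w u ys v → length xs ≤ R → xs ≡ ys

        AnsStep : ℕ → ℕ → Set
        AnsStep ans₀ ans = ans ≡ ans₀ ⊎ (ans ≡ 1 × Reach)

        AnsStep-trans : ∀ {a c e} → AnsStep a c → AnsStep c e → AnsStep a e
        AnsStep-trans st (inj₁ refl) = st
        AnsStep-trans st (inj₂ r)    = inj₂ r

        AnsStep-keep : ∀ {a c} → AnsStep a c → a ≡ 1 → c ≡ 1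
        AnsStep-keep (inj₁ refl) e = e
        AnsStep-keep (inj₂ (e , _)) _ = e

        Near : Set
        Near = ∃[ zs ] (Walk s zs t × length zs ≤ R)

        module _ (ans₀ : ℕ) where

          private
            Inv : ℕ → Mem → Set
            Inv j τ = ∃[ ok ] ∃[ ans ] (τ ≡ St (lev R M kb ok ans) (chk j 0 0 0 0 0 0 0) o × AnsStep ans₀ ans
              × ((ok ≡ 1 × (∀ u → u < j → UniqueSrc u) × (s < j → t ≢ s → Near → ans ≡ 1)) ⊎ (ok ≡ 0 × ¬ UniqueUpTo w R)))

            incSrc : ∀ {j} → j < n → suc j < cap
            incSrc j<n = ≤-<-trans (≤-trans j<n (≤-trans (≤-trans (n≤1+n n) (n≤1+n _)) (m≤m*n (suc (suc n)) (suc (suc R) * suc (2 * 2 ^ (K * b)))))) room′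

            inv-step : ∀ {j τ} → j < n → Inv j τ → Ends (branch (lt rZ rOk) checkP skip ⨾ ‼ inc rSrc ∷ []) τ (Inv (suc j))
            inv-step {j} j<n (_ , ans , refl , st , inj₂ (refl , ¬u)) = _ , (else tt refl skip✓ ▹ block _ (incSrc j<n , tt)) , (0 , ans , refl , st , inj₂ (refl , ¬u))
            inv-step {j} j<n (_ , ans , refl , st , inj₁ (refl , u , a)) = conclude (Check.Source.check-spec 𝒮 weighting o j j<n ans R>0)
              where
              conclude : Ends checkP (St (lev R M kb 1 ans) (chk j 0 0 0 0 0 0 0) o) (Check.Source.Outcome 𝒮 weighting o j j<n ans R>0) →
                         Ends (branch (lt rZ rOk) checkP skip ⨾ ‼ inc rSrc ∷ []) (St (lev R M kb 1 ans) (chk j 0 0 0 0 0 0 0) o) (Inv (suc j))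
              conclude (_ , ρ , ok′ , ans′ , refl , st′ , alt) = _ , (then tt refl ρ ▹ block _ (incSrc j<n , tt)) , (ok′ , ans′ , refl , AnsStep-trans st st′ , leaving alt)
                where
                leaving : _ → _
                leaving (inj₁ (e , uj , aj)) = inj₁ (e , below-suc u uj , λ s<′ t≢s near → case-src (m≤n⇒m<n∨m≡n s<′) t≢s near)
                  where
                  case-src : suc s < suc j ⊎ suc s ≡ suc j → t ≢ s → Near → ans′ ≡ 1
                  case-src (inj₁ s<j) t≢s near = AnsStep-keep st′ (a (s≤s⁻¹ s<j) t≢s near)
                  case-src (inj₂ refl) t≢s (zs , p , l) = aj refl t≢s t<n
                    (proj₁ (proj₂ (proj₂ (proj₂ (Balls.in-ball n adj adj-< w (2 * 2 ^ (K * b)) w≤ lengthFirst j j<n p l)))))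
                leaving (inj₂ (e , ¬u)) = inj₂ (e , λ un → ¬u (λ v mx my l → un _ _ _ _ j<n mx my l))

          allSources : (∀ u → u < n → UniqueSrc u) → UniqueUpTo w R
          allSources f u v xs ys u<n mx my l = f u u<n v mx my l

          Tested : Mem → Set
          Tested τ = ∃[ ok ] ∃[ ans ] (τ ≡ St (lev R M kb ok ans) chk₀ o × AnsStep ans₀ ans
              × ((ok ≡ 1 × UniqueUpTo w R × (t ≢ s → Near → ans ≡ 1)) ⊎ (ok ≡ 0 × ¬ UniqueUpTo w R)))

          test-spec : Ends (for rSrc rN (branch (lt rZ rOk) checkP skip) ⨾ ‼ (clr rSrc ∷ [])) (St (lev R M kb 1 ans₀) chk₀ o) Tested
          test-spec = conclude (for-ends rSrc rN (branch (lt rZ rOk) checkP skip) Inv n (λ { (_ , _ , refl , _) → refl , refl }) inv-step (<⇒≤ n<it)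
              (1 , ans₀ , refl , inj₁ refl , inj₁ (refl , (λ _ ()) , (λ ()))))
            where
            conclude : Ends (for rSrc rN (branch (lt rZ rOk) checkP skip)) (St (lev R M kb 1 ans₀) chk₀ o) (Inv n) →
                       Ends (for rSrc rN (branch (lt rZ rOk) checkP skip) ⨾ ‼ (clr rSrc ∷ [])) (St (lev R M kb 1 ans₀) chk₀ o) Tested
            conclude (_ , ρ , ok , ans , refl , st , alt) = _ , (ρ ▹ block _ (tt , tt)) , (ok , ans , refl , st , leaving alt)
              where
              leaving : _ → _
              leaving (inj₁ (e , u , a)) = inj₁ (e , allSources u , a s<n)
              leaving (inj₂ r) = inj₂ r

    AnsStep : ℕ → ℕ → Set
    AnsStep ans₀ ans = ans ≡ ans₀ ⊎ (ans ≡ 1 × Reach)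

    NearWithin : ℕ → Set
    NearWithin R = ∃[ zs ] (Walk s zs t × length zs ≤ R)

    searchBody : Prog
    searchBody = ‼ (inc rM ∷ inc rOk ∷ []) ⨾ for rSrc rN (branch (lt rZ rOk) checkP skip) ⨾ ‼ (clr rSrc ∷ [])

    refine-lengthFirst : ∀ {w m} → LengthFirst w → 0 < m → m ≤ hashBound → LengthFirst (refine base w m)
    refine-lengthFirst lf m>0 m≤ u<n mn = lf u<n (refine-min m>0 (≤-trans (*-monoʳ-≤ n m≤) hash-room) u<n mn)

    module Search (hs : List ℕ) (hashes : Hashes hs) (K< : length hs < lg) (w : ℕ → ℕ) (w≡ : ∀ v → weightFrom 1 hs v ≡ w v)
      (lengthFirst : LengthFirst w) (R : ℕ) (uniq : UniqueUpTo w R) (R≤ : R + R ≤ n + n) (R>0 : 0 < R) (o : List Letter) where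

      private
        K = length hs

        T′ : ℕ → ℕ → ℕ → Mem
        T′ ok ans m = St (lev (R + R) (pack hs * base + m) (K * b + b) ok ans) chk₀ o

        length≡ : ∀ m → length (hs ++ [ m ]) ≡ suc K
        length≡ m = trans (List.length-++ hs) (+-comm K 1)

        T≡ : ∀ ok ans m → T′ ok ans m ≡ St (lev (R + R) (pack (hs ++ [ m ])) (length (hs ++ [ m ]) * b) ok ans) chk₀ o
        T≡ ok ans m = cong₂ (λ M kb → St (lev (R + R) M kb ok ans) chk₀ o) (sym (pack-++ hs m))
          (trans (+-comm (K * b) b) (cong (_* b) (sym (length≡ m))))

        m<base : ∀ {m} → m ≤ hashBound → m < base
        m<base m≤ = ≤-<-trans m≤ hashBound<

      Searched : ℕ → Mem → Set
      Searched ans₀ τ = ∃[ ans ] ∃[ m ] (τ ≡ St (lev (R + R) (pack (hs ++ [ m ])) (length (hs ++ [ m ]) * b) 1 ans) chk₀ o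
        × 0 < m × m ≤ hashBound × UniqueUpTo (refine base w m) (R + R) × AnsStep ans₀ ans × (t ≢ s → NearWithin (R + R) → ans ≡ 1))

      private
        AnsStep-trans : ∀ {a c e} → AnsStep a c → AnsStep c e → AnsStep a e
        AnsStep-trans st (inj₁ refl) = st
        AnsStep-trans st (inj₂ r)    = inj₂ r

        Tried : ℕ → ℕ → Mem → Set
        Tried m ans τ = ∃[ ok ] ∃[ ans′ ] (τ ≡ T′ ok ans′ (suc m) × AnsStep ans ans′
          × ((ok ≡ 1 × UniqueUpTo (refine base w (suc m)) (R + R) × (t ≢ s → NearWithin (R + R) → ans′ ≡ 1)) ⊎ (ok ≡ 0 × ¬ UniqueUpTo (refine base w (suc m)) (R + R))))

        tested : ∀ m → m < hashBound → ∀ ans → Ends searchBody (T′ 0 ans m) (Tried m ans)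
        tested m m< ans = conclude (Lv.Test.test-spec (refine base w (suc m))
            (λ v → trans (weightFrom-++ 1 hs (suc m) v) (cong (λ a → a * base + hash (suc m) v) (w≡ v)))
            (refine-lengthFirst lengthFirst (s≤s z≤n) m<) (R + R) R≤ (≤-trans R>0 (m≤m+n R R)) o ans)
          where
          hashes′ : Hashes (hs ++ [ suc m ])
          hashes′ = Hashes-++ hashes (s≤s z≤n , m<base m<)
          K′≤ : length (hs ++ [ suc m ]) ≤ lg
          K′≤ = ≤-trans (≤-reflexive (length≡ (suc m))) K<
          module Lv = Level (hs ++ [ suc m ]) hashes′ K′≤
          M< : suc (pack hs * base + m) < cap
          M< = subst (_< cap) (trans (pack-++ hs (suc m)) (+-suc (pack hs * base) m))
            (≤-<-trans (≤-trans (<⇒≤ (pack-< hashes′)) (m≤n*m _ 2)) Lv.double-room)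
          one< : 1 < cap
          one< = ≤-<-trans (≤-trans (m^n>0 2 (length (hs ++ [ suc m ]) * b)) (m≤n*m (2 ^ (length (hs ++ [ suc m ]) * b)) 2)) Lv.double-room
          start≡ : St (lev (R + R) (suc (pack hs * base + m)) (K * b + b) 1 ans) chk₀ o ≡ St (lev (R + R) (pack (hs ++ [ suc m ])) (length (hs ++ [ suc m ]) * b) 1 ans) chk₀ o
          start≡ = trans (cong (λ M → St (lev (R + R) M (K * b + b) 1 ans) chk₀ o) (sym (+-suc (pack hs * base) m))) (T≡ 1 ans (suc m))
          conclude : Ends _ (St (lev (R + R) (pack (hs ++ [ suc m ])) (length (hs ++ [ suc m ]) * b) 1 ans) chk₀ o) _ → Ends searchBody (T′ 0 ans m) (Tried m ans)
          conclude (_ , ρ , ok , ans′ , refl , st , alt) = _ ,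
            (block _ (M< , one< , tt) ▹ startingAt start≡ (becomes (sym (T≡ ok ans′ (suc m))) ρ)) , (ok , ans′ , refl , st , alt)

      module Iso = Isolation w base R lengthFirst uniq

      -- The isolating modulus only bounds the search. The loop stops at the first modulus that
      -- passes, and its uniqueness comes from the correctness of the test, not from isolation.
      search-spec : ∀ ans₀ → Ends searchP (T′ 0 ans₀ 0) (Searched ans₀)
      search-spec ans₀ = start Iso.isolating
        where
        Found : ℕ → Mem → Set₁
        Found fu σ = Stops (eq rOk rZ) searchBody fu σ (Searched ans₀)
        go : ∀ k m fu ans → m + suc k ≤ hashBound → UniqueUpTo (refine base w (m + suc k)) (R + R) → suc k ≤ fu → AnsStep ans₀ ans → Found fu (T′ 0 ans m)
        continue : ∀ k m fu ans → m + suc k ≤ hashBound → UniqueUpTo (refine base w (m + suc k)) (R + R) → k ≤ fu → AnsStep ans₀ ans →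
          Ends searchBody (T′ 0 ans m) (Tried m ans) → Found (suc fu) (T′ 0 ans m)
        go k m (suc fu) ans m≤ u* k≤ st = continue k m fu ans m≤ u* (s≤s⁻¹ k≤) st (tested m (<-≤-trans (m<m+n m (s≤s z≤n)) m≤) ans)
        continue k m fu ans m≤ u* k≤ st (_ , ρ , _ , ans′ , refl , st′ , inj₁ (refl , u , a)) = _ , again tt refl ρ (stop✓ tt refl) ,
          (ans′ , suc m , T≡ 1 ans′ (suc m) , s≤s z≤n , <-≤-trans (m<m+n m (s≤s z≤n)) m≤ , u , AnsStep-trans st st′ , a)
        continue zero m fu ans m≤ u* k≤ st (_ , ρ , _ , ans′ , refl , st′ , inj₂ (refl , ¬u)) =
          contradiction (subst (λ m → UniqueUpTo (refine base w m) (R + R)) (trans (+-suc m 0) (cong suc (+-identityʳ m))) u*) ¬u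
        continue (suc k) m (suc fu) ans m≤ u* k≤ st (_ , ρ , _ , ans′ , refl , st′ , inj₂ (refl , ¬u)) = stops-again tt refl ρ
          (go k (suc m) (suc fu) ans′ (≤-trans (≤-reflexive (sym (+-suc m (suc k)))) m≤) (subst (λ m → UniqueUpTo (refine base w m) (R + R)) (+-suc m (suc k)) u*) k≤ (AnsStep-trans st st′))
        start : ∃[ m ] (0 < m × m ≤ hashBound × ¬ (m ∣ Iso.X)) → Ends searchP (T′ 0 ans₀ 0) (Searched ans₀)
        start (suc m , _ , m≤ , ∤X) = while-ends (go m 0 iterations ans₀ m≤
          (Iso.isolated (suc m) (s≤s z≤n) ∤X (≤-trans (*-monoʳ-≤ n m≤) hash-room)) (≤-trans m≤ (≤-trans (<⇒≤ hashBound<) base≤)) (inj₁ refl))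

    -- The start of the doubling: a walk of one edge is determined by its endpoints.
    unique₁ : UniqueUpTo (λ _ → 1) 1
    unique₁ u v []            []            u<n mx my l = refl
    unique₁ u v []            (y ∷ ys)      u<n mx my l = contradiction (shortest-≤ my (proj₁ mx)) λ()
    unique₁ u v (x ∷ xs)      []            u<n mx my l = contradiction (shortest-≤ mx (proj₁ my)) λ()
    unique₁ u v (x ∷ [])      (y ∷ [])      u<n (_ ∷ [] , _) (_ ∷ [] , _) l = refl
    unique₁ u v (x ∷ [])      (y ∷ z ∷ ys)  u<n mx my l = contradiction (shortest-≤ my (proj₁ mx)) λ { (s≤s ()) }
    unique₁ u v (x ∷ z ∷ xs)  (y ∷ ys)      u<n mx my (s≤s ())

    AnsOK : ℕ → Set
    AnsOK ans = (ans ≡ 0 ⊎ (ans ≡ 1 × Reach)) × (s ≡ t → ans ≡ 1)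

    record Good (hs : List ℕ) (w : ℕ → ℕ) (R ans : ℕ) : Set where
      field
        hashes      : Hashes hs
        levels≤     : length hs ≤ lg
        weights     : ∀ v → weightFrom 1 hs v ≡ w v
        lengthFirst : LengthFirst w
        uniq        : UniqueUpTo w R
        radius      : R ≡ 2 ^ length hs
        ansOK       : AnsOK ans
        -- Before the first round no test has been run, so completeness of the answer is claimed
        -- only afterwards.
        ansComplete : 0 < length hs → t ≢ s → NearWithin R → ans ≡ 1

    open Good

    Lvl : List Letter → List ℕ → ℕ → ℕ → ℕ → Mem
    Lvl o hs R ok ans = St (lev R (pack hs) (length hs * b) ok ans) chk₀ o

    Finished : List Letter → Mem → Set
    Finished o τ = ∃[ hs ] ∃[ w ] ∃[ R ] ∃[ ok ] ∃[ ans ] (τ ≡ Lvl o hs R ok ans × n ≤ R × Good hs w R ans)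

    levelBody : Prog
    levelBody = ‼ (add rR rR ∷ add rKb rB ∷ clr rOk ∷ []) ⨾ for rI rB (‼ add rM rM ∷ []) ⨾ ‼ (clr rI ∷ []) ⨾ searchP

    shiftTo : ℕ → ℕ → ℕ
    shiftTo m zero    = m
    shiftTo m (suc j) = shiftTo m j + shiftTo m j

    shiftTo-≡ : ∀ m j → shiftTo m j ≡ m * 2 ^ j
    shiftTo-≡ m zero    = sym (*-identityʳ m)
    shiftTo-≡ m (suc j) = trans (cong₂ _+_ (shiftTo-≡ m j) (shiftTo-≡ m j)) (l m (2 ^ j))
      where
      l : ∀ m p → m * p + m * p ≡ m * (2 * p)
      l = solve-∀

    level-step : ∀ {o hs w R ok ans} → Good hs w R ans → length hs < lg → R < n →
      Ends levelBody (Lvl o hs R ok ans) (λ τ → ∃[ m ] ∃[ ans′ ] (τ ≡ Lvl o (hs ++ [ m ]) (R + R) 1 ans′ × Good (hs ++ [ m ]) (refine base w m) (R + R) ans′))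
    level-step {o} {hs} {w} {R} {ok} {ans} g K< R<n = conclude (search-spec ans)
      where
      R+R≤ : R + R ≤ n + n
      R+R≤ = +-mono-≤ (<⇒≤ R<n) (<⇒≤ R<n)
      R>0 : 0 < R
      R>0 = subst (0 <_) (sym (radius g)) (m^n>0 2 (length hs))
      open Search hs (hashes g) K< w (weights g) (lengthFirst g) R (uniq g) R+R≤ R>0 o
      K = length hs
      big : ∀ {a} → a ≤ suc (suc n) * (suc (suc (n + n)) * suc (2 * 2 ^ (suc K * b))) → a < cap
      big a≤ = ≤-<-trans a≤ (room K<)
      row≤ : suc (2 * 2 ^ (suc K * b)) ≤ suc (suc n) * (suc (suc (n + n)) * suc (2 * 2 ^ (suc K * b)))
      row≤ = ≤-trans (m≤n*m _ (suc (suc (n + n)))) (m≤n*m _ (suc (suc n)))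
      pow< : ∀ {a} → a ≤ 2 ^ (suc K * b) → a < cap
      pow< a≤ = big (≤-trans a≤ (≤-trans (m≤n*m _ 2) (≤-trans (n≤1+n _) row≤)))
      R< : R + R < cap
      R< = big (≤-trans R+R≤ (≤-trans (≤-trans (n≤1+n _) (n≤1+n _)) (≤-trans (m≤m*n (suc (suc (n + n))) (suc (2 * 2 ^ (suc K * b)))) (m≤n*m _ (suc (suc n))))))
      kb< : K * b + b < cap
      kb< = pow< (≤-trans (≤-reflexive (+-comm (K * b) b)) (<⇒≤ (n<2^n (suc K * b))))
      shift≤ : ∀ j → j ≤ b → shiftTo (pack hs) j ≤ 2 ^ (suc K * b)
      shift≤ j j≤ = ≤-trans (≤-reflexive (shiftTo-≡ (pack hs) j)) (≤-trans (*-mono-≤ (<⇒≤ (pack-< (hashes g))) (^-monoʳ-≤ 2 j≤))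
        (≤-reflexive (trans (sym (^-distribˡ-+-* 2 (K * b) b)) (cong (2 ^_) (+-comm (K * b) b)))))
      b< : ∀ {j} → j ≤ b → j < cap
      b< j≤ = pow< (≤-trans j≤ (≤-trans (<⇒≤ (n<2^n b)) (^-monoʳ-≤ 2 (m≤m+n b (K * b)))))
      mid : ℕ → ℕ → Mem
      mid i M = S (lev (R + R) M (K * b + b) 0 ans) chk₀ enu₀ wlk₀ (record tmp₀ { tI = i }) o
      conclude : Ends searchP (mid 0 (pack hs * base + 0)) (Searched ans) →
        Ends levelBody (Lvl o hs R ok ans) (λ τ → ∃[ m ] ∃[ ans′ ] (τ ≡ Lvl o (hs ++ [ m ]) (R + R) 1 ans′ × Good (hs ++ [ m ]) (refine base w m) (R + R) ans′))
      conclude (_ , ρ , ans′ , m , refl , m>0 , m≤ , u , st , a) = _ ,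
        (block _ (R< , kb< , tt , tt) ▹
         for-exact rI rB _ (λ j → mid j (shiftTo (pack hs) j)) b (λ j → refl , refl)
           (λ j j< → block _ (≤-<-trans (≤-refl {shiftTo (pack hs) (suc j)}) (pow< (shift≤ (suc j) j<)) , tt) ▹ block _ (b< j< , tt)) b≤ ▹
         block _ (tt , tt) ▹
         startingAt (cong (mid 0) (trans (shiftTo-≡ (pack hs) b) (trans (cong (pack hs *_) (sym base≡)) (sym (+-identityʳ _))))) ρ) ,
        (m , ans′ , refl , record
          { hashes      = Hashes-++ (hashes g) (m>0 , ≤-<-trans m≤ hashBound<)
          ; levels≤     = ≤-trans (≤-reflexive len≡) K<
          ; weights     = λ v → trans (weightFrom-++ 1 hs m v) (cong (λ a → a * base + hash m v) (weights g v))
          ; lengthFirst = refine-lengthFirst (lengthFirst g) m>0 m≤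
          ; uniq        = u
          ; radius      = trans (cong₂ _+_ (radius g) (trans (radius g) (sym (+-identityʳ _)))) (cong (2 ^_) (sym len≡))
          ; ansOK       = ok-step st (ansOK g)
          ; ansComplete = λ _ → a })
        where
        len≡ : length (hs ++ [ m ]) ≡ suc K
        len≡ = trans (List.length-++ hs) (+-comm K 1)
        ok-step : ∀ {a c} → AnsStep a c → AnsOK a → AnsOK c
        ok-step (inj₁ refl)    r       = r
        ok-step (inj₂ (e , p)) _       = inj₂ (e , p) , λ _ → e

    -- After k rounds the radius is 2ᵏ. Since n is at most 2^`lg`, the loop ends within `lg` rounds.
    levels-spec : ∀ {o hs w R ok ans} → Good hs w R ans → Ends levelsP (Lvl o hs R ok ans) (Finished o)
    levels-spec {o} {hs} {w} {R} {ok} {ans} g =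
      while-ends (go (lg ∸ length hs) iterations (m+[n∸m]≡n (levels≤ g)) (≤-trans (m∸n≤m lg (length hs)) lg≤) g)
      where
      Next : List ℕ → (ℕ → ℕ) → ℕ → Mem → Set
      Next hs w R τ = ∃[ m ] ∃[ ans ] (τ ≡ Lvl o (hs ++ [ m ]) (R + R) 1 ans × Good (hs ++ [ m ]) (refine base w m) (R + R) ans)
      go : ∀ {hs w R ok ans} k fu → length hs + k ≡ lg → k ≤ fu → Good hs w R ans → Stops (lt rR rN) levelBody fu (Lvl o hs R ok ans) (Finished o)
      advance : ∀ {hs w R ok ans} k fu → length hs + k ≡ lg → k ≤ fu → Good hs w R ans → Dec (R < n) → Stops (lt rR rN) levelBody fu (Lvl o hs R ok ans) (Finished o)
      descend : ∀ {hs w R ok ans} k fu → length hs + suc k ≡ lg → k ≤ fu → R < n → Ends levelBody (Lvl o hs R ok ans) (Next hs w R) →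
                Stops (lt rR rN) levelBody (suc fu) (Lvl o hs R ok ans) (Finished o)
      go {R = R} k fu k≡ k≤ g = advance k fu k≡ k≤ g (R <? n)
      advance {hs} {w} {R} {ok} {ans} k fu k≡ k≤ g (no R≮n) = _ , stop✓ tt (<ᵇ-false (≮⇒≥ R≮n)) , (hs , w , R , ok , ans , refl , ≮⇒≥ R≮n , g)
      advance {hs} zero fu k≡ k≤ g (yes R<n) = contradiction R<n (≤⇒≯ (≤-trans n≤pw (≤-reflexive (trans (cong (2 ^_) (trans (sym k≡) (+-identityʳ _))) (sym (radius g))))))
      advance {hs} {w} (suc k) (suc fu) k≡ k≤ g (yes R<n) = descend {w = w} k fu k≡ (s≤s⁻¹ k≤) R<n (level-step g K< R<n)
        where
        K< : length hs < lg
        K< = ≤-trans (≤-trans (s≤s (m≤m+n (length hs) k)) (≤-reflexive (sym (+-suc (length hs) k)))) (≤-reflexive k≡)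
      descend {hs} k fu k≡ k≤ R<n (_ , ρ , m , ans′ , refl , g′) = stops-again tt (<ᵇ-true R<n) ρ
        (go k fu (trans (cong (_+ k) (trans (List.length-++ hs) (+-comm (length hs) 1))) (trans (sym (+-suc (length hs) k)) k≡)) k≤ g′)

    item : (ℕ → ℕ) → ℕ → ℕ → List Letter
    item w u v = if adj u v then map boolLetter (toBits wd (w v)) ++ [ sep ] else []

    rowTo : (ℕ → ℕ) → ℕ → ℕ → List Letter
    rowTo w u zero    = []
    rowTo w u (suc k) = rowTo w u k ++ item w u k

    rowsTo : (ℕ → ℕ) → ℕ → List Letter
    rowsTo w zero    = []
    rowsTo w (suc u) = rowsTo w u ++ rowTo w u n

    boolOf : ℕ → Bool
    boolOf a = 0 <ᵇ a

    output-spec : ∀ {hs w R ok ans o} → Good hs w R ans →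
      Ends outputP (Lvl o hs R ok ans) (λ τ → out τ ≡ (o ++ rowsTo (weightFrom 1 hs) n) ++ [ boolLetter (boolOf ans) ])
    output-spec {hs} {w₀} {R} {ok} {ans} {o} g = _ , (rows ▹ answer ans) , refl
      where
      open Level hs (hashes g) (levels≤ g)
      w = weightFrom 1 hs
      lv = lev R (pack hs) (length hs * b) ok ans
      at : ℕ → ℕ → Tmp → List Letter → Mem
      at u v τ o = S lv (record chk₀ { kV = v }) (record enu₀ { eU = u }) wlk₀ τ o
      vertex< : ∀ {u} → u ≤ n → u < cap
      vertex< u≤n = ≤-<-trans (≤-trans u≤n (≤-trans (≤-trans (n≤1+n n) (n≤1+n _)) (m≤m*n (suc (suc n)) (suc (suc (n + n)) * suc (2 * 2 ^ (length hs * b)))))) (room (levels≤ g))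
      entryP : Prog
      entryP = ‼ (add rEa rU ∷ add rEb rV ∷ []) ⨾ edgeP ⨾
               branch (lt rZ rG) (‼ (clr rG ∷ add rEa rV ∷ []) ⨾ weightP ⨾ ‼ (putReg rW ∷ put sep ∷ clr rW ∷ [])) skip
      entry-spec : ∀ {u v o} → u < n → v < n → ∀ {Q} → Exec entryP (at u v tmp₀ o) (just (at u v tmp₀ (o ++ item w u v))) Q
      entry-spec {u} {v} {o} u<n v<n = block _ (vertex< (<⇒≤ u<n) , vertex< (<⇒≤ v<n) , tt) ▹ edge-run {lv} {record chk₀ { kV = v }} {record enu₀ { eU = u }} {wlk₀} {o} u v u<n v<n ▹ tail (adj u v)
        where
        tail : ∀ c {Q} → Exec (branch (lt rZ rG) (‼ (clr rG ∷ add rEa rV ∷ []) ⨾ weightP ⨾ ‼ (putReg rW ∷ put sep ∷ clr rW ∷ [])) skip)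
          (at u v (edgeBit ⌊ c ⌋) o) (just (at u v tmp₀ (o ++ (if c then map boolLetter (toBits wd (w v)) ++ [ sep ] else [])))) Q
        tail true  = then tt refl (block _ (tt , vertex< (<⇒≤ v<n) , tt) ▹ weight-run {R} {ok} {ans} {record chk₀ { kV = v }} {record enu₀ { eU = u }} {wlk₀} {o} v v<n ▹
                      becomes (cong (at u v tmp₀) (List.++-assoc o (map boolLetter (toBits wd (w v))) [ sep ])) (block _ (tt , tt , tt , tt)))
        tail false = else tt refl (becomes (cong (at u v tmp₀) (sym (List.++-identityʳ o))) skip✓)
      row : ∀ {u o} → u < n → ∀ {Q} → Exec (for rV rN entryP ⨾ ‼ (clr rV ∷ [])) (at u 0 tmp₀ o) (just (at u 0 tmp₀ (o ++ rowTo w u n))) Q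
      row {u} {o} u<n = startingAt (cong (at u 0 tmp₀) (sym (List.++-identityʳ o)))
        (for-exact rV rN entryP (λ j → at u j tmp₀ (o ++ rowTo w u j)) n (λ j → refl , refl)
          (λ j j< → entry-spec u<n j< ▹ becomes (cong (at u (suc j) tmp₀) (List.++-assoc o (rowTo w u j) (item w u j))) (block _ (vertex< j< , tt))) (<⇒≤ n<it) ▹
         block _ (tt , tt))
      rows : ∀ {Q} → Exec (for rU rN (for rV rN entryP ⨾ ‼ (clr rV ∷ []))) (at 0 0 tmp₀ o) (just (at n 0 tmp₀ (o ++ rowsTo w n))) Q
      rows = startingAt (cong (at 0 0 tmp₀) (sym (List.++-identityʳ o)))
        (for-exact rU rN _ (λ j → at j 0 tmp₀ (o ++ rowsTo w j)) n (λ j → refl , refl)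
          (λ j j< → row j< ▹ becomes (cong (at (suc j) 0 tmp₀) (List.++-assoc o (rowsTo w j) (rowTo w j n))) (block _ (vertex< j< , tt))) (<⇒≤ n<it))
      answer : ∀ a {Q} → Exec (branch (lt rZ rAns) (‼ put (bit 1b) ∷ []) (‼ put (bit 0b) ∷ []))
        (S (lev R (pack hs) (length hs * b) ok a) chk₀ (record enu₀ { eU = n }) wlk₀ tmp₀ (o ++ rowsTo w n))
        (just (S (lev R (pack hs) (length hs * b) ok a) chk₀ (record enu₀ { eU = n }) wlk₀ tmp₀ ((o ++ rowsTo w n) ++ [ boolLetter (boolOf a) ]))) Q
      answer zero    = else tt refl (block _ (tt , tt))
      answer (suc a) = then tt refl (block _ (tt , tt))

-- Reading the input and choosing the width

cell-at : ∀ pre l post → inputCell (pre ++ l ∷ post) (suc (length pre)) ≡ letter l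
cell-at []        l post = refl
cell-at (p ∷ pre) l post = cell-at pre l post

length-unary : ∀ k → length (unary k) ≡ suc k
length-unary k = trans (List.length-++ (replicate k (bit 1b))) (trans (cong (_+ 1) (List.length-replicate k)) (+-comm k 1))

unary-one : ∀ pre k post j → j < k → isOneᵇ (inputCell (pre ++ unary k ++ post) (suc (j + length pre))) ≡ true
unary-one [] (suc k) post zero    j< = refl
unary-one [] (suc k) post (suc j) j< = unary-one [] k post j (s≤s⁻¹ j<)
unary-one (p ∷ pre) k post j j< rewrite +-suc j (length pre) = unary-one pre k post j j<

unary-stop : ∀ pre k post → isOneᵇ (inputCell (pre ++ unary k ++ post) (suc (k + length pre))) ≡ false
unary-stop [] zero    post = refl
unary-stop [] (suc k) post = unary-stop [] k post
unary-stop (p ∷ pre) k post rewrite +-suc k (length pre) = unary-stop pre k post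

-- The least l with k ≤ 2ˡ, computed incrementally in the same way as by the loop in `setupP`.
lgOf : ℕ → ℕ
lgOf zero    = 0
lgOf (suc k) = if 2 ^ lgOf k <ᵇ suc k then suc (lgOf k) else lgOf k

≤-2^lgOf : ∀ k → k ≤ 2 ^ lgOf k
≤-2^lgOf zero = z≤n
≤-2^lgOf (suc k) with 2 ^ lgOf k <ᵇ suc k in e
... | true  = ≤-trans (+-mono-≤ (m^n>0 2 (lgOf k)) (≤-2^lgOf k)) (+-monoʳ-≤ (2 ^ lgOf k) (m≤m+n _ 0))
... | false = ≮⇒≥ (λ p → subst T e (<⇒<ᵇ p))

2^lgOf-≤ : ∀ k → 2 ^ lgOf (suc k) ≤ 2 * suc k
2^lgOf-≤ k with 2 ^ lgOf k <ᵇ suc k in e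
... | true  = *-monoʳ-≤ 2 (<⇒≤ (<ᵇ⇒< (2 ^ lgOf k) (suc k) (subst T (sym e) _)))
2^lgOf-≤ zero    | false = s≤s z≤n
2^lgOf-≤ (suc k) | false = ≤-trans (2^lgOf-≤ k) (*-monoʳ-≤ 2 (n≤1+n (suc k)))

lgOf-suc : ∀ k → lgOf k ≤ lgOf (suc k)
lgOf-suc k with 2 ^ lgOf k <ᵇ suc k
... | true  = n≤1+n _
... | false = ≤-refl

lgOf-mono : ∀ {j k} → j ≤ k → lgOf j ≤ lgOf k
lgOf-mono {j} {zero}  z≤n = ≤-refl
lgOf-mono {j} {suc k} j≤ with m≤n⇒m<n∨m≡n j≤
... | inj₁ j<   = ≤-trans (lgOf-mono (s≤s⁻¹ j<)) (lgOf-suc k)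
... | inj₂ refl = ≤-refl

-- With L = 2ˡ the base is 16 L⁶. It has to be at least n * `hashBound`, and `hashBound` is at most
-- 9 n⁵ while n ≤ L.
bOf : ℕ → ℕ
bOf l = suc (suc (suc (suc (l + l + l + l + l + l))))

-- The shape follows the loops in `setupP`: l + 5 columns exist after reading n, and each of `bOf l`
-- iterations adds 3 + l. The product `bOf l * l` in it accommodates one digit per round.
widthOf : ℕ → ℕ
widthOf l = bOf l * (3 + l) + (l + 5)

module Setup (x : List Letter) (iterations : ℕ) (n s t : ℕ) (s<n : s < n) (t<n : t < n) (rest : List Letter)
  (x≡ : x ≡ unary n ++ unary s ++ unary t ++ rest)
  (lg≤ : lgOf n ≤ iterations) (b≤ : bOf (lgOf n) ≤ iterations) (x≤ : suc (length x) ≤ iterations) where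

  lg : ℕ
  lg = lgOf n

  b : ℕ
  b = bOf lg

  width′ : ℕ
  width′ = widthOf lg

  open Logic x width′ iterations

  off₁ off₂ off₃ : ℕ
  off₁ = suc n
  off₂ = suc (s + off₁)
  off₃ = suc (t + off₂)

  private
    small : ∀ {l a} → a ≤ 8 * 2 ^ l → a < 2 ^ (l + 5)
    small {l} {a} a≤ = ≤-<-trans a≤ (<-≤-trans (*-monoˡ-< (2 ^ l) {{>-nonZero (m^n>0 2 l)}} (s≤s (m≤m+n 8 23))) (≤-reflexive (trans (*-comm 32 (2 ^ l)) (sym (^-distribˡ-+-* 2 l 5)))))

    p>0 : ∀ l → 1 ≤ 2 ^ l
    p>0 l = m^n>0 2 l

    times : ∀ {p} q k → p ≤ k * q → k ≤ 8 → p ≤ 8 * q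
    times q k p≤ k≤ = ≤-trans p≤ (*-monoˡ-≤ q k≤)

    width≥ : lg + 5 ≤ width′
    width≥ = m≤n+m (lg + 5) (b * (3 + lg))

    total : length x ≡ off₃ + length rest
    total = trans (cong length x≡) (trans (List.length-++ (unary n)) (trans (cong₂ _+_ (length-unary n)
      (trans (List.length-++ (unary s)) (cong₂ _+_ (length-unary s) (trans (List.length-++ (unary t)) (cong (_+ length rest) (length-unary t)))))) (l n s t (length rest))))
      where
      l : ∀ n s t r → suc n + (suc s + (suc t + r)) ≡ suc (t + suc (s + suc n)) + r
      l = solve-∀

    off₃≤ : off₃ ≤ length x
    off₃≤ = ≤-trans (m≤m+n off₃ (length rest)) (≤-reflexive (sym total))
    off₂≤ : off₂ ≤ length x
    off₂≤ = ≤-trans (≤-trans (m≤n+m off₂ t) (n≤1+n _)) off₃≤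
    off₁≤ : off₁ ≤ length x
    off₁≤ = ≤-trans (≤-trans (m≤n+m off₁ s) (n≤1+n _)) off₂≤

    right≡ : ∀ {h} → h ≤ length x → moveInput x right h ≡ suc h
    right≡ h≤ = m≤n⇒m⊓n≡m (s≤s h≤)

    N : ℕ → Mem
    N k = st (con k 0 (lgOf k) (2 ^ lgOf k) (suc k) 0 0 0 0) (lev 0 0 0 0 0) chk₀ enu₀ wlk₀ tmp₀ (suc k) [] (lgOf k + 5)

    bodyN : Prog
    bodyN = ‼ (inc rN ∷ []) ⨾ branch (lt rPw rN) (‼ grow ∷ add rPw rPw ∷ inc rLg ∷ []) skip ⨾ ‼ (move right ∷ inc rOff ∷ [])

    stepN : ∀ {k} → k < n → ∀ {Q} → Exec bodyN (N k) (just (N (suc k))) Q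
    stepN {k} k<n = block _ (small {lgOf k} (times (2 ^ lgOf k) 2 k+1≤ (s≤s (s≤s z≤n))) , tt) ▹ tail
      where
      k+1≤ : suc k ≤ 2 * 2 ^ lgOf k
      k+1≤ = ≤-trans (+-mono-≤ (p>0 (lgOf k)) (≤-2^lgOf k)) (+-monoʳ-≤ (2 ^ lgOf k) (m≤m+n _ 0))
      h≡ : moveInput x right (suc k) ≡ suc (suc k)
      h≡ = right≡ (≤-trans (m≤n⇒m≤1+n k<n) off₁≤)
      W : ℕ → ℕ → ℕ → Mem
      W l p h = st (con (suc k) 0 l p (suc (suc k)) 0 0 0 0) (lev 0 0 0 0 0) chk₀ enu₀ wlk₀ tmp₀ h [] (l + 5)
      lgs : lgOf (suc k) ≤ lg
      lgs = lgOf-mono k<n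
      tail : ∀ {Q} → Exec (branch (lt rPw rN) (‼ grow ∷ add rPw rPw ∷ inc rLg ∷ []) skip ⨾ ‼ (move right ∷ inc rOff ∷ []))
        (st (con (suc k) 0 (lgOf k) (2 ^ lgOf k) (suc k) 0 0 0 0) (lev 0 0 0 0 0) chk₀ enu₀ wlk₀ tmp₀ (suc k) [] (lgOf k + 5)) (just (N (suc k))) Q
      tail with 2 ^ lgOf k <ᵇ suc k in e | lgs
      ... | true | lgs = then tt e (becomes (cong (λ p → st (con (suc k) 0 (suc l) p (suc k) 0 0 0 0) (lev 0 0 0 0 0) chk₀ enu₀ wlk₀ tmp₀ (suc k) [] (suc (l + 5))) dbl)
                             (block _ (≤-trans (+-monoˡ-≤ 5 lgs) width≥ , small {suc l} (≤-trans (≤-reflexive dbl) (m≤n*m _ 8)) ,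
                                       small {suc l} (≤-trans (<⇒≤ (n<2^n (suc l))) (m≤n*m _ 8)) , tt))) ▹
              becomes (cong (W (suc l) (2 ^ suc l)) h≡) (block _ (tt , small {suc l} (times (2 ^ suc l) 3 k+2≤ (s≤s (s≤s (s≤s z≤n)))) , tt))
        where
        l = lgOf k
        dbl : 2 ^ l + 2 ^ l ≡ 2 ^ suc l
        dbl = cong (2 ^ l +_) (sym (+-identityʳ (2 ^ l)))
        k+2≤ : suc (suc k) ≤ 3 * 2 ^ suc l
        k+2≤ = ≤-trans (+-mono-≤ (p>0 (suc l)) (≤-trans k+1≤ (≤-reflexive refl))) (+-monoʳ-≤ (2 ^ suc l) (m≤m+n _ _))
      ... | false | _ = else tt e skip✓ ▹
              becomes (cong (W (lgOf k) (2 ^ lgOf k)) h≡) (block _ (tt , small {lgOf k} (times (2 ^ lgOf k) 3 (+-mono-≤ (p>0 (lgOf k)) k+1≤) (s≤s (s≤s (s≤s z≤n)))) , tt))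

    loopN : ∀ {Q} → Exec (while isOne bodyN) (N 0) (just (N n)) Q
    loopN = loop (go n 0 iterations (+-identityʳ n) (≤-trans (≤-trans (n≤1+n n) (≤-trans off₁≤ (n≤1+n _))) x≤))
      where
      go : ∀ k j fu → k + j ≡ n → k ≤ fu → ∀ {Q} → Iterate isOne bodyN fu (N j) (just (N n)) Q
      go zero    j fu refl k≤ = stop✓ tt (trans (cong (λ y → isOneᵇ (inputCell y (suc j))) x≡)
        (subst (λ h → isOneᵇ (inputCell (unary n ++ unary s ++ unary t ++ rest) (suc h)) ≡ false) (+-identityʳ n) (unary-stop [] n (unary s ++ unary t ++ rest))))
      go (suc k) j (suc fu) refl k≤ = again tt (trans (cong (λ y → isOneᵇ (inputCell y (suc j))) x≡)
          (subst (λ h → isOneᵇ (inputCell (unary n ++ unary s ++ unary t ++ rest) (suc h)) ≡ true) (+-identityʳ j) (unary-one [] n (unary s ++ unary t ++ rest) j (s≤s (m≤n+m j k)))))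
        (stepN (s≤s (m≤n+m j k))) (go k (suc j) fu (+-suc k j) (s≤s⁻¹ k≤))

    -- One proof for reading s and t; the counting register is hidden in the family σ. The instances
    -- of σ let `rOff` equal the head position, which is how the offset of the matrix gets measured.
    module Unary (r : Reg) (k L : ℕ) (σ : ℕ → ℕ → Mem)
      (one  : ∀ j → j < k → isOneᵇ (inputCell x (suc (j + L))) ≡ true)
      (stop : isOneᵇ (inputCell x (suc (k + L))) ≡ false)
      (hdσ  : ∀ c h → hd (σ c h) ≡ h)
      (incσ : ∀ c h → h ≤ length x → AfterAll (inc r ∷ move right ∷ inc rOff ∷ []) (σ c h) ≡ σ (suc c) (suc h))
      (endσ : ∀ c h → h ≤ length x → AfterAll (move right ∷ inc rOff ∷ []) (σ c h) ≡ σ c (suc h))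
      (okσ  : ∀ c h → c < k → h ≤ length x → h ≤ off₃ → AllOK (inc r ∷ move right ∷ inc rOff ∷ []) (σ c h))
      (okₑ  : ∀ c h → h ≤ length x → h ≤ off₃ → AllOK (move right ∷ inc rOff ∷ []) (σ c h))
      (end≤ : suc (k + L) ≤ length x) (end≤₃ : suc (k + L) ≤ off₃) where

      go : ∀ i j fu → i + j ≡ k → i ≤ fu → ∀ {Q} →
           Iterate isOne (‼ inc r ∷ move right ∷ inc rOff ∷ []) fu (σ j (suc (j + L))) (just (σ k (suc (k + L)))) Q
      go zero    j fu refl i≤ = stop✓ tt (trans (cong (isOneᵇ ∘ inputCell x) (hdσ k (suc (k + L)))) stop)
      go (suc i) j (suc fu) refl i≤ = again tt (trans (cong (isOneᵇ ∘ inputCell x) (hdσ j (suc (j + L)))) (one j j<))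
          (becomes (incσ j (suc (j + L)) h≤) (block _ (okσ j (suc (j + L)) j< h≤ (≤-trans jk end≤₃))))
          (go i (suc j) fu (+-suc i j) (s≤s⁻¹ i≤))
        where
        j< : j < suc (i + j)
        j< = s≤s (m≤n+m j i)
        jk : suc (j + L) ≤ suc (suc (i + j) + L)
        jk = s≤s (+-monoˡ-≤ L (<⇒≤ j<))
        h≤ : suc (j + L) ≤ length x
        h≤ = ≤-trans jk end≤

      spec : ∀ {Q} → Exec (skipUnaryP r) (σ 0 (suc L)) (just (σ k (suc (suc (k + L))))) Q
      spec = loop (go k 0 iterations (+-identityʳ k) (≤-trans (≤-trans (m≤m+n k L) (≤-trans (n≤1+n _) (≤-trans end≤ (n≤1+n _)))) x≤)) ▹
             becomes (endσ k (suc (k + L)) end≤) (block _ (okₑ k (suc (k + L)) end≤ end≤₃))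

    big : ∀ {a} → a ≤ suc off₃ → a < 2 ^ (lg + 5)
    big {a} a≤ = small {lg} (≤-trans a≤ (≤-trans off≤ (*-monoʳ-≤ 8 (≤-2^lgOf n))))
      where
      off≤ : suc off₃ ≤ 8 * n
      off≤ = ≤-trans (≤-reflexive (l₁ t s n)) (≤-trans (+-mono-≤ (+-mono-≤ t<n s<n) (≤-refl {n + 2})) (≤-trans (≤-reflexive (l₂ n)) (≤-trans (+-monoʳ-≤ (3 * n) (*-monoʳ-≤ 2 (≤-<-trans z≤n s<n))) (≤-trans (≤-reflexive (l₃ n)) (*-monoˡ-≤ n (m≤m+n 5 3))))))
        where
        l₁ : ∀ t s n → suc (suc (t + suc (s + suc n))) ≡ suc t + suc s + (n + 2)
        l₁ = solve-∀
        l₂ : ∀ n → n + n + (n + 2) ≡ 3 * n + 2 * 1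
        l₂ = solve-∀
        l₃ : ∀ n → 3 * n + 2 * n ≡ 5 * n
        l₃ = solve-∀

    σS : ℕ → ℕ → Mem
    σS c h = st (con n 0 lg (2 ^ lg) h 0 c 0 0) (lev 0 0 0 0 0) chk₀ enu₀ wlk₀ tmp₀ h [] (lg + 5)

    σT : ℕ → ℕ → Mem
    σT c h = st (con n 0 lg (2 ^ lg) h 0 s c 0) (lev 0 0 0 0 0) chk₀ enu₀ wlk₀ tmp₀ h [] (lg + 5)

    x₁ : x ≡ unary n ++ unary s ++ (unary t ++ rest)
    x₁ = x≡
    x₂ : x ≡ (unary n ++ unary s) ++ unary t ++ rest
    x₂ = trans x≡ (sym (List.++-assoc (unary n) (unary s) (unary t ++ rest)))
    len₂ : length (unary n ++ unary s) ≡ off₂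
    len₂ = trans (List.length-++ (unary n)) (trans (cong₂ _+_ (length-unary n) (length-unary s)) (l n s))
      where
      l : ∀ n s → suc n + suc s ≡ suc (s + suc n)
      l = solve-∀

    skipS : ∀ {Q} → Exec (skipUnaryP rS) (σS 0 (suc off₁)) (just (σS s (suc off₂))) Q
    skipS = Unary.spec rS s off₁ σS
      (λ j j< → trans (cong₂ (λ y L → isOneᵇ (inputCell y (suc (j + L)))) x₁ (sym (length-unary n))) (unary-one (unary n) s (unary t ++ rest) j j<))
      (trans (cong₂ (λ y L → isOneᵇ (inputCell y (suc (s + L)))) x₁ (sym (length-unary n))) (unary-stop (unary n) s (unary t ++ rest)))
      (λ _ _ → refl)
      (λ c h h≤ → cong (λ h′ → st (con n 0 lg (2 ^ lg) (suc h) 0 (suc c) 0 0) (lev 0 0 0 0 0) chk₀ enu₀ wlk₀ tmp₀ h′ [] (lg + 5)) (right≡ h≤))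
      (λ c h h≤ → cong (λ h′ → st (con n 0 lg (2 ^ lg) (suc h) 0 c 0 0) (lev 0 0 0 0 0) chk₀ enu₀ wlk₀ tmp₀ h′ [] (lg + 5)) (right≡ h≤))
      (λ c h c< h≤ h≤₃ → big (≤-trans c< (≤-trans (m≤m+n s off₁) (≤-trans (n≤1+n _) (≤-trans (m≤n+m off₂ t) (≤-trans (n≤1+n _) (n≤1+n _)))))) , tt , big (s≤s h≤₃) , tt)
      (λ c h h≤ h≤₃ → tt , big (s≤s h≤₃) , tt)
      off₂≤ (≤-trans (m≤n+m off₂ t) (n≤1+n _))

    skipT : ∀ {Q} → Exec (skipUnaryP rT) (σT 0 (suc off₂)) (just (σT t (suc off₃))) Q
    skipT = Unary.spec rT t off₂ σT
      (λ j j< → trans (cong₂ (λ y L → isOneᵇ (inputCell y (suc (j + L)))) x₂ (sym len₂)) (unary-one (unary n ++ unary s) t rest j j<))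
      (trans (cong₂ (λ y L → isOneᵇ (inputCell y (suc (t + L)))) x₂ (sym len₂)) (unary-stop (unary n ++ unary s) t rest))
      (λ _ _ → refl)
      (λ c h h≤ → cong (λ h′ → st (con n 0 lg (2 ^ lg) (suc h) 0 s (suc c) 0) (lev 0 0 0 0 0) chk₀ enu₀ wlk₀ tmp₀ h′ [] (lg + 5)) (right≡ h≤))
      (λ c h h≤ → cong (λ h′ → st (con n 0 lg (2 ^ lg) (suc h) 0 s c 0) (lev 0 0 0 0 0) chk₀ enu₀ wlk₀ tmp₀ h′ [] (lg + 5)) (right≡ h≤))
      (λ c h c< h≤ h≤₃ → big (≤-trans c< (≤-trans (m≤m+n t off₂) (≤-trans (n≤1+n _) (n≤1+n _)))) , tt , big (s≤s h≤₃) , tt)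
      (λ c h h≤ h≤₃ → tt , big (s≤s h≤₃) , tt)
      off₃≤ ≤-refl

    rewind : ∀ {Q} → Exec (for rI rOff (‼ move left ∷ [])) (σT t (suc off₃))
      (just (st (con n 0 lg (2 ^ lg) (suc off₃) 0 s t 0) (lev 0 0 0 0 0) chk₀ enu₀ wlk₀ (record tmp₀ { tI = suc off₃ }) 0 [] (lg + 5))) Q
    rewind = becomes (cong (at (suc off₃)) (n∸n≡0 off₃))
      (for-exact rI rOff _ (λ j → at j (suc off₃ ∸ j)) (suc off₃) (λ j → refl , refl)
        (λ j j< → becomes (cong (at (suc j)) (pred[m∸n]≡m∸[1+n] (suc off₃) j)) (block _ (tt , tt) ▹ block _ (big j< , tt)))
        (≤-trans (s≤s off₃≤) x≤))
      where
      at : ℕ → ℕ → Mem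
      at i h = st (con n 0 lg (2 ^ lg) (suc off₃) 0 s t 0) (lev 0 0 0 0 0) chk₀ enu₀ wlk₀ (record tmp₀ { tI = i }) h [] (lg + 5)

    F : ℕ → ℕ → ℕ → Mem
    F i j w = st (con n (suc n) lg (2 ^ lg) (suc off₃) b s t 0) (lev 0 0 0 0 0) chk₀ enu₀ (record wlk₀ { wJ = j }) (record tmp₀ { tI = i }) 0 [] w

    six : ∀ k → k ≤ b → k < 2 ^ (lg + 5)
    six k k≤ = small {lg} (≤-trans k≤ (≤-trans b≤8 (*-monoʳ-≤ 8 (n<2^n lg))))
      where
      l : ∀ a → 8 * suc a ≡ suc (suc (suc (suc (a + a + a + a + a + a)))) + (2 * a + 4)
      l = solve-∀
      b≤8 : b ≤ 8 * suc lg
      b≤8 = ≤-trans (m≤m+n b (2 * lg + 4)) (≤-reflexive (sym (l lg)))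

    widthAt : ℕ → ℕ
    widthAt i = i * (3 + lg) + (lg + 5)

    wider : ∀ {w a} → lg + 5 ≤ w → a < 2 ^ (lg + 5) → a < 2 ^ w
    wider w≥ a< = <-≤-trans a< (^-monoʳ-≤ 2 w≥)

    widen : ∀ {Q} → Exec (for rI rB (‼ (grow ∷ grow ∷ grow ∷ []) ⨾ for rJ rLg (‼ grow ∷ []) ⨾ ‼ (clr rJ ∷ []))) (F 0 0 (lg + 5)) (just (F b 0 width′)) Q
    widen = for-exact rI rB _ (λ i → F i 0 (widthAt i)) b (λ i → refl , refl) step b≤
      where
      room : ∀ i → i < b → ∀ j → j ≤ lg → j + (3 + widthAt i) ≤ width′
      room i i<b j j≤ = ≤-trans (+-monoˡ-≤ (3 + widthAt i) j≤) (≤-trans (≤-reflexive (w≡ i)) (+-monoˡ-≤ (lg + 5) (*-monoˡ-≤ (3 + lg) i<b)))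
        where
        w≡ : ∀ i → lg + (3 + widthAt i) ≡ widthAt (suc i)
        w≡ i = l lg (i * (3 + lg)) (lg + 5)
          where
          l : ∀ a c e → a + (3 + (c + e)) ≡ 3 + a + c + e
          l = solve-∀
      w≥ : ∀ i → lg + 5 ≤ widthAt i
      w≥ i = m≤n+m (lg + 5) (i * (3 + lg))
      step : ∀ i → i < b → Exec _ (F i 0 (widthAt i)) (just (F (suc i) 0 (widthAt (suc i)))) (λ _ → ⊥)
      step i i<b =
        (block _ (≤-trans (m≤n+m _ 2) r3 , ≤-trans (n≤1+n _) r3 , r3 , tt) ▹
         for-exact rJ rLg _ (λ j → F i j (j + (3 + widthAt i))) lg (λ j → refl , refl)
           (λ j j< → block _ (room i i<b (suc j) j< , tt) ▹ block _ (wider (≤-trans (w≥ i) (w≤ (suc j))) (six (suc j) (≤-trans j< lg≤b)) , tt)) lg≤ ▹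
         block _ (tt , tt)) ▹
        becomes (cong (F (suc i) 0) (l lg (i * (3 + lg)) (lg + 5)))
          (block _ (wider (≤-trans (w≥ i) (w≤ lg)) (six (suc i) i<b) , tt))
        where
        r3 : 3 + widthAt i ≤ width′
        r3 = room i i<b 0 z≤n
        lg≤b : lg ≤ b
        lg≤b = ≤-trans (m≤n+m lg (lg + lg + lg + lg + lg)) (m≤n+m _ 4)
        w≤ : ∀ j → widthAt i ≤ j + (3 + widthAt i)
        w≤ j = ≤-trans (m≤n+m (widthAt i) 3) (m≤n+m _ j)
        l : ∀ a c e → a + (3 + (c + e)) ≡ 3 + a + c + e
        l = solve-∀

  setup-spec : ∀ {Q} → Exec setupP (mem (constant registerCount 0) 0 [] 0)
    (just (st (con n (suc n) lg (2 ^ lg) (suc off₃) b s t 0) (lev 1 0 0 0 ⌊ s ≡ᵇ t ⌋) chk₀ enu₀ wlk₀ tmp₀ 0 [] width′)) Q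
  setup-spec =
    block _ (g 1 (s≤s z≤n) , g 2 (s≤s (s≤s z≤n)) , g 3 (s≤s (s≤s (s≤s z≤n))) , g 4 (s≤s (s≤s (s≤s (s≤s z≤n)))) , g 5 ≤-refl ,
             s≤s (s≤s z≤n) , tt , s≤s (s≤s z≤n) , tt) ▹
    loopN ▹
    becomes (cong (λ h → st (con n 0 lg (2 ^ lg) (suc (suc n)) 0 0 0 0) (lev 0 0 0 0 0) chk₀ enu₀ wlk₀ tmp₀ h [] (lg + 5)) (right≡ off₁≤))
      (block _ (tt , big (s≤s (≤-trans (m≤n+m off₁ s) (≤-trans (n≤1+n _) (≤-trans (m≤n+m off₂ t) (n≤1+n _))))) , tt)) ▹
    skipS ▹ skipT ▹ rewind ▹
    block _ (tt , big (≤-trans n≤₁ off₁≤₃) , big off₁≤₃ ,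
      six lg (m≤n+m lg (4 + (lg + lg + lg + lg + lg))) , six₆ (lg + lg) (s₂ lg) , six₆ _ (s₃ lg) , six₆ _ (s₄ lg) , six₆ _ (s₅ lg) , six₆ _ (m≤n+m _ 4) ,
      six₆ _ (m≤n+m _ 3) , six₆ _ (m≤n+m _ 2) , six₆ _ (n≤1+n _) , six₆ _ ≤-refl , tt) ▹
    widen ▹
    block _ (tt , wider width≥ (big (s≤s z≤n)) , tt) ▹
    answer
    where
    g : ∀ k → k ≤ 5 → k ≤ width′
    g k k≤ = ≤-trans k≤ (≤-trans (m≤n+m 5 lg) width≥)
    n≤₁ : n ≤ off₁
    n≤₁ = n≤1+n n
    off₁≤₃ : off₁ ≤ suc off₃
    off₁≤₃ = ≤-trans (m≤n+m off₁ s) (≤-trans (n≤1+n _) (≤-trans (m≤n+m off₂ t) (≤-trans (n≤1+n _) (n≤1+n _))))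
    six₆ : ∀ k → k ≤ b → k < 2 ^ (lg + 5)
    six₆ = six
    s₅ : ∀ l → l + l + l + l + l ≤ bOf l
    s₅ l = ≤-trans (m≤m+n _ l) (m≤n+m _ 4)
    s₄ : ∀ l → l + l + l + l ≤ bOf l
    s₄ l = ≤-trans (m≤m+n _ l) (s₅ l)
    s₃ : ∀ l → l + l + l ≤ bOf l
    s₃ l = ≤-trans (m≤m+n _ l) (s₄ l)
    s₂ : ∀ l → l + l ≤ bOf l
    s₂ l = ≤-trans (m≤m+n _ l) (s₃ l)
    answer : ∀ {Q} → Exec (branch (eq rS rT) (‼ inc rAns ∷ []) skip)
      (st (con n (suc n) lg (2 ^ lg) (suc off₃) b s t 0) (lev 1 0 0 0 0) chk₀ enu₀ wlk₀ tmp₀ 0 [] width′)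
      (just (st (con n (suc n) lg (2 ^ lg) (suc off₃) b s t 0) (lev 1 0 0 0 ⌊ s ≡ᵇ t ⌋) chk₀ enu₀ wlk₀ tmp₀ 0 [] width′)) Q
    answer with s ≡ᵇ t in e
    ... | true  = then tt e (block _ (wider width≥ (big (s≤s z≤n)) , tt))
    ... | false = else tt e skip✓

-- Costs are polynomial

power-sum-≤ : ∀ {X a c} → 2 ≤ X → ∀ j k → a ≤ X ^ j → c ≤ X ^ k → a + c ≤ X ^ suc (j + k)
power-sum-≤ {X@(suc _)} {a} {c} 2≤X j k a≤ c≤ = ≤-trans
  (+-mono-≤ (≤-trans a≤ (^-monoʳ-≤ X (m≤m+n j k))) (≤-trans (≤-trans c≤ (^-monoʳ-≤ X (m≤n+m k j))) (m≤m+n _ 0)))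
  (*-monoˡ-≤ (X ^ (j + k)) 2≤X)

power-one : ∀ {X a} → a ≤ X → a ≤ X ^ 1
power-one {X} a≤ = ≤-trans a≤ (≤-reflexive (sym (*-identityʳ X)))

-- Because of 2 ≤ X, a sum of two powers of X is again bounded by a power of X, so a degree is
-- obtained by recursion on the program.
cost-≤ : ∀ p → ∃[ k ] (∀ {X N τ} → 2 ≤ X → N ≤ X → τ ≤ X → cost N τ p ≤ X ^ k)
cost-≤ skip = 0 , λ _ _ _ → z≤n
cost-≤ fail = 0 , λ _ _ _ → z≤n
cost-≤ (p ⨾ q) = let j , p≤ = cost-≤ p ; k , q≤ = cost-≤ q in
  suc (j + k) , λ 2≤X N≤ τ≤ → power-sum-≤ 2≤X j k (p≤ 2≤X N≤ τ≤) (q≤ 2≤X N≤ τ≤)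
cost-≤ (branch i p q) = let j , p≤ = cost-≤ p ; k , q≤ = cost-≤ q in
  suc (1 + suc (j + k)) , λ 2≤X N≤ τ≤ → power-sum-≤ 2≤X 1 (suc (j + k)) (power-one τ≤) (power-sum-≤ 2≤X j k (p≤ 2≤X N≤ τ≤) (q≤ 2≤X N≤ τ≤))
cost-≤ (while i p) = let k , p≤ = cost-≤ p in
  suc (suc (suc (1 + k)) + 1) , λ 2≤X N≤ τ≤ → power-sum-≤ 2≤X (suc (suc (1 + k))) 1 (*-mono-≤ N≤ (power-sum-≤ 2≤X 1 k (power-one τ≤) (p≤ 2≤X N≤ τ≤))) (power-one τ≤)
cost-≤ (choose p q) = let j , p≤ = cost-≤ p ; k , q≤ = cost-≤ q in
  suc (0 + suc (j + k)) , λ 2≤X N≤ τ≤ → power-sum-≤ 2≤X 0 (suc (j + k)) ≤-refl (power-sum-≤ 2≤X j k (p≤ 2≤X N≤ τ≤) (q≤ 2≤X N≤ τ≤))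

-- Numerical estimates

baseOf : ℕ → ℕ
baseOf l = 2 ^ bOf l

sixth : ℕ → ℕ
sixth a = a * a * a * a * a * a

-- Six separate factors allow lower powers to be compared with L⁶ after padding with ones.
sixth-mono : ∀ {a c e f g h L} → a ≤ L → c ≤ L → e ≤ L → f ≤ L → g ≤ L → h ≤ L → a * c * e * f * g * h ≤ sixth L
sixth-mono a c e f g h = *-mono-≤ (*-mono-≤ (*-mono-≤ (*-mono-≤ (*-mono-≤ a c) e) f) g) h

baseOf-≡ : ∀ l → baseOf l ≡ 16 * sixth (2 ^ l)
baseOf-≡ l = trans (^-distribˡ-+-* 2 4 (l + l + l + l + l + l)) (cong (16 *_) (d (l + l + l + l + l) (d (l + l + l + l) (d (l + l + l) (d (l + l) (d l refl))))))
  where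
  d : ∀ k {y} → 2 ^ k ≡ y → 2 ^ (k + l) ≡ y * 2 ^ l
  d k e = trans (^-distribˡ-+-* 2 k l) (cong (_* 2 ^ l) e)

module Estimates (n : ℕ) (n>0 : 0 < n) where

  l L q : ℕ
  l = lgOf n
  L = 2 ^ l
  q = sixth L

  base : ℕ
  base = baseOf l

  n≤L : n ≤ L
  n≤L = ≤-2^lgOf n

  1≤L : 1 ≤ L
  1≤L = m^n>0 2 l

  l≤L : l ≤ L
  l≤L = <⇒≤ (n<2^n l)

  1≤q : 1 ≤ q
  1≤q = sixth-mono 1≤L 1≤L 1≤L 1≤L 1≤L 1≤L

  L²≤q : L * L ≤ q
  L²≤q = ≤-trans (≤-reflexive (e L)) (sixth-mono {L} {L} {1} {1} {1} {1} ≤-refl ≤-refl 1≤L 1≤L 1≤L 1≤L)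
    where
    e : ∀ a → a * a ≡ a * a * 1 * 1 * 1 * 1
    e = solve-∀

  n≤q : n ≤ q
  n≤q = ≤-trans (≤-reflexive (e n)) (sixth-mono {n} {1} {1} {1} {1} {1} n≤L 1≤L 1≤L 1≤L 1≤L 1≤L)
    where
    e : ∀ a → a ≡ a * 1 * 1 * 1 * 1 * 1
    e = solve-∀

  n²≤q : n * n ≤ q
  n²≤q = ≤-trans (*-mono-≤ n≤L n≤L) L²≤q

  n⁶≤q : n * n * n * n * n * n ≤ q
  n⁶≤q = sixth-mono n≤L n≤L n≤L n≤L n≤L n≤L

  n⁵≤q : n * n * n * n * n ≤ q
  n⁵≤q = ≤-trans (≤-reflexive (sym (*-identityʳ _))) (sixth-mono n≤L n≤L n≤L n≤L n≤L 1≤L)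

  below-base : ∀ {a} k → a ≤ k * q → k ≤ 16 → a ≤ base
  below-base k a≤ k≤ = ≤-trans a≤ (≤-trans (*-monoˡ-≤ q k≤) (≤-reflexive (sym (baseOf-≡ l))))

  below-base-< : ∀ {a} k → a ≤ k * q → k < 16 → a < base
  below-base-< k a≤ k< = <-≤-trans (≤-<-trans a≤ (*-monoˡ-< q {{>-nonZero 1≤q}} k<)) (≤-reflexive (sym (baseOf-≡ l)))

  l≤base : l ≤ base
  l≤base = ≤-trans (m≤n+m l (4 + (l + l + l + l + l))) (<⇒≤ (n<2^n (bOf l)))

  b≤base : bOf l ≤ base
  b≤base = <⇒≤ (n<2^n (bOf l))

  bOf-≤ : bOf l ≤ 10 * L
  bOf-≤ = ≤-trans (≤-reflexive (e l)) (≤-trans (+-mono-≤ (*-monoʳ-≤ 4 1≤L) (*-monoʳ-≤ 6 l≤L)) (≤-reflexive (sym (*-distribʳ-+ L 4 6))))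
    where
    e : ∀ l → suc (suc (suc (suc (l + l + l + l + l + l)))) ≡ 4 * 1 + 6 * l
    e = solve-∀

  lb≤base : l * bOf l ≤ base
  lb≤base = below-base 10 (≤-trans (*-mono-≤ l≤L bOf-≤) (≤-trans (≤-reflexive (e L)) (*-monoʳ-≤ 10 L²≤q))) (m≤m+n 10 6)
    where
    e : ∀ L → L * (10 * L) ≡ 10 * (L * L)
    e = solve-∀

  2n<base : n + n < base
  2n<base = below-base-< 2 (≤-trans (+-mono-≤ n≤q n≤q) (≤-reflexive (e q))) (s≤s (s≤s (s≤s z≤n)))
    where
    e : ∀ q → q + q ≡ 2 * q
    e = solve-∀

  hashes : ℕ
  hashes = suc (suc (n * (n * (n * (n * (n + n + 1))))) + suc (n * (n * (n * (n * (n + n + 1))))))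

  private
    n⁴≤n⁵ : n * n * n * n * 1 ≤ n * n * n * n * n
    n⁴≤n⁵ = *-monoʳ-≤ (n * n * n * n) n>0
    1≤n⁵ : 1 * 1 * 1 * 1 * 1 ≤ n * n * n * n * n
    1≤n⁵ = *-mono-≤ (*-mono-≤ (*-mono-≤ (*-mono-≤ n>0 n>0) n>0) n>0) n>0

  hashes-≤ : hashes ≤ 9 * (n * n * n * n * n)
  hashes-≤ = ≤-trans (≤-reflexive (e₁ n)) (≤-trans (+-mono-≤ (+-monoʳ-≤ (4 * (n * n * n * n * n)) (*-monoʳ-≤ 2 n⁴≤n⁵)) (*-monoʳ-≤ 3 1≤n⁵)) (≤-reflexive (e₂ (n * n * n * n * n))))
    where
    e₁ : ∀ n → suc (suc (n * (n * (n * (n * (n + n + 1))))) + suc (n * (n * (n * (n * (n + n + 1)))))) ≡ 4 * (n * n * n * n * n) + 2 * (n * n * n * n * 1) + 3 * (1 * 1 * 1 * 1 * 1)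
    e₁ = solve-∀
    e₂ : ∀ a → 4 * a + 2 * a + 3 * a ≡ 9 * a
    e₂ = solve-∀

  hashes<base : hashes < base
  hashes<base = below-base-< 9 (≤-trans hashes-≤ (*-monoʳ-≤ 9 n⁵≤q)) (m≤m+n 10 6)

  n*hashes≤base : n * hashes ≤ base
  n*hashes≤base = below-base 9 (≤-trans (*-monoʳ-≤ n hashes-≤) (≤-trans (≤-reflexive (e n)) (*-monoʳ-≤ 9 n⁶≤q))) (m≤m+n 9 7)
    where
    e : ∀ n → n * (9 * (n * n * n * n * n)) ≡ 9 * (n * n * n * n * n * n)
    e = solve-∀

  input-≤ : ∀ {len} → len ≤ n * suc n + 3 * n + 1 → suc (len + suc n) ≤ base
  input-≤ len≤ = below-base-< 9 (≤-trans (+-monoˡ-≤ (suc n) len≤) (≤-trans (≤-reflexive (e₁ n)) (≤-trans (+-mono-≤ (+-mono-≤ n²≤q (*-monoʳ-≤ 5 n≤q)) (*-monoʳ-≤ 2 1≤q)) (≤-trans (≤-reflexive (e₂ q)) (*-monoˡ-≤ q (n≤1+n 8)))))) (m≤m+n 10 6)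
    where
    e₁ : ∀ n → n * suc n + 3 * n + 1 + suc n ≡ n * n + 5 * n + 2 * 1
    e₁ = solve-∀
    e₂ : ∀ q → q + 5 * q + 2 * q ≡ 8 * q
    e₂ = solve-∀

  base<cap : base < 2 ^ widthOf l
  base<cap = ^-monoʳ-< 2 (s≤s (s≤s z≤n)) (≤-trans (≤-reflexive (sym (+-comm (bOf l) 1))) (+-mono-≤ (m≤m*n (bOf l) (3 + l)) (≤-trans (s≤s z≤n) (m≤n+m 5 l))))

  -- The three factors are rounded up to 3L, 4L and 3P. Their constant 36 is covered by 64 = 4 · 16,
  -- that is, by four times the base, which costs `bOf l + 2` further bits.
  room : ∀ {K} → K ≤ l → suc (suc n) * (suc (suc (n + n)) * suc (2 * 2 ^ (K * bOf l))) < 2 ^ widthOf l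
  room {K} K≤ = begin-strict
    suc (suc n) * (suc (suc (n + n)) * suc (2 * 2 ^ (K * bOf l)))  ≤⟨ *-mono-≤ a≤ (*-mono-≤ c≤ d≤) ⟩
    3 * L * (4 * L * (3 * P))                                      ≡⟨ e L P ⟩
    36 * (L * L) * P                                               ≤⟨ *-monoˡ-≤ P (*-monoʳ-≤ 36 L²≤q) ⟩
    36 * q * P                                                     <⟨ *-monoˡ-< P {{>-nonZero P>0}} (*-monoˡ-< q {{>-nonZero 1≤q}} {36} {64} (m≤m+n 37 27)) ⟩
    64 * q * P                                                     ≡⟨ cong (_* P) (trans (*-assoc 4 16 q) (cong (4 *_) (sym (baseOf-≡ l)))) ⟩
    4 * base * P                                                   ≡⟨ *-assoc 4 base P ⟩
    2 ^ 2 * (2 ^ bOf l * 2 ^ (l * bOf l))                          ≡⟨ cong (4 *_) (sym (^-distribˡ-+-* 2 (bOf l) (l * bOf l))) ⟩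
    2 ^ 2 * 2 ^ (bOf l + l * bOf l)                                ≡⟨ sym (^-distribˡ-+-* 2 2 (bOf l + l * bOf l)) ⟩
    2 ^ (2 + (bOf l + l * bOf l))                                  ≤⟨ ^-monoʳ-≤ 2 (exponents (bOf l)) ⟩
    2 ^ widthOf l                                                  ∎
    where
    open ≤-Reasoning
    P = 2 ^ (l * bOf l)
    P>0 = m^n>0 2 (l * bOf l)
    a≤ : suc (suc n) ≤ 3 * L
    a≤ = +-mono-≤ 1≤L (+-mono-≤ 1≤L (≤-trans n≤L (m≤m+n L 0)))
    c≤ : suc (suc (n + n)) ≤ 4 * L
    c≤ = +-mono-≤ 1≤L (+-mono-≤ 1≤L (+-mono-≤ n≤L (≤-trans n≤L (m≤m+n L 0))))
    d≤ : suc (2 * 2 ^ (K * bOf l)) ≤ 3 * P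
    d≤ = +-mono-≤ P>0 (*-monoʳ-≤ 2 (^-monoʳ-≤ 2 (*-monoˡ-≤ (bOf l) K≤)))
    e : ∀ L P → 3 * L * (4 * L * (3 * P)) ≡ 36 * (L * L) * P
    e = solve-∀
    exponents : ∀ c → 2 + (c + l * c) ≤ c * (3 + l) + (l + 5)
    exponents c = ≤-trans (m≤m+n _ (2 * c + l + 3)) (≤-reflexive (eq′ c l))
      where
      eq′ : ∀ c l → 2 + (c + l * c) + (2 * c + l + 3) ≡ c * (3 + l) + (l + 5)
      eq′ = solve-∀

  opTime-≤ : opTimeFor (widthOf l) ≤ 96 * q
  opTime-≤ = begin
    2 * (bOf l * (3 + l) + (l + 5)) + 4       ≤⟨ +-monoˡ-≤ 4 (*-monoʳ-≤ 2 (+-mono-≤ (*-mono-≤ bOf-≤ 3+l≤) l+5≤)) ⟩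
    2 * (10 * L * (4 * L) + 6 * L) + 4 * 1    ≤⟨ +-mono-≤ (*-monoʳ-≤ 2 (+-mono-≤ (≤-trans (≤-reflexive (e₁ L)) (*-monoʳ-≤ 40 L²≤q)) (*-monoʳ-≤ 6 L≤q))) (*-monoʳ-≤ 4 1≤q) ⟩
    2 * (40 * q + 6 * q) + 4 * q              ≡⟨ e₂ q ⟩
    96 * q                                    ∎
    where
    open ≤-Reasoning
    3+l≤ : 3 + l ≤ 4 * L
    3+l≤ = +-mono-≤ 1≤L (+-mono-≤ 1≤L (+-mono-≤ 1≤L (≤-trans l≤L (m≤m+n L 0))))
    l+5≤ : l + 5 ≤ 6 * L
    l+5≤ = +-mono-≤ l≤L (≤-trans (≤-reflexive refl) (*-monoʳ-≤ 5 1≤L))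
    L≤q : L ≤ q
    L≤q = ≤-trans (m≤m*n L L {{>-nonZero 1≤L}}) L²≤q
    e₁ : ∀ L → 10 * L * (4 * L) ≡ 40 * (L * L)
    e₁ = solve-∀
    e₂ : ∀ q → 2 * (40 * q + 6 * q) + 4 * q ≡ 96 * q
    e₂ = solve-∀

  q-≤ : q ≤ 64 * n ^ 6
  q-≤ = ≤-trans (sixth-mono L≤ L≤ L≤ L≤ L≤ L≤) (≤-reflexive (e n))
    where
    L≤ : L ≤ 2 * n
    L≤ = go n n>0
      where
      go : ∀ n → 0 < n → 2 ^ lgOf n ≤ 2 * n
      go (suc k) _ = 2^lgOf-≤ k
    e : ∀ n → 2 * n * (2 * n) * (2 * n) * (2 * n) * (2 * n) * (2 * n) ≡ 64 * (n * (n * (n * (n * (n * (n * 1))))))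
    e = solve-∀

timeOf : Prog → ℕ → ℕ
timeOf p n = suc (cost (baseOf (lgOf n)) (opTimeFor (widthOf (lgOf n))) p)

time-polynomial : ∀ p → PolynomiallyBounded (timeOf p)
-- 96 q bounds both the number of iterations and the time of a sweep, and q ≤ 64 n⁶ because L ≤ 2n;
-- 6144 = 96 · 64, and the factor 2 absorbs the first step of the machine.
time-polynomial p = let k , bound = cost-≤ p in 6 * k , 2 * 6144 ^ k , 1 , λ n n>0 → estimate k bound n n>0
  where
  estimate : ∀ k → (∀ {X N τ} → 2 ≤ X → N ≤ X → τ ≤ X → cost N τ p ≤ X ^ k) → ∀ n → 1 ≤ n → timeOf p n ≤ 2 * 6144 ^ k * n ^ (6 * k)
  estimate k bound n n>0 = begin
    suc (cost base (opTimeFor (widthOf l)) p)   ≤⟨ s≤s (bound {96 * q} 2≤ base≤ opTime-≤) ⟩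
    suc ((96 * q) ^ k)                          ≤⟨ +-monoˡ-≤ _ (≤-trans (≤-reflexive (sym (^-zeroˡ k))) (^-monoˡ-≤ k (≤-trans (n≤1+n 1) 2≤))) ⟩
    (96 * q) ^ k + (96 * q) ^ k                 ≡⟨ cong ((96 * q) ^ k +_) (sym (+-identityʳ _)) ⟩
    2 * (96 * q) ^ k                            ≤⟨ *-monoʳ-≤ 2 (^-monoˡ-≤ k (≤-trans (*-monoʳ-≤ 96 q-≤) (≤-reflexive (sym (*-assoc 96 64 (n ^ 6)))))) ⟩
    2 * (6144 * n ^ 6) ^ k                      ≡⟨ cong (2 *_) (power-* 6144 (n ^ 6) k) ⟩
    2 * (6144 ^ k * (n ^ 6) ^ k)                ≡⟨ cong (λ a → 2 * (6144 ^ k * a)) (^-*-assoc n 6 k) ⟩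
    2 * (6144 ^ k * n ^ (6 * k))                ≡⟨ sym (*-assoc 2 (6144 ^ k) _) ⟩
    2 * 6144 ^ k * n ^ (6 * k)                  ∎
    where
    open ≤-Reasoning
    open Estimates n n>0
    2≤ : 2 ≤ 96 * q
    2≤ = ≤-trans (m≤m+n 2 94) (m≤m*n 96 q {{>-nonZero 1≤q}})
    base≤ : base ≤ 96 * q
    base≤ = ≤-trans (≤-reflexive (baseOf-≡ l)) (*-monoˡ-≤ q (m≤m+n 16 80))
    power-* : ∀ a c k → (a * c) ^ k ≡ a ^ k * c ^ k
    power-* a c zero    = refl
    power-* a c (suc k) = trans (cong (a * c *_) (power-* a c k)) (e a c (a ^ k) (c ^ k))
      where
      e : ∀ a c x y → a * c * (x * y) ≡ a * x * (c * y)
      e = solve-∀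

width-log² : (λ n → widthOf (lgOf n) + 3) ∈O log²
-- From n = 2 on the logarithm a is at least 1, so l ≤ 1 + a ≤ 2a, and constants can be absorbed:
-- the sum is 80 a² + 10 a.
width-log² = 90 , 2 , λ n 2≤n → estimate n ⌈log₂ n ⌉ (lg≤ n 2≤n) (⌈log₂⌉-mono-≤ 2≤n)
  where
  lg≤ : ∀ n → 2 ≤ n → lgOf n ≤ 1 + ⌈log₂ n ⌉
  lg≤ n@(suc k) _ = ≤-trans (≤-reflexive (sym (⌈log₂2^n⌉≡n (lgOf n)))) (≤-trans (⌈log₂⌉-mono-≤ (2^lgOf-≤ k)) (≤-reflexive (⌈log₂2*n⌉≡1+⌈log₂n⌉ n)))
  estimate : ∀ n a → lgOf n ≤ 1 + a → 1 ≤ a → widthOf (lgOf n) + 3 ≤ 90 * a ^ 2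
  estimate n a l≤ a≥1 = begin
    bOf l * (3 + l) + (l + 5) + 3                      ≤⟨ +-monoˡ-≤ 3 (+-mono-≤ (*-mono-≤ bOf≤ (+-monoʳ-≤ 3 l≤2a)) (+-monoˡ-≤ 5 l≤2a)) ⟩
    (16 * a) * (3 + 2 * a) + (2 * a + 5) + 3           ≤⟨ +-mono-≤ (+-mono-≤ (*-monoʳ-≤ (16 * a) (+-monoˡ-≤ (2 * a) (*-monoʳ-≤ 3 a≥1))) (+-monoʳ-≤ (2 * a) (*-monoʳ-≤ 5 a≥1))) (*-monoʳ-≤ 3 a≥1) ⟩
    (16 * a) * (3 * a + 2 * a) + (2 * a + 5 * a) + 3 * a ≡⟨ e₁ a ⟩
    80 * (a * (a * 1)) + 10 * (a * 1)                  ≤⟨ +-monoʳ-≤ (80 * (a * (a * 1))) (*-monoʳ-≤ 10 (*-monoʳ-≤ a (≤-trans a≥1 (≤-reflexive (sym (*-identityʳ a)))))) ⟩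
    80 * (a * (a * 1)) + 10 * (a * (a * 1))            ≡⟨ sym (*-distribʳ-+ (a * (a * 1)) 80 10) ⟩
    90 * (a * (a * 1))                                 ∎
    where
    open ≤-Reasoning
    l = lgOf n
    l≤2a : l ≤ 2 * a
    l≤2a = ≤-trans l≤ (≤-trans (+-monoˡ-≤ a a≥1) (≤-reflexive (cong (a +_) (sym (+-identityʳ a)))))
    bOf≤ : bOf l ≤ 16 * a
    bOf≤ = ≤-trans (≤-reflexive (e₀ l)) (≤-trans (+-mono-≤ (*-monoʳ-≤ 4 a≥1) (*-monoʳ-≤ 6 l≤2a)) (≤-reflexive (e₂ a)))
      where
      e₀ : ∀ l → suc (suc (suc (suc (l + l + l + l + l + l)))) ≡ 4 * 1 + 6 * l
      e₀ = solve-∀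
      e₂ : ∀ a → 4 * a + 6 * (2 * a) ≡ 16 * a
      e₂ = solve-∀
    e₁ : ∀ a → (16 * a) * (3 * a + 2 * a) + (2 * a + 5 * a) + 3 * a ≡ 80 * (a * (a * 1)) + 10 * (a * 1)
    e₁ = solve-∀

-- Graphs, paths and the encodings of input and output

tabulate-split : ∀ {A : Set} {k} (f : Fin k → A) (i : Fin k) →
                 ∃[ pre ] ∃[ post ] (tabulate f ≡ pre ++ f i ∷ post × length pre ≡ toℕ i)
tabulate-split f zero    = [] , _ , refl , refl
tabulate-split f (suc i) = let pre , post , e , l = tabulate-split (f ∘ suc) i in f zero ∷ pre , post , cong (f zero ∷_) e , cong suc l

length-concatMap : ∀ {A B : Set} (g : A → List B) {c} → (∀ a → length (g a) ≡ c) → ∀ xs → length (concatMap g xs) ≡ length xs * c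
length-concatMap g e []       = refl
length-concatMap g e (x ∷ xs) = trans (List.length-++ (g x)) (cong₂ _+_ (e x) (length-concatMap g e xs))

-- The program appends at the end, whereas `concatMap` recurses from the front; `catTo` follows the
-- program.
catTo : ∀ {A : Set} → (ℕ → List A) → ℕ → List A
catTo h zero    = []
catTo h (suc k) = catTo h k ++ h k

catTo-suc : ∀ {A : Set} (h : ℕ → List A) k → catTo h (suc k) ≡ h 0 ++ catTo (h ∘ suc) k
catTo-suc h zero    = sym (List.++-identityʳ (h 0))
catTo-suc h (suc k) = trans (cong (_++ h (suc k)) (catTo-suc h k)) (List.++-assoc (h 0) (catTo (h ∘ suc) k) (h (suc k)))

concatMap-tabulate : ∀ {A B : Set} {k} (f : Fin k → A) (g : A → List B) (h : ℕ → List B) →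
                     (∀ i → g (f i) ≡ h (toℕ i)) → concatMap g (tabulate f) ≡ catTo h k
concatMap-tabulate {k = zero}  f g h e = refl
concatMap-tabulate {k = suc k} f g h e =
  trans (cong₂ _++_ (e zero) (concatMap-tabulate (f ∘ suc) g (h ∘ suc) (e ∘ suc))) (sym (catTo-suc h k))

concatMap-mapMaybe : ∀ {A B C : Set} (f : B → List C) (g : A → Maybe B) xs →
                     concatMap f (mapMaybe g xs) ≡ concatMap (λ a → Maybe.maybe f [] (g a)) xs
concatMap-mapMaybe f g [] = refl
concatMap-mapMaybe f g (x ∷ xs) with g x
... | just b  = cong (f b ++_) (concatMap-mapMaybe f g xs)
... | nothing = concatMap-mapMaybe f g xs

concatMap-cartesianProduct : ∀ {A B C : Set} (f : A × B → List C) xs ys →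
  concatMap f (cartesianProduct xs ys) ≡ concatMap (λ a → concatMap (λ b → f (a , b)) ys) xs
concatMap-cartesianProduct f []       ys = refl
concatMap-cartesianProduct f (x ∷ xs) ys = trans (List.concatMap-++ f (map (x ,_) ys) (cartesianProduct xs ys))
  (cong₂ _++_ (List.concatMap-map f (x ,_) ys) (concatMap-cartesianProduct f xs ys))

digit : Bool → Bit
digit b = if b then 1b else 0b

fromDigits-bits : ∀ bs → fromDigits {2} (map digit bs) ≡ val bs
fromDigits-bits []           = refl
fromDigits-bits (true  ∷ bs) = cong suc (trans (*-comm (fromDigits {2} (map digit bs)) 2) (cong (2 *_) (fromDigits-bits bs)))
fromDigits-bits (false ∷ bs) = trans (*-comm (fromDigits {2} (map digit bs)) 2) (cong (2 *_) (fromDigits-bits bs))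

wsum-cong : ∀ {w w′ : ℕ → ℕ} → (∀ v → w v ≡ w′ v) → ∀ xs → wsum w xs ≡ wsum w′ xs
wsum-cong e []       = refl
wsum-cong e (x ∷ xs) = cong₂ _+_ (e x) (wsum-cong e xs)

module Graph {n : ℕ} (G : Digraph n) where

  -- The search works on natural numbers, as held in registers; numbers out of range have no edges.
  adjacent : ℕ → ℕ → Bool
  adjacent u v with u <? n | v <? n
  ... | yes u<n | yes v<n = G (fromℕ< u<n) (fromℕ< v<n)
  ... | yes _   | no _    = false
  ... | no _    | _       = false

  adjacent-≡ : ∀ u v → adjacent (toℕ u) (toℕ v) ≡ G u v
  adjacent-≡ u v with toℕ u <? n | toℕ v <? n
  ... | yes u<n | yes v<n = cong₂ G (fromℕ<-toℕ u u<n) (fromℕ<-toℕ v v<n)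
  ... | yes _   | no v≮n  = contradiction (toℕ<n v) v≮n
  ... | no u≮n  | _       = contradiction (toℕ<n u) u≮n

  adjacent-< : ∀ {u v} → adjacent u v ≡ true → v < n
  adjacent-< {u} {v} e with u <? n | v <? n
  ... | yes _ | yes v<n = v<n

  open Walks n adjacent adjacent-<

  T⇒≡ : ∀ {b} → T b → b ≡ true
  T⇒≡ {true} _ = refl

  ≡⇒T : ∀ {b} → b ≡ true → T b
  ≡⇒T refl = tt

  vertices : ∀ {u v} → Path G u v → List ℕ
  vertices ε               = []
  vertices (_◅_ {j = x} e p) = toℕ x ∷ vertices p

  path⇒walk : ∀ {u v} (p : Path G u v) → Walk (toℕ u) (vertices p) (toℕ v)
  path⇒walk ε                       = []
  path⇒walk (_◅_ {i = u} {j = x} e p) = trans (adjacent-≡ u x) (T⇒≡ e) ∷ path⇒walk p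

  walk⇒path : ∀ {u xs v a c} → Walk a xs c → a ≡ toℕ u → c ≡ toℕ v → Σ[ p ∈ Path G u v ] (vertices p ≡ xs)
  walk⇒path {u} {_} {v} [] a≡ c≡ with refl ← toℕ-injective (trans (sym a≡) c≡) = ε , refl
  walk⇒path {u} {x ∷ xs} {v} (e ∷ w) refl c≡ =
    let x<n = adjacent-< e
        x≡  = toℕ-fromℕ< x<n
        p , vs = walk⇒path {fromℕ< x<n} w (sym x≡) c≡
        edge = ≡⇒T (trans (sym (adjacent-≡ u (fromℕ< x<n))) (trans (cong (adjacent (toℕ u)) x≡) e))
    in edge ◅ p , cong₂ _∷_ x≡ vs

  -- There are no parallel edges, as proofs of `T` are irrelevant.
  vertices-injective : ∀ {u v} (p q : Path G u v) → vertices p ≡ vertices q → p ≡ q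
  vertices-injective ε ε _ = refl
  vertices-injective ε (_ ◅ _) ()
  vertices-injective (_ ◅ _) ε ()
  vertices-injective {u} (_◅_ {j = x} e p) (_◅_ {j = y} e′ q) vs
    with refl ← toℕ-injective {i = x} {y} (List.∷-injectiveˡ vs) =
    cong₂ _◅_ (T-irrelevant {G u x} e e′) (vertices-injective p q (List.∷-injectiveʳ vs))

  targetWeight : (w : ℕ → ℕ) → (∀ v → 0 < w v) → WeightFunction G
  targetWeight w w>0 = record { weight = λ {u} {v} _ → w (toℕ v) ; positive = λ {u} {v} _ → w>0 (toℕ v) }

  pathWeight-≡ : ∀ w w>0 {u v} (p : Path G u v) → pathWeight (targetWeight w w>0) p ≡ wsum w (vertices p)
  pathWeight-≡ w w>0 ε                 = refl
  pathWeight-≡ w w>0 (_◅_ {j = x} e p) = cong (w (toℕ x) +_) (pathWeight-≡ w w>0 p)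

  -- A minimum path is also shortest, so it has fewer than n edges and falls under uniqueness up to
  -- R.
  minUnique : ∀ {w w′ R} w>0 → (∀ v → w v ≡ w′ v) → LengthFirst w′ → UniqueUpTo w′ R → n ≤ R → MinUnique G (targetWeight w w>0)
  minUnique {w} {w′} {R} w>0 w≡ lf uniq n≤R {u} {v} p q mp mq =
    vertices-injective p q (uniq (toℕ u) (toℕ v) (vertices p) (vertices q) (toℕ<n u) (min p mp) (min q mq) short)
    where
    min : ∀ (p : Path G u v) → IsMinimum (targetWeight w w>0) p → Min w′ (toℕ u) (vertices p) (toℕ v)
    min p mp = path⇒walk p , λ ys wk → let r , vs = walk⇒path {u} {ys} {v} wk refl refl in
      subst₂ _≤_ (trans (pathWeight-≡ w w>0 p) (wsum-cong w≡ (vertices p)))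
                 (trans (pathWeight-≡ w w>0 r) (trans (cong (wsum w) vs) (wsum-cong w≡ ys))) (mp r)
    short : length (vertices p) ≤ R
    short = let ys , wk , l , _ = shorten (toℕ<n u) (path⇒walk p) in
      ≤-trans (shortest-≤ (lf (toℕ<n u) (min p mp)) wk) (≤-trans (<⇒≤ l) n≤R)

  rowLetters : Fin n → List Letter
  rowLetters u = map (λ v → boolLetter (G u v)) (allFin n) ++ [ sep ]

  matrix : List Letter
  matrix = concatMap rowLetters (allFin n)

  length-row : ∀ u → length (rowLetters u) ≡ suc n
  length-row u = trans (List.length-++ (map _ (allFin n))) (trans (cong (_+ 1) (trans (List.length-map _ (allFin n)) (List.length-tabulate {n = n} (id {A = Fin n})))) (+-comm n 1))

  length-matrix : length matrix ≡ n * suc n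
  length-matrix = trans (length-concatMap rowLetters length-row (allFin n)) (cong (_* suc n) (List.length-tabulate {n = n} (id {A = Fin n})))

  matrix-split : ∀ u v → ∃[ pre ] ∃[ post ] (matrix ≡ pre ++ boolLetter (G u v) ∷ post × length pre ≡ toℕ v + toℕ u * suc n)
  matrix-split u v =
    let us , us′ , eu , lu = tabulate-split id u
        vs , vs′ , ev , lv = tabulate-split id v
        f = λ v → boolLetter (G u v)
    in concatMap rowLetters us ++ map f vs , (map f vs′ ++ [ sep ]) ++ concatMap rowLetters us′ ,
      (begin
        concatMap rowLetters (allFin n)                                                 ≡⟨ cong (concatMap rowLetters) eu ⟩
        concatMap rowLetters (us ++ u ∷ us′)                                            ≡⟨ List.concatMap-++ rowLetters us (u ∷ us′) ⟩
        concatMap rowLetters us ++ rowLetters u ++ concatMap rowLetters us′             ≡⟨ cong (λ l → concatMap rowLetters us ++ (l ++ [ sep ]) ++ concatMap rowLetters us′)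
                                                                                             (trans (cong (map f) ev) (List.map-++ f vs (v ∷ vs′))) ⟩
        concatMap rowLetters us ++ ((map f vs ++ f v ∷ map f vs′) ++ [ sep ]) ++ concatMap rowLetters us′
                                                                                        ≡⟨ cong (λ l → concatMap rowLetters us ++ l ++ concatMap rowLetters us′) (List.++-assoc (map f vs) (f v ∷ map f vs′) [ sep ]) ⟩
        concatMap rowLetters us ++ (map f vs ++ f v ∷ map f vs′ ++ [ sep ]) ++ concatMap rowLetters us′
                                                                                        ≡⟨ cong (concatMap rowLetters us ++_) (List.++-assoc (map f vs) (f v ∷ map f vs′ ++ [ sep ]) (concatMap rowLetters us′)) ⟩
        concatMap rowLetters us ++ map f vs ++ f v ∷ (map f vs′ ++ [ sep ]) ++ concatMap rowLetters us′
                                                                                        ≡⟨ sym (List.++-assoc (concatMap rowLetters us) (map f vs) _) ⟩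
        (concatMap rowLetters us ++ map f vs) ++ f v ∷ (map f vs′ ++ [ sep ]) ++ concatMap rowLetters us′ ∎) ,
      trans (List.length-++ (concatMap rowLetters us)) (trans (cong₂ _+_ (trans (length-concatMap rowLetters length-row us) (cong (_* suc n) lu)) (trans (List.length-map f vs) lv)) (+-comm (toℕ u * suc n) (toℕ v)))
    where open ≡-Reasoning

-- The machine on a given graph

module Main {n : ℕ} (G : Digraph n) (s′ t′ : Fin n) where

  open Graph G

  s t : ℕ
  s = toℕ s′
  t = toℕ t′
  s<n : s < n
  s<n = toℕ<n s′
  t<n : t < n
  t<n = toℕ<n t′

  open Estimates n (≤-<-trans z≤n s<n) hiding (hashes)

  x : List Letter
  x = encodeInput G s′ t′

  open Walks n adjacent adjacent-<

  off₃ : ℕ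
  off₃ = suc (t + suc (s + suc n))

  prefix : List Letter
  prefix = unary n ++ unary s ++ unary t

  x≡ : x ≡ prefix ++ matrix
  x≡ = sym (trans (List.++-assoc (unary n) (unary s ++ unary t) matrix) (cong (unary n ++_) (List.++-assoc (unary s) (unary t) matrix)))

  length-prefix : length prefix ≡ off₃
  length-prefix = trans (List.length-++ (unary n)) (trans (cong₂ _+_ (length-unary n) (trans (List.length-++ (unary s)) (cong₂ _+_ (length-unary s) (length-unary t)))) (e n s t))
    where
    e : ∀ n s t → suc n + (suc s + suc t) ≡ suc (t + suc (s + suc n))
    e = solve-∀

  length-x : length x ≤ n * suc n + 3 * n + 1
  length-x = ≤-trans (≤-reflexive (trans (cong length x≡) (trans (List.length-++ prefix) (cong₂ _+_ length-prefix length-matrix))))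
    (≤-trans (≤-reflexive (e₁ t s n)) (≤-trans (+-monoˡ-≤ (n + 1 + n * suc n) (+-mono-≤ t<n s<n)) (≤-reflexive (e₂ n))))
    where
    e₁ : ∀ t s n → suc (t + suc (s + suc n)) + n * suc n ≡ suc t + suc s + (n + 1 + n * suc n)
    e₁ = solve-∀
    e₂ : ∀ n → n + n + (n + 1 + n * suc n) ≡ n * suc n + 3 * n + 1
    e₂ = solve-∀

  x+n< : suc (length x + suc n) ≤ base
  x+n< = input-≤ length-x

  position : ∀ u v → ∃[ pre ] ∃[ post ] (x ≡ pre ++ boolLetter (G u v) ∷ post × suc (length pre) ≡ suc off₃ + toℕ v + toℕ u * suc n)
  position u v = let pre , post , e , len = matrix-split u v in
    prefix ++ pre , post , trans x≡ (trans (cong (prefix ++_) e) (sym (List.++-assoc prefix pre _))) ,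
    trans (cong suc (trans (List.length-++ prefix) (cong₂ _+_ length-prefix len))) (cong suc (sym (+-assoc off₃ (toℕ v) _)))

  cellF : ∀ u v → inputCell x (suc off₃ + toℕ v + toℕ u * suc n) ≡ letter (boolLetter (adjacent (toℕ u) (toℕ v)))
  cellF u v = let pre , post , e , len = position u v in
    trans (cong₂ inputCell e (sym len)) (trans (cell-at pre _ post) (cong (letter ∘ boolLetter) (sym (adjacent-≡ u v))))

  cell : ∀ {u v} → u < n → v < n → inputCell x (suc off₃ + v + u * suc n) ≡ letter (boolLetter (adjacent u v))
  cell {u} {v} u<n v<n = subst₂ (λ u v → inputCell x (suc off₃ + v + u * suc n) ≡ letter (boolLetter (adjacent u v)))
    (toℕ-fromℕ< u<n) (toℕ-fromℕ< v<n) (cellF (fromℕ< u<n) (fromℕ< v<n))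

  cell-≤ : ∀ {u v} → u < n → v < n → suc off₃ + v + u * suc n ≤ length x
  cell-≤ {u} {v} u<n v<n = subst₂ (λ u v → suc off₃ + v + u * suc n ≤ length x) (toℕ-fromℕ< u<n) (toℕ-fromℕ< v<n)
    (let pre , post , e , len = position (fromℕ< u<n) (fromℕ< v<n) in
     ≤-trans (≤-reflexive (sym len)) (≤-trans (≤-trans (s≤s (m≤m+n (length pre) (length post))) (≤-reflexive (sym (+-suc (length pre) (length post))))) (≤-reflexive (sym (trans (cong length e) (List.length-++ pre))))))

  wd : ℕ
  wd = widthOf l

  setting : Setting
  setting = record
    { x = x ; mw = wd ; iterations = base ; n = n ; lg = l ; pw = 2 ^ l ; off = suc off₃ ; b = bOf l ; s = s ; t = t ; wd = wd
    ; adj = adjacent ; adj-< = adjacent-< }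

  open Logic x wd base
  open Subroutines setting
  open Weights base refl
  open Driver setting base refl

  x≤base : suc (length x) ≤ base
  x≤base = ≤-trans (s≤s (m≤m+n (length x) (suc n))) x+n<

  edge-run : EdgeRuns
  edge-run u v u<n v<n = Edges.edge-spec cell cell-≤ (<-trans x+n< base<cap) (<⇒≤ x≤base) (<⇒≤ (≤-<-trans (m≤m+n n n) 2n<base)) u v u<n v<n

  bounds : Bounds
  bounds = record
    { edge-run = edge-run ; s<n = s<n ; t<n = t<n ; n≤pw = n≤L ; room = room ; hash-room = n*hashes≤base ; hashBound< = hashes<base
    ; base≤ = ≤-refl ; lgb≤ = lb≤base ; lg≤ = l≤base ; b≤ = b≤base ; 2n< = 2n<base }

  open Phases bounds
  open Good

  good₀ : Good [] (λ _ → 1) 1 ⌊ s ≡ᵇ t ⌋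
  good₀ = record
    { hashes      = []
    ; levels≤     = z≤n
    ; weights     = λ _ → refl
    ; lengthFirst = λ _ mn → mn
    ; uniq        = unique₁
    ; radius      = refl
    ; ansOK       = sound-ans , λ { e → cong ⌊_⌋ (subst (λ t → (s ≡ᵇ t) ≡ true) e (≡ᵇ-refl s)) }
    ; ansComplete = λ ()
    }
    where
    sound-ans : ⌊ s ≡ᵇ t ⌋ ≡ 0 ⊎ (⌊ s ≡ᵇ t ⌋ ≡ 1 × Reach)
    sound-ans with s ≡ᵇ t in e
    ... | false = inj₁ refl
    ... | true  = inj₂ (refl , [] , subst (Walk s []) (≡ᵇ⇒≡ s t (subst T (sym e) _)) [])

  start : Mem
  start = mem (constant registerCount 0) 0 [] 0

  setup-run : ∀ {Q} → Exec setupP start (just (Lvl [] [] 1 0 ⌊ s ≡ᵇ t ⌋)) Q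
  setup-run = Setup.setup-spec x base n s t s<n t<n matrix refl l≤base b≤base x≤base

  Result : Set₁
  Result = ∃[ hs ] ∃[ w ] ∃[ R ] ∃[ ans ] Σ[ τ ∈ Mem ] (Exec mainP start (just τ) (λ _ → ⊥)
      × out τ ≡ rowsTo (weightFrom 1 hs) n ++ [ boolLetter (boolOf ans) ] × n ≤ R × Good hs w R ans)

  main-spec : Result
  main-spec = levels (levels-spec good₀)
    where
    levels : Ends levelsP (Lvl [] [] 1 0 ⌊ s ≡ᵇ t ⌋) (Finished []) → Result
    levels (_ , ρ , hs , w , R , ok , ans , refl , n≤R , g) =
      let τ , ρ′ , o≡ = output-spec {hs} {w} {R} {ok} {ans} {[]} g in
      hs , w , R , ans , τ , (setup-run ▹ ρ ▹ ρ′) , o≡ , n≤R , g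

  module Conclusion {hs : List ℕ} {w : ℕ → ℕ} {R ans : ℕ} (n≤R : n ≤ R) (good : Good hs w R ans) where

    weights>0 : ∀ v → 0 < weightFrom 1 hs v
    weights>0 v = go 1 hs (s≤s z≤n)
      where
      go : ∀ a hs → 0 < a → 0 < weightFrom a hs v
      go a []       a>0 = a>0
      go a (m ∷ hs) a>0 = go (a * base + hash m v) hs (<-≤-trans (*-mono-≤ a>0 (m^n>0 2 (bOf l))) (m≤m+n (a * base) (hash m v)))

    W : WeightFunction G
    W = targetWeight (weightFrom 1 hs) weights>0

    numeral : ∃₂ (Edge G) → List Bit
    numeral (u , v , e) = map digit (toBits wd (weightFrom 1 hs (toℕ v)))

    weight<cap : ∀ v → weightFrom 1 hs v < 2 ^ wd
    weight<cap v = <-trans (Level.weight≤ hs (hashes good) (levels≤ good) v) (Level.double-room hs (hashes good) (levels≤ good))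

    numeral-≡ : ∀ {u v} (e : Edge G u v) → fromDigits {2} (numeral (u , v , e)) ≡ weight W e
    numeral-≡ {u} {v} e = trans (fromDigits-bits (toBits wd (weightFrom 1 hs (toℕ v)))) (val-toBits wd (weightFrom 1 hs (toℕ v)) (weight<cap (toℕ v)))

    letters : ∃₂ (Edge G) → List Letter
    letters e = map bit (numeral e) ++ [ sep ]

    rows-≡ : rowsTo (weightFrom 1 hs) n ≡ concatMap letters (edges G)
    rows-≡ = sym (begin
      concatMap letters (edges G)
        ≡⟨ concatMap-mapMaybe letters _ (cartesianProduct (allFin n) (allFin n)) ⟩
      concatMap _ (cartesianProduct (allFin n) (allFin n))
        ≡⟨ List.concatMap-cong (λ { (u , v) → entry-≡ u v (T? (G u v)) }) (cartesianProduct (allFin n) (allFin n)) ⟩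
      concatMap (λ { (u , v) → item w′ (toℕ u) (toℕ v) }) (cartesianProduct (allFin n) (allFin n))
        ≡⟨ concatMap-cartesianProduct _ (allFin n) (allFin n) ⟩
      concatMap (λ u → concatMap (λ v → item w′ (toℕ u) (toℕ v)) (allFin n)) (allFin n)
        ≡⟨ concatMap-tabulate {k = n} id _ (λ u → rowTo w′ u n) (λ u → trans (concatMap-tabulate {k = n} id _ (item w′ (toℕ u)) (λ _ → refl)) (catTo-row (toℕ u) n)) ⟩
      catTo (λ u → rowTo w′ u n) n
        ≡⟨ catTo-rows n ⟩
      rowsTo w′ n ∎)
      where
      open ≡-Reasoning
      w′ = weightFrom 1 hs
      catTo-row : ∀ u k → catTo (item w′ u) k ≡ rowTo w′ u k
      catTo-row u zero    = refl
      catTo-row u (suc k) = cong (_++ item w′ u k) (catTo-row u k)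
      catTo-rows : ∀ k → catTo (λ u → rowTo w′ u n) k ≡ rowsTo w′ k
      catTo-rows zero    = refl
      catTo-rows (suc k) = cong (_++ rowTo w′ k n) (catTo-rows k)
      entry-≡ : ∀ u v (d : Dec (T (G u v))) →
        Maybe.maybe letters [] (Maybe.map (λ e → u , v , e) (dec⇒maybe d)) ≡ item w′ (toℕ u) (toℕ v)
      entry-≡ u v (yes e) = trans (cong (_++ [ sep ]) (sym (List.map-∘ (toBits wd (w′ (toℕ v))))))
        (cong (λ b → if b then map boolLetter (toBits wd (w′ (toℕ v))) ++ [ sep ] else []) (sym (trans (adjacent-≡ u v) (T⇒≡ e))))
      entry-≡ u v (no ¬e) = cong (λ b → if b then map boolLetter (toBits wd (w′ (toℕ v))) ++ [ sep ] else []) (sym (trans (adjacent-≡ u v) (¬T⇒≡ ¬e)))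
        where
        ¬T⇒≡ : ∀ {b} → ¬ T b → b ≡ false
        ¬T⇒≡ {true}  ¬t = contradiction tt ¬t
        ¬T⇒≡ {false} _  = refl

    bits-W : wd -bit W
    bits-W {u} {v} e = numeral (u , v , e) , trans (List.length-map digit (toBits wd (weightFrom 1 hs (toℕ v)))) (length-toBits wd (weightFrom 1 hs (toℕ v))) , numeral-≡ e

    W-minUnique : MinUnique G W
    W-minUnique = minUnique weights>0 (weights good) (lengthFirst good) (uniq good) n≤R

    reach⇔ : T (boolOf ans) ⇔ Path G s′ t′
    reach⇔ = mk⇔ (to (proj₁ (ansOK good))) (λ p → from p)
      where
      to : ans ≡ 0 ⊎ (ans ≡ 1 × Reach) → T (boolOf ans) → Path G s′ t′
      to (inj₁ e) b = ⊥-elim (subst (T ∘ boolOf) e b)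
      to (inj₂ (_ , zs , p)) _ = proj₁ (walk⇒path {s′} {zs} {t′} p refl refl)
      ans≡1 : Path G s′ t′ → ans ≡ 1
      ans≡1 p = decide (t ≟ s)
        where
        -- If no round took place, the radius is 1, so n ≤ 1 and the two vertices coincide.
        levels>0 : t ≢ s → 0 < length hs
        levels>0 t≢s = go (length hs) refl
          where
          go : ∀ k → length hs ≡ k → 0 < length hs
          go (suc k) e = subst (0 <_) (sym e) (s≤s z≤n)
          go zero e = contradiction (trans (small t<n) (sym (small s<n))) t≢s
            where
            small : ∀ {a} → a < n → a ≡ 0
            small a<n = n<1⇒n≡0 (<-≤-trans a<n (≤-trans n≤R (≤-reflexive (trans (radius good) (cong (2 ^_) e)))))
        decide : Dec (t ≡ s) → ans ≡ 1
        decide (yes t≡s) = proj₂ (ansOK good) (sym t≡s)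
        decide (no t≢s)  = ansComplete good (levels>0 t≢s) t≢s
          (let zs , q , len , _ = shorten s<n (path⇒walk p) in zs , q , ≤-trans (<⇒≤ len) n≤R)
      from : Path G s′ t′ → T (boolOf ans)
      from p = subst (T ∘ boolOf) (sym (ans≡1 p)) tt

  open Soundness mainP x wd base using (correct)

  Claim : Set
  Claim = RunsWithin (compile mainP) x (timeOf mainP n) (wd + 3)
    × (Σ[ p ∈ AcceptingPath (compile mainP) x ]
         (∀ (p′ : AcceptingPath (compile mainP) x) → p′ ≡ p)
         × (Σ[ W ∈ WeightFunction G ] Σ[ reachable ∈ Bool ]
              EncodesOutput (result (compile mainP) x p) W reachable
              × wd -bit W
              × MinUnique G W
              × (T reachable ⇔ Path G s′ t′)))

  theorem : Claim
  theorem = conclude main-spec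
    where
    conclude : Result → Claim
    conclude (_ , _ , _ , ans , _ , runs , out≡ , n≤R , good) =
      let within , p , unique , o≡ = correct runs
          open Conclusion n≤R good
      in within , p , unique , W , boolOf ans ,
         (numeral , numeral-≡ , trans o≡ (trans out≡ (cong (_++ [ boolLetter (boolOf ans) ]) rows-≡))) ,
         bits-W , W-minUnique , reach⇔

theorem3 :
  Σ[ M ∈ Machine ]
  Σ[ time ∈ (ℕ → ℕ) ] Σ[ memory ∈ (ℕ → ℕ) ] Σ[ bits ∈ (ℕ → ℕ) ]
    PolynomiallyBounded time
    × memory ∈O log²
    × bits ∈O log²
    × (∀ (n : ℕ) (G : Digraph n) (s t : Fin n) →
         RunsWithin M (encodeInput G s t) (time n) (memory n)
         × (Σ[ p ∈ AcceptingPath M (encodeInput G s t) ]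
              (∀ (p′ : AcceptingPath M (encodeInput G s t)) → p′ ≡ p)
              × (Σ[ W ∈ WeightFunction G ] Σ[ reachable ∈ Bool ]
                   EncodesOutput (result M (encodeInput G s t) p) W reachable
                   × bits n -bit W
                   × MinUnique G W
                   × (T reachable ⇔ Path G s t))))
theorem3 = compile mainP , timeOf mainP , (λ n → widthOf (lgOf n) + 3) , (λ n → widthOf (lgOf n)) ,
  time-polynomial mainP , width-log² ,
  (let c , n₀ , bound = width-log² in c , n₀ , λ n n≥ → ≤-trans (m≤m+n _ 3) (bound n n≥)) ,
  λ n G s t → Main.theorem G s t
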